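{- Let $n\ge 2$, let $M,N\in\mathbb{Z}^{n-1}$ and let $D=(D_1,\dots,D_{n-1})$ be a tuple of positive integers. If $D_1,\dots,D_{n-1}$ are pairwise coprime, then the long Weyl element Kloosterman sums satisfy $$S_n(M,N;D)=\prod_{i=1}^{n-1}S_2(D_{i-1}M_iD_{i+1},N_i;D_i),$$ with the convention $D_0=1$ and $D_n=1$.
   Context: Definition of $S_n(M,N;D)$ for any $n\ge2$, $M,N\in\mathbb{Z}^{n-1}$ and $D$ an $(n-1)$-tuple of positive integers: $e(z)=e^{2\pi i z}$. $U$ is the group of upper triangular unipotent $n\times n$ matrices. For $N\in\mathbb{Z}^{n-1}$, $\psi_N$ is the character of $U(\mathbb{R})$, trivial on $U(\mathbb{Z})$, given by $\psi_N(u)=e(N_1u_{1,2}+N_2u_{2,3}+\cdots+N_{n-1}u_{n-1,n})$. For $M\in \mathbb{Z}^{n-1}$, $\tilde M=(M_{n-1},\dots,M_1)$. Let $w_0$ be the long Weyl element: the $n\times n$ matrix whose only nonzero entries are on the anti-diagonal, the entry at position $(n-k+1,k)$ being $(-1)^{k-1}$ ($1\le k\le n$). Let $c=\mathrm{Diag}(1/D_{n-1},\,D_{n-1}/D_{n-2},\dots,D_2/D_1,\,D_1)$, $C(c)=U(\mathbb{R})\,c\,w_0\,U(\mathbb{R})\cap SL(n,\mathbb{Z})$ and $X(c)=U(\mathbb{Z})\backslash C(c)/U(\mathbb{Z})$. Each $\gamma\in C(c)$ is uniquely $\gamma=b_1cw_0b_2$ with $b_1,b_2\in U(\mathbb{R})$;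 set $\mu(\gamma)=b_1\in U(\mathbb{Z})\backslash U(\mathbb{R})$ and $\mu'(\gamma)=b_2\in U(\mathbb{R})/U(\mathbb{Z})$. Then $$S_n(M,N;D)=\sum_{x\in X(c)}\psi_{\tilde M}(\mu(x))\,\psi_N(\mu'(x)).$$ For $n=2$ the arguments are integers (1-tuples). -}

module Defs where

open import Algebra.Bundles using (CommutativeRing)
open import Algebra.Morphism.Structures using (IsRingMonomorphism)
import Algebra.Properties.CommutativeMonoid.Sum as Sum
import Algebra.Properties.Semiring.Exp as Exp
open import Data.Bool.Base using (if_then_else_)
open import Data.Fin.Base using (Fin; zero; suc; toℕ; inject₁; opposite; punchIn; _<_)
open import Data.Fin.Properties using (_≟_)
open import Data.Integer.Base as ℤ using (ℤ; +_)
open import Data.Integer.Properties as ℤ using ()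
open import Data.Nat.Base using (ℕ; zero; suc; NonZero)
open import Data.Product.Base using (_×_; ∃₂)
open import Data.Rational.Base as ℚ using (ℚ; _/_)
open import Data.Vec.Functional using (Vector; reverse)
open import Function.Base using (_∘_)
open import Function.Definitions using (Bijective)
open import Level using (Level; _⊔_) renaming (suc to lsuc)
open import Relation.Binary.PropositionalEquality.Core using (_≡_)
open import Relation.Nullary.Decidable.Core using (does)

private
  variable
    A : Set
    n r : ℕ

record ℕ⁺ : Set where
  constructor pos
  field
    value : ℕ
    .{{nonZero}} : NonZero value

open ℕ⁺ public using (value)

_÷_ : ℕ⁺ → ℕ⁺ → ℚ
pos p ÷ pos q = (+ p) / q

⟨_⟩ : A → Vector A 1
⟨ x ⟩ _ = x

_∷ʳ_ : Vector A r → A → Vector A (suc r)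
_∷ʳ_ {r = zero}  xs y _       = y
_∷ʳ_ {r = suc r} xs y zero    = xs zero
_∷ʳ_ {r = suc r} xs y (suc i) = ((xs ∘ suc) ∷ʳ y) i

-- (D₀ , D₁ , … , Dᵣ , Dᵣ₊₁) with D₀ = Dᵣ₊₁ = 1.  The tuple D itself is
-- indexed from 0, so that D i is the entry of index 1 + toℕ i here.
padded : Vector ℕ⁺ r → Vector ℕ⁺ (suc (suc r))
padded D zero    = pos 1
padded D (suc i) = (D ∷ʳ pos 1) i

-- For the entry Dₖ, k = 1 + toℕ i: the integer Dₖ₋₁ · m · Dₖ₊₁.
twist : Vector ℕ⁺ r → Fin r → ℤ → ℤ
twist D i m =
  + value (padded D (inject₁ (inject₁ i))) ℤ.* m ℤ.* + value (padded D (suc (suc i)))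

Matrix : ∀ {a} → Set a → ℕ → Set a
Matrix A n = Vector (Vector A n) n

mapᴹ : ∀ {a b} {A : Set a} {B : Set b} → (A → B) → Matrix A n → Matrix B n
mapᴹ f X i j = f (X i j)

module MatrixOver {a ℓ} (R : CommutativeRing a ℓ) where
  open CommutativeRing R hiding (zero)
  open Sum +-commutativeMonoid using (sum)
  open Exp semiring using (_^_)

  infix  4 _≋_
  infixl 7 _⊗_

  _≋_ : Matrix Carrier n → Matrix Carrier n → Set ℓ
  X ≋ Y = ∀ i j → X i j ≈ Y i j

  _⊗_ : Matrix Carrier n → Matrix Carrier n → Matrix Carrier n
  (X ⊗ Y) i j = sum λ k → X i k * Y k j

  diag : Vector Carrier n → Matrix Carrier n
  diag d i j = if does (i ≟ j) then d i else 0#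

  -- In 1-based indices the entry at (n - k + 1 , k) is (-1)ᵏ⁻¹.
  w₀ : Matrix Carrier n
  w₀ i j = if does (i ≟ opposite j) then (- 1#) ^ toℕ j else 0#

  -- Laplace expansion along the first row.
  det : Matrix Carrier n → Carrier
  det {zero}  X = 1#
  det {suc n} X =
    sum λ j → (- 1#) ^ toℕ j * X zero j * det (λ i k → X (suc i) (punchIn j k))

  record Unipotent (u : Matrix Carrier n) : Set ℓ where
    field
      diagonal : ∀ i → u i i ≈ 1#
      below    : ∀ {i j} → j < i → u i j ≈ 0#

module ℤᴹ = MatrixOver ℤ.+-*-commutativeRing

-- The properties of the real numbers, the complex numbers and the function
-- z ↦ e(z) = exp(2πiz) that enter the definition of Kloosterman sums.
-- The fields named ℝ and ℂ may be any commutative rings with this structure;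
-- the actual real and complex numbers are an instance.
record Exponential (a ℓ b m : Level) : Set (lsuc (a ⊔ ℓ ⊔ b ⊔ m)) where
  field
    ℝ : CommutativeRing a ℓ
    ℂ : CommutativeRing b m

  module ℝ = CommutativeRing ℝ
  module ℂ = CommutativeRing ℂ

  field
    fromℚ               : ℚ → ℝ.Carrier
    fromℚ-monomorphism  : IsRingMonomorphism ℚ.+-*-rawRing ℝ.rawRing fromℚ
    e                   : ℝ.Carrier → ℂ.Carrier
    e-cong              : ∀ {x y} → x ℝ.≈ y → e x ℂ.≈ e y
    e-homo              : ∀ x y → e (x ℝ.+ y) ℂ.≈ e x ℂ.* e y
    e-periodic          : ∀ (z : ℤ) → e (fromℚ (z / 1)) ℂ.≈ ℂ.1#

  fromℤ : ℤ → ℝ.Carrier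
  fromℤ z = fromℚ (z / 1)

-- Throughout, r = n - 1.
module Kloosterman {a ℓ b m} (𝔼 : Exponential a ℓ b m) where
  open Exponential 𝔼
  module ℝᴹ = MatrixOver ℝ
  open Sum ℝ.+-commutativeMonoid using () renaming (sum to ∑ℝ)
  open Sum ℂ.+-commutativeMonoid using () renaming (sum to ∑)
  open Sum ℂ.*-commutativeMonoid public using () renaming (sum to ∏)

  ψ : Vector ℤ r → Matrix ℝ.Carrier (suc r) → ℂ.Carrier
  ψ N u = e (∑ℝ λ i → fromℤ (N i) ℝ.* u (inject₁ i) (suc i))

  -- Diag(1/Dᵣ , Dᵣ/Dᵣ₋₁ , … , D₂/D₁ , D₁): the j-th entry, counted from 0,
  -- is Dₖ₊₁/Dₖ with k = r - j.
  c : Vector ℕ⁺ r → Matrix ℝ.Carrier (suc r)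
  c D = ℝᴹ.diag λ j →
    fromℚ (padded D (suc (opposite j)) ÷ padded D (inject₁ (opposite j)))

  -- The elements of C(c).  Since b₁ and b₂ are determined by γ, carrying
  -- them as data does not add elements.
  record Cell (D : Vector ℕ⁺ r) : Set (a ⊔ ℓ) where
    field
      γ             : Matrix ℤ (suc r)
      det≡1         : ℤᴹ.det γ ≡ ℤ.1ℤ
      b₁ b₂         : Matrix ℝ.Carrier (suc r)
      b₁-unipotent  : ℝᴹ.Unipotent b₁
      b₂-unipotent  : ℝᴹ.Unipotent b₂
      decomposition : mapᴹ fromℤ γ ℝᴹ.≋ b₁ ℝᴹ.⊗ c D ℝᴹ.⊗ ℝᴹ.w₀ ℝᴹ.⊗ b₂

  open Cell

  -- Equality in X(c) = U(ℤ) \ C(c) / U(ℤ).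
  _∼_ : {D : Vector ℕ⁺ r} → Cell D → Cell D → Set
  x ∼ y = ∃₂ λ u v →
    ℤᴹ.Unipotent u × ℤᴹ.Unipotent v × (γ y ℤᴹ.≋ u ℤᴹ.⊗ γ x ℤᴹ.⊗ v)

  -- A proof that X(c) is finite: a system of representatives, each double
  -- coset being hit exactly once.
  record Enumeration (D : Vector ℕ⁺ r) : Set (a ⊔ ℓ) where
    field
      size      : ℕ
      element   : Fin size → Cell D
      bijective : Bijective _≡_ _∼_ element

  open Enumeration

  -- The sum over X(c), computed along a given enumeration of it.
  S : Vector ℤ r → Vector ℤ r → {D : Vector ℕ⁺ r} → Enumeration D → ℂ.Carrier
  S M N X = ∑ λ k → ψ (reverse M) (b₁ (element X k)) ℂ.* ψ N (b₂ (element X k))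

-- Reversing the order of the rows turns a decomposition γ = b₁ c w₀ b₂ into a
-- factorization g = aᵀ d b with unipotent upper triangular a and b and with
-- d = diag(± Dₖ₊₁ / Dₖ).  Clearing the first row and column of g and passing to
-- a Schur complement shows, by induction on the size, that each such g is
-- equivalent, under unipotent integer matrices, to a tridiagonal matrix with
-- entries ± uₖ below and ± wₖ above the diagonal, where
-- Dₖ₋₁ uₖ wₖ ≡ Dₖ₊₁ (mod Dₖ).  In these terms Dₖ (b₁)ₙ₋ₖ,ₙ₋ₖ₊₁ ≡ Dₖ₋₁ uₖ and
-- Dₖ (b₂)ₖ,ₖ₊₁ ≡ Dₖ₋₁ wₖ modulo Dₖ.  As the factorization is unique,
-- x ↦ (Dₖ (b₂)ₖ,ₖ₊₁ mod Dₖ)ₖ is a bijection from X(c) to ∏ₖ (ℤ/Dₖ)ˣ.  The summand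
-- at x is the product over k of those of the n = 2 sums at the coordinates of x,
-- and the product of the n = 2 sums is expanded by distributivity.

module Submission where

open import Defs
open import Algebra.Bundles using (CommutativeRing)
import Algebra.Morphism.Construct.Composition as Composition
open import Algebra.Morphism.Structures using (IsRingMonomorphism)
import Algebra.Properties.CommutativeMonoid.Sum as CommutativeMonoidSum
import Algebra.Properties.Ring as RingProperties
import Algebra.Properties.Semiring.Exp as Exp
import Algebra.Properties.Semiring.Sum as SemiringSum
import Algebra.Solver.CommutativeMonoid as CommutativeMonoidSolver
import Algebra.Solver.Ring
open import Algebra.Solver.Ring.AlmostCommutativeRing using (_-Raw-AlmostCommutative⟶_; fromCommutativeRing)
open import Data.Bool.Base using (if_then_else_)
open import Data.Fin.Base using (Fin; zero; suc; combine; fromℕ; fromℕ<; inject₁; opposite; pinch; punchIn; remQuot; toℕ; _<_; _↑ˡ_; _↑ʳ_)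
open import Data.Fin.Permutation using (permutation) renaming (reverse to reverse-permutation)
open import Data.Fin.Properties using (_≟_; combine-remQuot; opposite-involutive; opposite-prop; remQuot-combine; suc-injective; toℕ-fromℕ; toℕ-fromℕ<; toℕ-injective; toℕ-inject₁; toℕ<n)
open import Data.Integer.Base as ℤ using (ℤ; +_; -[1+_]; 0ℤ; 1ℤ; -1ℤ)
import Data.Integer.DivMod as ℤ
import Data.Integer.Divisibility.Signed as ℤ
import Data.Integer.Properties as ℤ
open import Data.Integer.Solver using (module +-*-Solver)
import Data.Maybe.Base as Maybe
open import Data.Nat.Base as ℕ using (ℕ; zero; suc; _≤_; z<s; s<s; s≤s)
open import Data.Nat.Coprimality using (Coprime; coprime?; coprime-Bézout)
import Data.Nat.Divisibility as ℕ
open import Data.Nat.GCD using (module Bézout)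
import Data.Nat.Properties as ℕ
open import Data.Product.Base using (_×_; _,_; ∃; ∃₂; proj₁; proj₂)
open import Data.Rational.Base as ℚ using (ℚ)
import Data.Rational.Properties as ℚ
open import Data.Rational.Unnormalised.Base as ℚᵘ using (mkℚᵘ; *≡*)
import Data.Rational.Unnormalised.Properties as ℚᵘ
open import Data.Vec.Functional using (Vector; _∷_; reverse; tail; transpose)
open import Function.Base using (_∘_)
open import Level using (_⊔_)
open import Relation.Binary.Bundles using (Setoid)
open import Relation.Binary.Definitions using (WeaklyDecidable)
open import Relation.Binary.PropositionalEquality as ≡ using (_≡_; _≢_)
import Relation.Binary.Reasoning.Setoid as SetoidReasoning
open import Relation.Nullary.Decidable using (does; yes; no)
open import Relation.Nullary.Negation using (contradiction)
open import Relation.Unary using (Pred; Decidable)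

-- Clearing works because `Dₖ₊₁` is the corner of the next Schur complement: if `x` and `y` are the
-- entries below and to the right of the corner `Dₖ`, then `x y ≡ Dₖ₊₁` modulo `Dₖ`, so by
-- coprimality both are units. The obstacle is the way back: an equivalence of Schur complements has
-- to be extended to integral matrices acting on `g`. Conjugation by the row factors keeps the left
-- matrix integral, but the right one extends only if `Dₖ` divides the first row of `ν` off the
-- diagonal; coprimality is used here a second time. The twist comes from the coordinates `Uₖ` and
-- `Vₖ` of a cell, the superdiagonal entries of the two factors multiplied by `Dₖ`: their product is
-- `Dₖ₋₁ Dₖ₊₁` modulo `Dₖ`, while for n = 2 it is 1. Equal `Vₖ` thus forces `Uₖ` to be `Dₖ₋₁ Dₖ₊₁`
-- times its counterpart. Since ℝ is only a ring containing ℚ, congruences are obtained through the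
-- injectivity of `fromℤ`. A cell built from prescribed coordinates must moreover be shown to have
-- determinant 1, which accounts for the part on determinants.

private
  variable
    n r : ℕ

-- Matrices over a commutative ring: unipotent inverses, the two-sided action, uniqueness of
-- triangular factorizations

minor : ∀ {a} {A : Set a} → Matrix A (suc n) → Matrix A n
minor X i j = X (suc i) (suc j)

module MatrixAlgebra {c ℓ} (R : CommutativeRing c ℓ) where
  open CommutativeRing R hiding (zero)
  open MatrixOver R public
  open CommutativeMonoidSum +-commutativeMonoid using (sum; sum-cong-≋; ∑-comm; ∑-distrib-+; sum-replicate-zero) public
  open SemiringSum semiring using (*-distribˡ-sum; *-distribʳ-sum) public
  infix 30 _ᵀ

  _ᵀ : Matrix Carrier n → Matrix Carrier n
  X ᵀ = transpose X

  ≋-refl : {X : Matrix Carrier n} → X ≋ X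
  ≋-refl i j = refl

  ≋-sym : {X Y : Matrix Carrier n} → X ≋ Y → Y ≋ X
  ≋-sym X≋Y i j = sym (X≋Y i j)

  ≋-trans : {X Y Z : Matrix Carrier n} → X ≋ Y → Y ≋ Z → X ≋ Z
  ≋-trans X≋Y Y≋Z i j = trans (X≋Y i j) (Y≋Z i j)

  ≋-setoid : ℕ → Setoid _ _
  ≋-setoid n = record
    { Carrier       = Matrix Carrier n
    ; _≈_           = _≋_
    ; isEquivalence = record { refl = ≋-refl ; sym = ≋-sym ; trans = ≋-trans }
    }

  sum-≈0 : {f : Vector Carrier n} → (∀ k → f k ≈ 0#) → sum f ≈ 0#
  sum-≈0 {n} f≈0 = trans (sum-cong-≋ f≈0) (sum-replicate-zero n)

  +0 : ∀ {x y} → y ≈ 0# → x + y ≈ x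
  +0 y≈0 = trans (+-congˡ y≈0) (+-identityʳ _)

  0+ : ∀ {x y} → x ≈ 0# → x + y ≈ y
  0+ x≈0 = trans (+-congʳ x≈0) (+-identityˡ _)

  *0 : ∀ {x y} → y ≈ 0# → x * y ≈ 0#
  *0 y≈0 = trans (*-congˡ y≈0) (zeroʳ _)

  0* : ∀ {x y} → x ≈ 0# → x * y ≈ 0#
  0* x≈0 = trans (*-congʳ x≈0) (zeroˡ _)

  1* : ∀ {x y} → x ≈ 1# → x * y ≈ y
  1* x≈1 = trans (*-congʳ x≈1) (*-identityˡ _)

  *1 : ∀ {x y} → y ≈ 1# → x * y ≈ x
  *1 y≈1 = trans (*-congˡ y≈1) (*-identityʳ _)

  sum-head : (f : Vector Carrier (suc n)) → (∀ k → f (suc k) ≈ 0#) → sum f ≈ f zero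
  sum-head f f≈0 = +0 (sum-≈0 {f = tail f} f≈0)

  ⊗-cong : {X X′ Y Y′ : Matrix Carrier n} → X ≋ X′ → Y ≋ Y′ → X ⊗ Y ≋ X′ ⊗ Y′
  ⊗-cong X≋X′ Y≋Y′ i j = sum-cong-≋ λ k → *-cong (X≋X′ i k) (Y≋Y′ k j)

  ⊗-assoc : (X Y Z : Matrix Carrier n) → (X ⊗ Y) ⊗ Z ≋ X ⊗ (Y ⊗ Z)
  ⊗-assoc X Y Z i j = begin
    sum (λ k → sum (λ l → X i l * Y l k) * Z k j)
      ≈⟨ sum-cong-≋ (λ k → *-distribʳ-sum (Z k j) (λ l → X i l * Y l k)) ⟩
    sum (λ k → sum (λ l → X i l * Y l k * Z k j))
      ≈⟨ ∑-comm (λ k l → X i l * Y l k * Z k j) ⟩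
    sum (λ l → sum (λ k → X i l * Y l k * Z k j))
      ≈⟨ sum-cong-≋ (λ l → sum-cong-≋ λ k → *-assoc (X i l) (Y l k) (Z k j)) ⟩
    sum (λ l → sum (λ k → X i l * (Y l k * Z k j)))
      ≈⟨ sum-cong-≋ (λ l → *-distribˡ-sum (X i l) (λ k → Y l k * Z k j)) ⟨
    sum (λ l → X i l * sum (λ k → Y l k * Z k j)) ∎
    where open SetoidReasoning setoid

  ⊗-transpose : (X Y : Matrix Carrier n) → (X ⊗ Y) ᵀ ≋ Y ᵀ ⊗ X ᵀ
  ⊗-transpose X Y i j = sum-cong-≋ λ k → *-comm (X j k) (Y k i)

  1ᴹ : Matrix Carrier n
  1ᴹ zero    zero    = 1#
  1ᴹ zero    (suc j) = 0#
  1ᴹ (suc i) zero    = 0#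
  1ᴹ (suc i) (suc j) = 1ᴹ i j

  ⊗-identityˡ : (X : Matrix Carrier n) → 1ᴹ ⊗ X ≋ X
  ⊗-identityˡ X i j = column i (λ k → X k j)
    where
    column : ∀ {n} (i : Fin n) (x : Vector Carrier n) → sum (λ k → 1ᴹ i k * x k) ≈ x i
    column zero    x = trans (sum-head (λ k → 1ᴹ zero k * x k) (λ k → zeroˡ (x (suc k)))) (*-identityˡ _)
    column (suc i) x = trans (0+ (zeroˡ _)) (column i (tail x))

  1ᴹ-transpose : 1ᴹ {n} ᵀ ≋ 1ᴹ
  1ᴹ-transpose zero    zero    = refl
  1ᴹ-transpose zero    (suc j) = refl
  1ᴹ-transpose (suc i) zero    = refl
  1ᴹ-transpose (suc i) (suc j) = 1ᴹ-transpose i j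

  ⊗-identityʳ : (X : Matrix Carrier n) → X ⊗ 1ᴹ ≋ X
  ⊗-identityʳ {n} X i j = (begin
    (X ⊗ 1ᴹ) ᵀ    ≈⟨ ⊗-transpose X 1ᴹ ⟩
    1ᴹ ᵀ ⊗ X ᵀ    ≈⟨ ⊗-cong 1ᴹ-transpose ≋-refl ⟩
    1ᴹ ⊗ X ᵀ      ≈⟨ ⊗-identityˡ (X ᵀ) ⟩
    X ᵀ           ∎) j i
    where open SetoidReasoning (≋-setoid n)

  open Unipotent public

  unipotent-minor : {u : Matrix Carrier (suc n)} → Unipotent u → Unipotent (minor u)
  unipotent-minor U = record
    { diagonal = diagonal U ∘ suc
    ; below    = λ j<i → below U (s<s j<i)
    }

  unipotent-column : {u : Matrix Carrier (suc n)} → Unipotent u → ∀ i → u (suc i) zero ≈ 0#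
  unipotent-column U i = below U z<s

  unipotent-∷ : {u : Matrix Carrier (suc n)} → u zero zero ≈ 1# → (∀ i → u (suc i) zero ≈ 0#) →
                Unipotent (minor u) → Unipotent u
  unipotent-∷ head column U = record
    { diagonal = λ { zero → head ; (suc i) → diagonal U i }
    ; below    = λ { {suc i} {zero} _ → column i ; {suc i} {suc j} (s≤s j<i) → below U j<i }
    }

  unipotent-cong : {u v : Matrix Carrier n} → u ≋ v → Unipotent u → Unipotent v
  unipotent-cong u≋v U = record
    { diagonal = λ i → trans (sym (u≋v i i)) (diagonal U i)
    ; below    = λ j<i → trans (sym (u≋v _ _)) (below U j<i)
    }

  1ᴹ-unipotent : Unipotent (1ᴹ {n})
  1ᴹ-unipotent {zero}  = record { diagonal = λ () ; below = λ { {()} } }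
  1ᴹ-unipotent {suc n} = unipotent-∷ refl (λ i → refl) 1ᴹ-unipotent

  module _ {u : Matrix Carrier (suc n)} (U : Unipotent u) (v : Matrix Carrier (suc n)) where
    unipotent-⊗-below : ∀ i j → (u ⊗ v) (suc i) j ≈ sum (λ k → u (suc i) (suc k) * v (suc k) j)
    unipotent-⊗-below i j = 0+ (0* (unipotent-column U i))

  module _ (u : Matrix Carrier (suc n)) {v : Matrix Carrier (suc n)} (V : Unipotent v) where
    ⊗-unipotent-column : ∀ i → (u ⊗ v) i zero ≈ u i zero
    ⊗-unipotent-column i = trans
      (sum-head (λ k → u i k * v k zero) (λ k → *0 (unipotent-column V k))) (*1 (diagonal V zero))

  ⊗-unipotent : {u v : Matrix Carrier n} → Unipotent u → Unipotent v → Unipotent (u ⊗ v)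
  ⊗-unipotent {zero}                  U V = record { diagonal = λ () ; below = λ { {()} } }
  ⊗-unipotent {suc n} {u = u} {v = v} U V = unipotent-∷
    (trans (⊗-unipotent-column u V zero) (diagonal U zero))
    (λ i → trans (⊗-unipotent-column u V (suc i)) (unipotent-column U i))
    (unipotent-cong (λ i j → sym (unipotent-⊗-below U v i (suc j)))
      (⊗-unipotent (unipotent-minor U) (unipotent-minor V)))

  -- Between row `inject₁ k` of `u` and column `suc k` of `v` only the two terms at these indices
  -- survive. By this additivity an integral change of representative shifts the superdiagonal by
  -- integers.
  ⊗-superdiagonal : {u v : Matrix Carrier (suc r)} → Unipotent u → Unipotent v → ∀ k →
    (u ⊗ v) (inject₁ k) (suc k) ≈ u (inject₁ k) (suc k) + v (inject₁ k) (suc k)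
  ⊗-superdiagonal {u = u} {v} U V zero = begin
    u zero zero * v zero (suc zero) +
      (u zero (suc zero) * v (suc zero) (suc zero) + sum (λ k → u zero (suc (suc k)) * v (suc (suc k)) (suc zero)))
        ≈⟨ +-cong (1* (diagonal U zero))
            (trans (sum-head (λ k → u zero (suc k) * v (suc k) (suc zero)) (λ k → *0 (below V (s<s z<s))))
                   (*1 (diagonal V (suc zero)))) ⟩
    v zero (suc zero) + u zero (suc zero) ≈⟨ +-comm _ _ ⟩
    u zero (suc zero) + v zero (suc zero) ∎
    where open SetoidReasoning setoid
  ⊗-superdiagonal {u = u} {v} U V (suc k) =
    trans (unipotent-⊗-below U v (inject₁ k) (suc (suc k)))
          (⊗-superdiagonal (unipotent-minor U) (unipotent-minor V) k)

  -- Block inversion: if `u` has first row (1, ρ) and its minor has the inverse `v`, then the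
  -- inverse of `u` has first row (1, - ρ v).
  unipotent-inverseʳ : {u : Matrix Carrier n} → Unipotent u → ∃ λ v → Unipotent v × u ⊗ v ≋ 1ᴹ
  unipotent-inverseʳ {zero}          U = 1ᴹ , 1ᴹ-unipotent , λ ()
  unipotent-inverseʳ {suc n} {u = u} U with unipotent-inverseʳ (unipotent-minor U)
  ... | v , V , uv≋1 = v̂ , V̂ , u⊗v̂≋1
    where
    v̂ : Matrix Carrier (suc n)
    v̂ zero    zero    = 1#
    v̂ zero    (suc j) = - sum (λ k → u zero (suc k) * v k j)
    v̂ (suc i) zero    = 0#
    v̂ (suc i) (suc j) = v i j

    V̂ : Unipotent v̂
    V̂ = unipotent-∷ refl (λ i → refl) V

    u⊗v̂≋1 : u ⊗ v̂ ≋ 1ᴹ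
    u⊗v̂≋1 zero    zero    = trans (⊗-unipotent-column u V̂ zero) (diagonal U zero)
    u⊗v̂≋1 (suc i) zero    = trans (⊗-unipotent-column u V̂ (suc i)) (unipotent-column U i)
    u⊗v̂≋1 zero    (suc j) = trans (+-congʳ (1* (diagonal U zero))) (-‿inverseˡ _)
    u⊗v̂≋1 (suc i) (suc j) = trans (unipotent-⊗-below U v̂ i (suc j)) (uv≋1 i j)

  -- The right inverse `v` has a right inverse `w` of its own, and `u = u (v w) = (u v) w = w` makes
  -- `v` two-sided.
  unipotent-inverse : {u : Matrix Carrier n} → Unipotent u →
                      ∃ λ v → Unipotent v × u ⊗ v ≋ 1ᴹ × v ⊗ u ≋ 1ᴹ
  unipotent-inverse {u = u} U =
    let v , V , uv≋1 = unipotent-inverseʳ U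
        w , W , vw≋1 = unipotent-inverseʳ V
        u≋w : u ≋ w
        u≋w = begin
          u             ≈⟨ ⊗-identityʳ u ⟨
          u ⊗ 1ᴹ        ≈⟨ ⊗-cong ≋-refl vw≋1 ⟨
          u ⊗ (v ⊗ w)   ≈⟨ ⊗-assoc u v w ⟨
          u ⊗ v ⊗ w     ≈⟨ ⊗-cong uv≋1 ≋-refl ⟩
          1ᴹ ⊗ w        ≈⟨ ⊗-identityˡ w ⟩
          w             ∎
    in v , V , uv≋1 , ≋-trans (⊗-cong ≋-refl u≋w) vw≋1
    where open SetoidReasoning (≋-setoid _)

  -- Reversing rows turns left multiplication by an upper unipotent matrix into left multiplication
  -- by a lower one. The latter is written as a transpose, so that `Unipotent` serves on both sides.
  act : Matrix Carrier n → Matrix Carrier n → Matrix Carrier n → Matrix Carrier n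
  act μ g ν = μ ᵀ ⊗ (g ⊗ ν)

  act-cong : (μ : Matrix Carrier n) {g g′ : Matrix Carrier n} (ν : Matrix Carrier n) →
             g ≋ g′ → act μ g ν ≋ act μ g′ ν
  act-cong μ ν g≋g′ = ⊗-cong ≋-refl (⊗-cong g≋g′ ≋-refl)

  act-act : (μ μ′ g ν ν′ : Matrix Carrier n) →
            act μ′ (act μ g ν) ν′ ≋ act (μ ⊗ μ′) g (ν ⊗ ν′)
  act-act μ μ′ g ν ν′ = begin
    μ′ ᵀ ⊗ (μ ᵀ ⊗ (g ⊗ ν) ⊗ ν′)   ≈⟨ ⊗-cong ≋-refl (⊗-assoc (μ ᵀ) (g ⊗ ν) ν′) ⟩
    μ′ ᵀ ⊗ (μ ᵀ ⊗ (g ⊗ ν ⊗ ν′))   ≈⟨ ⊗-assoc (μ′ ᵀ) (μ ᵀ) (g ⊗ ν ⊗ ν′) ⟨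
    μ′ ᵀ ⊗ μ ᵀ ⊗ (g ⊗ ν ⊗ ν′)     ≈⟨ ⊗-cong (≋-sym (⊗-transpose μ μ′)) (⊗-assoc g ν ν′) ⟩
    (μ ⊗ μ′) ᵀ ⊗ (g ⊗ (ν ⊗ ν′))   ∎
    where open SetoidReasoning (≋-setoid _)

  infix 4 _≃_

  record _≃_ (g g′ : Matrix Carrier n) : Set (c ⊔ ℓ) where
    constructor acting
    field
      {μ ν}       : Matrix Carrier n
      μ-unipotent : Unipotent μ
      ν-unipotent : Unipotent ν
      action      : g′ ≋ act μ g ν

  ≃-trans : {g g′ g″ : Matrix Carrier n} → g ≃ g′ → g′ ≃ g″ → g ≃ g″
  ≃-trans {g = g} (acting {μ} {ν} U V g′≋) (acting {μ′} {ν′} U′ V′ g″≋) =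
    acting (⊗-unipotent U U′) (⊗-unipotent V V′)
    (≋-trans g″≋ (≋-trans (act-cong μ′ ν′ g′≋) (act-act μ μ′ g ν ν′)))

  act-identity : (g : Matrix Carrier n) → act 1ᴹ g 1ᴹ ≋ g
  act-identity g = ≋-trans (⊗-cong 1ᴹ-transpose (⊗-identityʳ g)) (⊗-identityˡ g)

  ≋⇒≃ : {g g′ : Matrix Carrier n} → g ≋ g′ → g ≃ g′
  ≋⇒≃ {g = g} g≋g′ =
    acting 1ᴹ-unipotent 1ᴹ-unipotent (≋-trans (≋-sym g≋g′) (≋-sym (act-identity g)))

  ≃-sym : {g g′ : Matrix Carrier n} → g ≃ g′ → g′ ≃ g
  ≃-sym {g = g} {g′} (acting {μ} {ν} U V g′≋)
    with unipotent-inverse U | unipotent-inverse V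
  ... | μ′ , U′ , μμ′≋1 , _ | ν′ , V′ , νν′≋1 , _ = acting U′ V′ (≋-sym (begin
    act μ′ g′ ν′             ≈⟨ act-cong μ′ ν′ g′≋ ⟩
    act μ′ (act μ g ν) ν′    ≈⟨ act-act μ μ′ g ν ν′ ⟩
    act (μ ⊗ μ′) g (ν ⊗ ν′)  ≈⟨ ⊗-cong (λ i j → μμ′≋1 j i) (⊗-cong ≋-refl νν′≋1) ⟩
    act 1ᴹ g 1ᴹ              ≈⟨ act-identity g ⟩
    g                        ∎))
    where open SetoidReasoning (≋-setoid _)

  scaleRows : Vector Carrier n → Matrix Carrier n → Matrix Carrier n
  scaleRows d X i j = d i * X i j

  -- The diagonal matrix between the two triangular factors is absorbed as a scaling of rows.
  ldu : Matrix Carrier n → Vector Carrier n → Matrix Carrier n → Matrix Carrier n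
  ldu a d b = a ᵀ ⊗ scaleRows d b

  scaleRows-⊗ : (d : Vector Carrier n) (b ν : Matrix Carrier n) →
                scaleRows d b ⊗ ν ≋ scaleRows d (b ⊗ ν)
  scaleRows-⊗ d b ν k j = begin
    sum (λ l → d k * b k l * ν l j)   ≈⟨ sum-cong-≋ (λ l → *-assoc (d k) (b k l) (ν l j)) ⟩
    sum (λ l → d k * (b k l * ν l j)) ≈⟨ *-distribˡ-sum (d k) (λ l → b k l * ν l j) ⟨
    d k * sum (λ l → b k l * ν l j)   ∎
    where open SetoidReasoning setoid

  act-ldu : (μ a : Matrix Carrier n) (d : Vector Carrier n) (b ν : Matrix Carrier n) →
            act μ (ldu a d b) ν ≋ ldu (a ⊗ μ) d (b ⊗ ν)
  act-ldu μ a d b ν = begin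
    μ ᵀ ⊗ (a ᵀ ⊗ scaleRows d b ⊗ ν)   ≈⟨ ⊗-cong ≋-refl (⊗-assoc (a ᵀ) (scaleRows d b) ν) ⟩
    μ ᵀ ⊗ (a ᵀ ⊗ (scaleRows d b ⊗ ν)) ≈⟨ ⊗-assoc (μ ᵀ) (a ᵀ) (scaleRows d b ⊗ ν) ⟨
    μ ᵀ ⊗ a ᵀ ⊗ (scaleRows d b ⊗ ν)   ≈⟨ ⊗-cong (≋-sym (⊗-transpose a μ)) (scaleRows-⊗ d b ν) ⟩
    ldu (a ⊗ μ) d (b ⊗ ν)             ∎
    where open SetoidReasoning (≋-setoid _)

  ldu-row : {a b : Matrix Carrier (suc n)} (d : Vector Carrier (suc n)) → Unipotent a →
            ∀ j → ldu a d b zero j ≈ d zero * b zero j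
  ldu-row {a = a} {b} d A j = trans
    (sum-head (λ k → a k zero * (d k * b k j)) (λ k → 0* (unipotent-column A k))) (1* (diagonal A zero))

  ldu-column : {a b : Matrix Carrier (suc n)} (d : Vector Carrier (suc n)) → Unipotent b →
               ∀ i → ldu a d b i zero ≈ a zero i * d zero
  ldu-column {a = a} {b} d B i = trans
    (sum-head (λ k → a k i * (d k * b k zero)) (λ k → *0 (*0 (unipotent-column B k))))
    (*-congˡ (*1 (diagonal B zero)))

  *-cancelˡ-inverse : ∀ {x y z z⁻¹} → z * z⁻¹ ≈ 1# → z * x ≈ z * y → x ≈ y
  *-cancelˡ-inverse {x} {y} {z} {z⁻¹} zz⁻¹≈1 zx≈zy = begin
    x              ≈⟨ 1* (trans (*-comm z⁻¹ z) zz⁻¹≈1) ⟨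
    z⁻¹ * z * x    ≈⟨ *-assoc z⁻¹ z x ⟩
    z⁻¹ * (z * x)  ≈⟨ *-congˡ zx≈zy ⟩
    z⁻¹ * (z * y)  ≈⟨ *-assoc z⁻¹ z y ⟨
    z⁻¹ * z * y    ≈⟨ 1* (trans (*-comm z⁻¹ z) zz⁻¹≈1) ⟩
    y              ∎
    where open SetoidReasoning setoid

  +-cancelˡ : ∀ {x y z} → z + x ≈ z + y → x ≈ y
  +-cancelˡ {x} {y} {z} eq = begin
    x              ≈⟨ 0+ (-‿inverseˡ z) ⟨
    - z + z + x    ≈⟨ +-assoc (- z) z x ⟩
    - z + (z + x)  ≈⟨ +-congˡ eq ⟩
    - z + (z + y)  ≈⟨ +-assoc (- z) z y ⟨
    - z + z + y    ≈⟨ 0+ (-‿inverseˡ z) ⟩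
    y              ∎
    where open SetoidReasoning setoid

  -- The first row of the product is `d zero` times that of `b`, and its first column gives the
  -- first row of `a` in the same way. Cancelling the rank one contribution of these rows leaves the
  -- same equation for the minors.
  ldu-unique : {a b a′ b′ : Matrix Carrier n} {d d⁻¹ : Vector Carrier n} →
    (∀ k → d k * d⁻¹ k ≈ 1#) →
    Unipotent a → Unipotent b → Unipotent a′ → Unipotent b′ →
    ldu a d b ≋ ldu a′ d b′ → a ≋ a′ × b ≋ b′
  ldu-unique {zero} inv A B A′ B′ eq = (λ ()) , λ ()
  ldu-unique {suc n} {a} {b} {a′} {b′} {d} inv A B A′ B′ eq = a≋a′ , b≋b′
    where
    b-row : ∀ j → b zero j ≈ b′ zero j
    b-row j = *-cancelˡ-inverse (inv zero)
      (trans (sym (ldu-row {a = a} {b} d A j)) (trans (eq zero j) (ldu-row {a = a′} {b′} d A′ j)))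

    a-row : ∀ i → a zero i ≈ a′ zero i
    a-row i = *-cancelˡ-inverse (inv zero) (trans (*-comm _ _) (trans
      (trans (sym (ldu-column {a = a} {b = b} d B i)) (trans (eq i zero) (ldu-column {a = a′} {b = b′} d B′ i))) (*-comm _ _)))

    minors : minor a ≋ minor a′ × minor b ≋ minor b′
    minors = ldu-unique (inv ∘ suc)
      (unipotent-minor A) (unipotent-minor B) (unipotent-minor A′) (unipotent-minor B′)
      λ i j → +-cancelˡ (trans (eq (suc i) (suc j))
        (+-congʳ (sym (*-cong (a-row (suc i)) (*-congˡ (b-row (suc j)))))))

    a≋a′ : a ≋ a′
    a≋a′ zero    j       = a-row j
    a≋a′ (suc i) zero    = trans (unipotent-column A i) (sym (unipotent-column A′ i))
    a≋a′ (suc i) (suc j) = proj₁ minors i j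

    b≋b′ : b ≋ b′
    b≋b′ zero    j       = b-row j
    b≋b′ (suc i) zero    = trans (unipotent-column B i) (sym (unipotent-column B′ i))
    b≋b′ (suc i) (suc j) = proj₂ minors i j

-- Determinants: Cramer's rule, unipotent factors, antitriangular matrices

-- (punchIn j l , pinch l j) is the pair (j , l) of distinct columns in the
-- opposite order, the second column being counted among those left.
punchIn-pinch : (j : Fin (suc n)) (l : Fin n) → punchIn (punchIn j l) (pinch l j) ≡ j
punchIn-pinch zero    zero    = ≡.refl
punchIn-pinch zero    (suc l) = ≡.refl
punchIn-pinch (suc j) zero    = ≡.refl
punchIn-pinch (suc j) (suc l) = ≡.cong suc (punchIn-pinch j l)

-- Makes the second minors in a double expansion independent of the order in which two columns are
-- deleted.
punchIn-punchIn : (j : Fin (suc (suc n))) (l : Fin (suc n)) (q : Fin n) →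
  punchIn (punchIn j l) (punchIn (pinch l j) q) ≡ punchIn j (punchIn l q)
punchIn-punchIn zero    l       q       = ≡.refl
punchIn-punchIn (suc j) zero    q       = ≡.refl
punchIn-punchIn (suc j) (suc l) zero    = ≡.refl
punchIn-punchIn (suc j) (suc l) (suc q) = ≡.cong suc (punchIn-punchIn j l q)

punchIn-fromℕ : (k : Fin n) → punchIn (fromℕ n) k ≡ inject₁ k
punchIn-fromℕ zero    = ≡.refl
punchIn-fromℕ (suc k) = ≡.cong suc (punchIn-fromℕ k)

module Determinant {c ℓ} (R : CommutativeRing c ℓ) where
  open CommutativeRing R hiding (zero)
  open MatrixAlgebra R
  open CommutativeMonoidSum +-commutativeMonoid using (sum-init-last)
  open CommutativeMonoidSum *-commutativeMonoid using () renaming (sum to product)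
  open RingProperties ring using (-‿distribˡ-*; -‿distribʳ-*; -‿+-comm; -0#≈0#; -‿involutive; -1*x≈-x)
  open Exp semiring using (_^_)
  open CommutativeMonoidSolver *-commutativeMonoid using (solve; _⊕_; _⊜_)
  open SetoidReasoning setoid

  sign : Fin n → Carrier
  sign i = (- 1#) ^ toℕ i

  sum-neg : (f : Vector Carrier n) → sum (λ k → - f k) ≈ - sum f
  sum-neg {zero}  f = sym -0#≈0#
  sum-neg {suc n} f = trans (+-congˡ (sum-neg (tail f))) (-‿+-comm _ _)

  -- Exchanging the members of each pair swaps the row and the column of pairs that contain 0; the
  -- remaining pairs form the same sum one size smaller.
  ∑∑-transpose : (G : Fin (suc n) → Fin n → Carrier) →
    sum (λ j → sum (G j)) ≈ sum (λ j → sum λ l → G (punchIn j l) (pinch l j))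
  ∑∑-transpose {zero}  G = refl
  ∑∑-transpose {suc n} G = begin
    row + sum (λ j → G (suc j) zero + sum (λ l → G (suc j) (suc l)))
      ≈⟨ +-congˡ (∑-distrib-+ (λ j → G (suc j) zero) (λ j → sum λ l → G (suc j) (suc l))) ⟩
    row + (column + sum (λ j → sum λ l → G (suc j) (suc l)))
      ≈⟨ +-congˡ (+-congˡ (∑∑-transpose (λ j l → G (suc j) (suc l)))) ⟩
    row + (column + rest)    ≈⟨ +-assoc row column rest ⟨
    row + column + rest      ≈⟨ +-congʳ (+-comm row column) ⟩
    column + row + rest      ≈⟨ +-assoc column row rest ⟩
    column + (row + rest)
      ≈⟨ +-congˡ (∑-distrib-+ (G zero) (λ j → sum λ l → G (suc (punchIn j l)) (suc (pinch l j)))) ⟨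
    column + sum (λ j → G zero j + sum (λ l → G (suc (punchIn j l)) (suc (pinch l j)))) ∎
    where
    row = sum (G zero)
    column = sum λ j → G (suc j) zero
    rest = sum λ j → sum λ l → G (suc (punchIn j l)) (suc (pinch l j))

  -- In a general ring a sum equal to its own negative need not vanish, so the terms are cancelled
  -- in pairs: those with first member 0 against those with second member 0, the others by
  -- induction.
  ∑∑-antisymmetric : (G : Fin (suc n) → Fin n → Carrier) →
    (∀ j l → G (punchIn j l) (pinch l j) ≈ - G j l) → sum (λ j → sum (G j)) ≈ 0#
  ∑∑-antisymmetric {zero}  G anti = +-identityʳ 0#
  ∑∑-antisymmetric {suc n} G anti = begin
    row + sum (λ j → G (suc j) zero + sum (λ l → G (suc j) (suc l)))
      ≈⟨ +-congˡ (∑-distrib-+ (λ j → G (suc j) zero) (λ j → sum λ l → G (suc j) (suc l))) ⟩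
    row + (sum (λ j → G (suc j) zero) + sum (λ j → sum λ l → G (suc j) (suc l)))
      ≈⟨ +-congˡ (+0 (∑∑-antisymmetric (λ j l → G (suc j) (suc l)) (λ j l → anti (suc j) (suc l)))) ⟩
    row + sum (λ j → G (suc j) zero)  ≈⟨ +-congˡ (sum-cong-≋ (anti zero)) ⟩
    row + sum (λ j → - G zero j)      ≈⟨ +-congˡ (sum-neg (G zero)) ⟩
    row + - row                       ≈⟨ -‿inverseʳ row ⟩
    0#                                ∎
    where
    row = sum (G zero)

  -- The sum of the two positions changes by exactly one, up or down according to which of the
  -- columns lies further left.
  sign-transpose : (j : Fin (suc n)) (l : Fin n) →
    sign (punchIn j l) * sign (pinch l j) ≈ - (sign j * sign l)
  sign-transpose {suc n} zero l = begin
    (- 1# * sign l) * 1#  ≈⟨ *-identityʳ _ ⟩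
    - 1# * sign l         ≈⟨ -‿distribˡ-* 1# (sign l) ⟨
    - (1# * sign l)       ∎
  sign-transpose (suc j) zero = begin
    1# * sign j               ≈⟨ -‿involutive _ ⟨
    - - (1# * sign j)         ≈⟨ -‿cong (-‿distribˡ-* 1# (sign j)) ⟩
    - (- 1# * sign j)         ≈⟨ -‿cong (*-identityʳ _) ⟨
    - (- 1# * sign j * 1#)    ∎
  sign-transpose (suc j) (suc l) = begin
    (- 1# * sign (punchIn j l)) * (- 1# * sign (pinch l j)) ≈⟨ interchange _ _ _ ⟩
    - 1# * - 1# * (sign (punchIn j l) * sign (pinch l j))   ≈⟨ *-congˡ (sign-transpose j l) ⟩
    - 1# * - 1# * - (sign j * sign l)                       ≈⟨ -‿distribʳ-* _ _ ⟨
    - (- 1# * - 1# * (sign j * sign l))                     ≈⟨ -‿cong (interchange _ _ _) ⟨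
    - ((- 1# * sign j) * (- 1# * sign l))                   ∎
    where
    interchange : ∀ x y z → (x * y) * (x * z) ≈ x * x * (y * z)
    interchange = solve 3 (λ x y z → ((x ⊕ y) ⊕ (x ⊕ z)) ⊜ ((x ⊕ x) ⊕ (y ⊕ z))) refl

  sign² : (i : Fin n) → sign i * sign i ≈ 1#
  sign² i = power (toℕ i)
    where
    power : ∀ k → (- 1#) ^ k * (- 1#) ^ k ≈ 1#
    power zero    = *-identityˡ 1#
    power (suc k) = begin
      (- 1# * (- 1#) ^ k) * (- 1# * (- 1#) ^ k)   ≈⟨ solve 2 (λ x y → ((x ⊕ y) ⊕ (x ⊕ y)) ⊜ ((x ⊕ x) ⊕ (y ⊕ y))) refl (- 1#) ((- 1#) ^ k) ⟩
      - 1# * - 1# * ((- 1#) ^ k * (- 1#) ^ k)     ≈⟨ *1 (power k) ⟩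
      - 1# * - 1#                                 ≈⟨ -1*x≈-x (- 1#) ⟩
      - - 1#                                      ≈⟨ -‿involutive 1# ⟩
      1#                                          ∎

  det-cong : {X Y : Matrix Carrier n} → X ≋ Y → det X ≈ det Y
  det-cong {zero}  X≋Y = refl
  det-cong {suc n} X≋Y = sum-cong-≋ λ j →
    *-cong (*-congˡ {x = sign j} (X≋Y zero j)) (det-cong λ i k → X≋Y (suc i) (punchIn j k))

  withoutColumn : (Fin n → Fin (suc r) → Carrier) → Fin (suc r) → Fin n → Fin r → Carrier
  withoutColumn Z j i k = Z i (punchIn j k)

  -- Cramer's rule: the signed maximal minors of an n × (n + 1) matrix form
  -- a vector in its kernel.
  det-kernel : (Z : Fin n → Fin (suc n) → Carrier) (k : Fin n) →
    sum (λ j → sign j * Z k j * det (withoutColumn Z j)) ≈ 0#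
  det-kernel {suc n} Z k = trans
    (sum-cong-≋ λ j → *-distribˡ-sum (sign j * Z k j) (λ l → sign l * Z zero (punchIn j l) * subdet j l)) (vanish k)
    where
    subdet : Fin (suc (suc n)) → Fin (suc n) → Carrier
    subdet j l = det (λ i q → Z (suc i) (punchIn j (punchIn l q)))

    term : Fin (suc n) → Fin (suc (suc n)) → Fin (suc n) → Carrier
    term k j l = sign j * Z k j * (sign l * Z zero (punchIn j l) * subdet j l)

    rearrange : ∀ a b c d e → a * b * (c * d * e) ≈ a * c * (b * d * e)
    rearrange = solve 5 (λ a b c d e → ((a ⊕ b) ⊕ ((c ⊕ d) ⊕ e)) ⊜ ((a ⊕ c) ⊕ ((b ⊕ d) ⊕ e))) refl

    term-transpose : ∀ k j l → term k (punchIn j l) (pinch l j) ≈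
      - (sign j * Z zero j * (sign l * Z k (punchIn j l) * subdet j l))
    term-transpose k j l = begin
      term k (punchIn j l) (pinch l j)
        ≈⟨ *-congˡ (*-cong (*-congˡ (reflexive (≡.cong (Z zero) (punchIn-pinch j l))))
             (det-cong λ i q → reflexive (≡.cong (Z (suc i)) (punchIn-punchIn j l q)))) ⟩
      sign (punchIn j l) * Z k (punchIn j l) * (sign (pinch l j) * Z zero j * subdet j l)
        ≈⟨ rearrange _ _ _ _ _ ⟩
      sign (punchIn j l) * sign (pinch l j) * (Z k (punchIn j l) * Z zero j * subdet j l)
        ≈⟨ *-cong (sign-transpose j l) (*-congʳ (*-comm _ _)) ⟩
      - (sign j * sign l) * (Z zero j * Z k (punchIn j l) * subdet j l)
        ≈⟨ -‿distribˡ-* _ _ ⟨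
      - (sign j * sign l * (Z zero j * Z k (punchIn j l) * subdet j l))
        ≈⟨ -‿cong (rearrange _ _ _ _ _) ⟨
      - (sign j * Z zero j * (sign l * Z k (punchIn j l) * subdet j l)) ∎

    vanish : ∀ k → sum (λ j → sum (term k j)) ≈ 0#
    -- For row 0 this is the double expansion of a matrix with a repeated row, antisymmetric in the
    -- two columns.
    vanish zero    = ∑∑-antisymmetric (term zero) (term-transpose zero)
    -- Exchanging the columns moves row 0 to the outer sum; the inner sum is the same identity for
    -- the other rows with column `j` deleted.
    vanish (suc k) = trans (∑∑-transpose (term (suc k))) (sum-≈0 λ j → begin
      sum (λ l → term (suc k) (punchIn j l) (pinch l j))
        ≈⟨ sum-cong-≋ (term-transpose (suc k) j) ⟩
      sum (λ l → - (sign j * Z zero j * (sign l * Z (suc k) (punchIn j l) * subdet j l)))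
        ≈⟨ sum-neg (λ l → sign j * Z zero j * (sign l * Z (suc k) (punchIn j l) * subdet j l)) ⟩
      - sum (λ l → sign j * Z zero j * (sign l * Z (suc k) (punchIn j l) * subdet j l))
        ≈⟨ -‿cong (*-distribˡ-sum (sign j * Z zero j) (λ l → sign l * Z (suc k) (punchIn j l) * subdet j l)) ⟨
      - (sign j * Z zero j * sum (λ l → sign l * Z (suc k) (punchIn j l) * subdet j l))
        ≈⟨ -‿cong (*0 (det-kernel (λ i l → Z (suc i) (punchIn j l)) k)) ⟩
      - 0#  ≈⟨ -0#≈0# ⟩
      0#    ∎)

  -- The minors along the first row are those of `X` by induction. The first row of `u ⊗ X` combines
  -- the rows of `X` with coefficients `u zero k`, and by `det-kernel` every row but the first
  -- contributes 0.
  det-unipotent-⊗ : {u : Matrix Carrier n} → Unipotent u → (X : Matrix Carrier n) → det (u ⊗ X) ≈ det X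
  det-unipotent-⊗ {zero}          U X = refl
  det-unipotent-⊗ {suc n} {u = u} U X = begin
    det (u ⊗ X)
      ≈⟨ sum-cong-≋ (λ j → *-congˡ {x = sign j * (u ⊗ X) zero j} (trans
           (det-cong λ i k → unipotent-⊗-below U X i (punchIn j k))
           (det-unipotent-⊗ (unipotent-minor U) (withoutColumn (tail X) j)))) ⟩
    sum (λ j → sign j * sum (λ k → u zero k * X k j) * m j)
      ≈⟨ sum-cong-≋ (λ j → trans (solve 3 (λ x y z → ((x ⊕ y) ⊕ z) ⊜ (y ⊕ (x ⊕ z))) refl _ _ _)
           (*-distribʳ-sum (sign j * m j) (λ k → u zero k * X k j))) ⟩
    sum (λ j → sum λ k → u zero k * X k j * (sign j * m j))
      ≈⟨ ∑-comm (λ j k → u zero k * X k j * (sign j * m j)) ⟩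
    sum (λ k → sum λ j → u zero k * X k j * (sign j * m j))
      ≈⟨ sum-cong-≋ (λ k → trans (sum-cong-≋ λ j → solve 4 (λ x y z w → ((x ⊕ y) ⊕ (z ⊕ w)) ⊜ (x ⊕ ((z ⊕ y) ⊕ w))) refl (u zero k) (X k j) (sign j) (m j))
           (sym (*-distribˡ-sum (u zero k) (λ j → sign j * X k j * m j)))) ⟩
    sum (λ k → u zero k * sum λ j → sign j * X k j * m j)
      ≈⟨ sum-head (λ k → u zero k * sum λ j → sign j * X k j * m j) (λ k → *0 (det-kernel (tail X) k)) ⟩
    u zero zero * det X  ≈⟨ 1* (diagonal U zero) ⟩
    det X                ∎
    where
    m : Fin (suc n) → Carrier
    m j = det (withoutColumn (tail X) j)

  -- Only the last entry of the first row is nonzero. Its sign, the one prescribed in `w₀`, equals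
  -- the sign of its position in the expansion, so the two cancel and no sign is left.
  det-antitriangular : (a : Vector Carrier n) (X : Matrix Carrier n) →
    (∀ i j → j < opposite i → X i j ≈ 0#) →
    (∀ i → X i (opposite i) ≈ a i * sign (opposite i)) →
    det X ≈ product a
  det-antitriangular {zero}  a X above antidiagonal = refl
  det-antitriangular {suc n} a X above antidiagonal = begin
    det X
      ≈⟨ sum-init-last (λ j → sign j * X zero j * det (withoutColumn (tail X) j)) ⟩
    sum (λ j → sign (inject₁ j) * X zero (inject₁ j) * det (withoutColumn (tail X) (inject₁ j)))
      + sign l * X zero l * det (withoutColumn (tail X) l)
      ≈⟨ 0+ (sum-≈0 {f = λ j → sign (inject₁ j) * X zero (inject₁ j) * det (withoutColumn (tail X) (inject₁ j))}
              λ j → 0* (*0 (above zero (inject₁ j) (inject₁<fromℕ j)))) ⟩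
    sign l * X zero l * det (withoutColumn (tail X) l)
      ≈⟨ *-cong (*-congˡ (antidiagonal zero)) (det-antitriangular (tail a) (withoutColumn (tail X) l)
           (λ i k k< → trans (column i k) (above (suc i) (inject₁ k) (inject₁-mono k< )))
           (λ i → trans (column i (opposite i)) (trans (antidiagonal (suc i))
             (*-congˡ (reflexive (≡.cong ((- 1#) ^_) (toℕ-inject₁ (opposite i)))))))) ⟩
    sign l * (a zero * sign l) * product (tail a)
      ≈⟨ *-congʳ (solve 2 (λ x y → (x ⊕ (y ⊕ x)) ⊜ ((x ⊕ x) ⊕ y)) refl (sign l) (a zero)) ⟩
    sign l * sign l * a zero * product (tail a)
      ≈⟨ *-congʳ (1* (sign² l)) ⟩
    a zero * product (tail a) ∎
    where
    l = fromℕ n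

    column : ∀ i k → X (suc i) (punchIn l k) ≈ X (suc i) (inject₁ k)
    column i k = reflexive (≡.cong (X (suc i)) (punchIn-fromℕ k))

    inject₁<fromℕ : ∀ (j : Fin n) → inject₁ j < fromℕ n
    inject₁<fromℕ j = ≡.subst₂ ℕ._<_ (≡.sym (toℕ-inject₁ j)) (≡.sym (toℕ-fromℕ n)) (toℕ<n j)

    inject₁-mono : ∀ {i j : Fin n} → i < j → inject₁ i < inject₁ j
    inject₁-mono {i} {j} = ≡.subst₂ ℕ._<_ (≡.sym (toℕ-inject₁ i)) (≡.sym (toℕ-inject₁ j))

-- Integer arithmetic: Bézout coefficients, congruences, residues

module IntegerArithmetic where
  open import Data.Integer.Base using (_+_; _*_; -_; _-_)
  open ≡ using (refl; sym; trans; cong; cong₂; subst; module ≡-Reasoning)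
  open +-*-Solver using (solve; con; _:=_; _:+_; _:*_; _:-_; :-_)

  ⟦_⟧ : ℕ⁺ → ℤ
  ⟦ p ⟧ = + value p

  ⟦⟧-cancelˡ : ∀ p {x y} → ⟦ p ⟧ * x ≡ ⟦ p ⟧ * y → x ≡ y
  ⟦⟧-cancelˡ (pos (suc p)) {x} {y} = ℤ.*-cancelˡ-≡ (+ suc p) x y

  -- Equations are proved by certificates: the difference of the two sides is an explicit linear
  -- combination of the differences of known equations, which the ring solver verifies.
  linear₁ : ∀ {x y l r} c → l ≡ r → x - y ≡ c * (l - r) → x ≡ y
  linear₁ {x} {y} {l} c refl eq = ℤ.i-j≡0⇒i≡j x y
    (trans eq (trans (cong (c *_) (ℤ.+-inverseʳ l)) (ℤ.*-zeroʳ c)))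

  private
    +-vanishʳ : ∀ x c l → x + c * (l - l) ≡ x
    +-vanishʳ = solve 3 (λ x c l → x :+ c :* (l :- l) := x) refl

  linear₂ : ∀ {x y l r l′ r′} c c′ → l ≡ r → l′ ≡ r′ →
            x - y ≡ c * (l - r) + c′ * (l′ - r′) → x ≡ y
  linear₂ {l = l} {r} {l′ = l′} c c′ l≡r refl eq = linear₁ c l≡r
    (trans eq (+-vanishʳ (c * (l - r)) c′ l′))

  linear₃ : ∀ {x y l r l′ r′ l″ r″} c c′ c″ → l ≡ r → l′ ≡ r′ → l″ ≡ r″ →
            x - y ≡ c * (l - r) + c′ * (l′ - r′) + c″ * (l″ - r″) → x ≡ y
  linear₃ {l = l} {r} {l′} {r′} {l″ = l″} c c′ c″ l≡r l′≡r′ refl eq = linear₂ c c′ l≡r l′≡r′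
    (trans eq (+-vanishʳ (c * (l - r) + c′ * (l′ - r′)) c″ l″))

  infix 4 _⊥_ _≡_mod_
  infix 3 _by_

  -- Coprimality with the Bézout coefficients as data: they become matrix entries in `clear-row` and
  -- inverses in `inverse-mod`.
  _⊥_ : ℤ → ℤ → Set
  i ⊥ j = ∃₂ λ s t → s * i + t * j ≡ 1ℤ

  coprime⇒⊥ : ∀ {m n} → Coprime m n → + m ⊥ + n
  coprime⇒⊥ {m} {n} c with coprime-Bézout c
  ... | Bézout.+- x y eq = + x , - + y , (begin
    + x * + m + - + y * + n           ≡⟨ cong (λ □ → □ + - + y * + n) (ℤ.pos-* x m) ⟨
    + (x ℕ.* m) + - + y * + n         ≡⟨ cong (λ □ → + □ + - + y * + n) eq ⟨
    1ℤ + + (y ℕ.* n) + - + y * + n    ≡⟨ cong (λ □ → 1ℤ + □ + - + y * + n) (ℤ.pos-* y n) ⟩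
    1ℤ + + y * + n + - + y * + n      ≡⟨ solve 2 (λ a b → con 1ℤ :+ a :* b :+ :- a :* b := con 1ℤ) refl (+ y) (+ n) ⟩
    1ℤ                                ∎)
    where open ≡-Reasoning
  ... | Bézout.-+ x y eq = - + x , + y , (begin
    - + x * + m + + y * + n           ≡⟨ cong (λ □ → - + x * + m + □) (ℤ.pos-* y n) ⟨
    - + x * + m + + (y ℕ.* n)         ≡⟨ cong (λ □ → - + x * + m + + □) eq ⟨
    - + x * + m + (1ℤ + + (x ℕ.* m))  ≡⟨ cong (λ □ → - + x * + m + (1ℤ + □)) (ℤ.pos-* x m) ⟩
    - + x * + m + (1ℤ + + x * + m)    ≡⟨ solve 2 (λ a b → :- a :* b :+ (con 1ℤ :+ a :* b) := con 1ℤ) refl (+ x) (+ m) ⟩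
    1ℤ                                ∎)
    where open ≡-Reasoning

  ⊥⇒coprime : ∀ {m n} → + m ⊥ + n → Coprime m n
  ⊥⇒coprime {m} {n} (s , t , eq) (ℕ.divides a refl , ℕ.divides b refl) =
    ℕ.∣1⇒≡1 (ℤ.∣⇒∣ᵤ (ℤ.divides (s * + a + t * + b) (trans (sym eq) (begin
      s * + (a ℕ.* d) + t * + (b ℕ.* d)   ≡⟨ cong₂ (λ x y → s * x + t * y) (ℤ.pos-* a d) (ℤ.pos-* b d) ⟩
      s * (+ a * + d) + t * (+ b * + d)   ≡⟨ solve 5 (λ s t a b d → s :* (a :* d) :+ t :* (b :* d) := (s :* a :+ t :* b) :* d) refl s t (+ a) (+ b) (+ d) ⟩
      (s * + a + t * + b) * + d           ∎))))
    where
    open ≡-Reasoning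
    d = _

  ⊥-sym : ∀ {i j} → i ⊥ j → j ⊥ i
  ⊥-sym {i} {j} (s , t , eq) = t , s , trans (ℤ.+-comm (t * j) (s * i)) eq

  ⊥-1ʳ : ∀ i → i ⊥ 1ℤ
  ⊥-1ʳ i = 0ℤ , 1ℤ , refl

  ⊥-* : ∀ {p i j} → p ⊥ i → p ⊥ j → p ⊥ i * j
  ⊥-* {p} {i} {j} (s , t , eq) (s′ , t′ , eq′) =
    s + t * i * s′ , t * t′ , linear₂ 1ℤ (t * i) eq eq′
      (solve 7 (λ p i j s t s′ t′ →
        (s :+ t :* i :* s′) :* p :+ t :* t′ :* (i :* j) :- con 1ℤ :=
        con 1ℤ :* (s :* p :+ t :* i :- con 1ℤ) :+ t :* i :* (s′ :* p :+ t′ :* j :- con 1ℤ))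
        refl p i j s t s′ t′)

  -- The quotient is kept as data because it is read as an entry of an integral unipotent matrix, or
  -- obtained from one.
  record _≡_mod_ (i j p : ℤ) : Set where
    constructor _by_
    field
      quotient : ℤ
      equality : i ≡ j + quotient * p

  mod-refl : ∀ {p i} → i ≡ i mod p
  mod-refl {p} {i} = 0ℤ by solve 2 (λ i p → i := i :+ con 0ℤ :* p) refl i p

  ≡⇒mod : ∀ {p i j} → i ≡ j → i ≡ j mod p
  ≡⇒mod refl = mod-refl

  mod-sym : ∀ {p i j} → i ≡ j mod p → j ≡ i mod p
  mod-sym {p} {i} {j} (t by eq) = (- t) by linear₁ (- 1ℤ) eq
    (solve 4 (λ p i j t → j :- (i :+ :- t :* p) := :- con 1ℤ :* (i :- (j :+ t :* p))) refl p i j t)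

  mod-trans : ∀ {p i j k} → i ≡ j mod p → j ≡ k mod p → i ≡ k mod p
  mod-trans {p} {i} {j} {k} (t by eq) (s by eq′) = (t + s) by linear₂ 1ℤ 1ℤ eq eq′
    (solve 6 (λ p i j k t s → i :- (k :+ (t :+ s) :* p) :=
      con 1ℤ :* (i :- (j :+ t :* p)) :+ con 1ℤ :* (j :- (k :+ s :* p))) refl p i j k t s)

  mod-* : ∀ {p i j i′ j′} → i ≡ j mod p → i′ ≡ j′ mod p → i * i′ ≡ j * j′ mod p
  mod-* {p} {i} {j} {i′} {j′} (t by refl) (s by refl) = (t * j′ + s * j + t * s * p) by
    solve 5 (λ p j j′ t s → (j :+ t :* p) :* (j′ :+ s :* p) :=
      j :* j′ :+ (t :* j′ :+ s :* j :+ t :* s :* p) :* p) refl p j j′ t s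

  mod-*ˡ : ∀ {p i j} k → i ≡ j mod p → k * i ≡ k * j mod p
  mod-*ˡ k = mod-* (mod-refl {i = k})

  -- The quotient comes from multiplying `i - j` by `s p + t k = 1`.
  mod-cancelˡ : ∀ {p k i j} → p ⊥ k → k * i ≡ k * j mod p → i ≡ j mod p
  mod-cancelˡ {p} {k} {i} {j} (s , t , eq) (q by eq′) = (t * q + s * (i - j)) by linear₂ (j - i) t eq eq′
    (solve 7 (λ p k i j s t q →
      i :- (j :+ (t :* q :+ s :* (i :- j)) :* p) :=
      (j :- i) :* (s :* p :+ t :* k :- con 1ℤ) :+ t :* (k :* i :- (k :* j :+ q :* p)))
      refl p k i j s t q)

  ⊥-mod : ∀ {p i j} → i ≡ j mod p → p ⊥ i → p ⊥ j
  ⊥-mod {p} {i} {j} (q by refl) (s , t , eq) = s + t * q , t , trans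
    (solve 5 (λ p j s t q → (s :+ t :* q) :* p :+ t :* j := s :* p :+ t :* (j :+ q :* p)) refl p j s t q) eq

  ⊥-factorˡ : ∀ {p} i {j} → p ⊥ i * j → p ⊥ i
  ⊥-factorˡ {p} i {j} (s , t , eq) = s , t * j , trans
    (solve 5 (λ p i j s t → s :* p :+ t :* j :* i := s :* p :+ t :* (i :* j)) refl p i j s t) eq

  ⊥-factorʳ : ∀ {p} i {j} → p ⊥ i * j → p ⊥ j
  ⊥-factorʳ {p} i {j} p⊥ij = ⊥-factorˡ j (subst (p ⊥_) (ℤ.*-comm i j) p⊥ij)

  inverse-mod : ∀ {p i} → p ⊥ i → ∃ λ j → i * j ≡ 1ℤ mod p
  inverse-mod {p} {i} (s , t , eq) = t , ((- s) by linear₁ 1ℤ eq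
    (solve 4 (λ p i s t → i :* t :- (con 1ℤ :+ :- s :* p) := con 1ℤ :* (s :* p :+ t :* i :- con 1ℤ)) refl p i s t))

  abstract
    divide-mod : ∀ {p i} → p ⊥ i → ∀ y → ∃ λ j → i * j ≡ y mod p
    divide-mod {p} {i} p⊥i y = let j , ij≡1 = inverse-mod p⊥i in
      y * j , mod-trans (≡⇒mod (solve 3 (λ i y j → i :* (y :* j) := y :* (i :* j)) refl i y j))
        (mod-trans (mod-*ˡ y ij≡1) (≡⇒mod (ℤ.*-identityʳ y)))

    -- Solves the equation of one tridiagonal step with `p * w` prescribed modulo `d`. Dividing `v`
    -- by the unit `p` gives `w`; then `p * w`, congruent to the unit `v`, can be divided into `c`
    -- to give `u`, and `z` is the remaining quotient.
    solve-equation : ∀ {d p v} c → d ⊥ p → d ⊥ v →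
      ∃₂ λ u w → ∃ λ z → p * w ≡ v mod d × p * u * w ≡ c + d * z
    solve-equation {d} {p} {v} c d⊥p d⊥v = step (divide-mod d⊥p v)
      where
      finish : ∀ w → p * w ≡ v mod d → (∃ λ u → p * w * u ≡ c mod d) →
        ∃₂ λ u w → ∃ λ z → p * w ≡ v mod d × p * u * w ≡ c + d * z
      finish w pw≡v (u , (z by eq)) = u , w , z , pw≡v , linear₁ 1ℤ eq
        (solve 6 (λ p u w c d z → p :* u :* w :- (c :+ d :* z) := con 1ℤ :* (p :* w :* u :- (c :+ z :* d)))
          refl p u w c d z)

      step : (∃ λ w → p * w ≡ v mod d) → ∃₂ λ u w → ∃ λ z → p * w ≡ v mod d × p * u * w ≡ c + d * z
      step (w , pw≡v) = finish w pw≡v (divide-mod (⊥-mod (mod-sym pw≡v) d⊥v) c)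

  Residue : ℕ⁺ → ℤ → Set
  Residue p i = ∃ λ k → i ≡ + k × k ℕ.< value p

  residue : ∀ p i → ∃ λ j → Residue p j × i ≡ j mod ⟦ p ⟧
  residue p@(pos m) i = _ , (i ℤ.%ℕ m , refl , ℤ.n%ℕd<d i m) , (i ℤ./ℕ m by ℤ.a≡a%ℕn+[a/ℕn]*n i m)

  residue-unique : ∀ p {i j} → Residue p i → Residue p j → i ≡ j mod ⟦ p ⟧ → i ≡ j
  residue-unique p (k , refl , k<p) (l , refl , l<p) ((+ zero) by eq) = trans eq (ℤ.+-identityʳ _)
  residue-unique p@(pos m) (k , refl , k<p) (l , refl , l<p) ((+ suc t) by eq) =
    contradiction k<p (ℕ.≤⇒≯ (begin
      m                      ≤⟨ ℕ.m≤m+n m (t ℕ.* m) ⟩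
      suc t ℕ.* m            ≤⟨ ℕ.m≤n+m (suc t ℕ.* m) l ⟩
      l ℕ.+ suc t ℕ.* m      ≡⟨ ℤ.+-injective (trans eq (cong (_+_ (+ l)) (sym (ℤ.pos-* (suc t) m)))) ⟨
      k                      ∎))
    where open ℕ.≤-Reasoning
  -- Exchanging the two residues makes a negative quotient positive.
  residue-unique p@(pos m) (k , refl , k<p) (l , refl , l<p) (-[1+ t ] by eq) =
    sym (residue-unique p (l , refl , l<p) (k , refl , k<p) (mod-sym (-[1+ t ] by eq)))

open IntegerArithmetic

-- Integer matrices: clearing a row and a column, lifting equivalences from a Schur complement

module IntegerMatrix where
  open import Data.Integer.Base using (_+_; _*_; -_; _-_)
  open ≡ using (refl; sym; trans; cong; cong₂; module ≡-Reasoning)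
  open +-*-Solver using (solve; con; _:=_; _:+_; _:*_; _:-_; :-_)
  open MatrixAlgebra ℤ.+-*-commutativeRing public

  -- A unipotent `ν` adds earlier columns to later ones. Since `s h₀ + t h₁ = 1`, subtracting `hⱼ`
  -- times the combination (s, t) of the first two columns removes `hⱼ`, and a multiple of the first
  -- column moves `h₁` to any member of its class modulo `h₀`.
  clear-row : (h : Vector ℤ (suc (suc n))) (y : ℤ) → h zero ⊥ h (suc zero) → h (suc zero) ≡ y mod h zero →
    ∃ λ ν → Unipotent ν × sum (λ l → h l * ν l (suc zero)) ≡ y ×
      (∀ j → sum (λ l → h l * ν l (suc (suc j))) ≡ 0ℤ)
  clear-row {n} h y (s , t , st) (q by h₁≡) = ν , N , column₁ , column
    where
    ν : Matrix ℤ (suc (suc n))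
    ν zero          zero          = 1ℤ
    ν zero          (suc zero)    = - q
    ν zero          (suc (suc j)) = - (h (suc (suc j)) * s)
    ν (suc zero)    zero          = 0ℤ
    ν (suc zero)    (suc zero)    = 1ℤ
    ν (suc zero)    (suc (suc j)) = - (h (suc (suc j)) * t)
    ν (suc (suc i)) zero          = 0ℤ
    ν (suc (suc i)) (suc zero)    = 0ℤ
    ν (suc (suc i)) (suc (suc j)) = 1ᴹ i j

    N : Unipotent ν
    N = unipotent-∷ refl (λ { zero → refl ; (suc i) → refl })
      (unipotent-∷ refl (λ i → refl) 1ᴹ-unipotent)

    column₁ : sum (λ l → h l * ν l (suc zero)) ≡ y
    column₁ = trans
      (cong (λ □ → h zero * - q + □) (sum-head (λ l → h (suc l) * ν (suc l) (suc zero)) (λ l → ℤ.*-zeroʳ (h (suc (suc l))))))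
      (linear₁ 1ℤ h₁≡ (solve 4 (λ p q h₁ y →
        p :* :- q :+ h₁ :* con 1ℤ :- y := con 1ℤ :* (h₁ :- (y :+ q :* p))) refl (h zero) q (h (suc zero)) y))

    column : ∀ j → sum (λ l → h l * ν l (suc (suc j))) ≡ 0ℤ
    column j = trans
      (cong (λ □ → h zero * ν zero (suc (suc j)) + (h (suc zero) * ν (suc zero) (suc (suc j)) + □))
        -- The rest of the column is a unit vector; the identity law for matrices applies once the
        -- row is repeated to a square matrix.
        (⊗-identityʳ (λ _ → tail (tail h)) j j))
      (linear₁ (- h (suc (suc j))) st (solve 5 (λ p h₁ hⱼ s t →
        p :* :- (hⱼ :* s) :+ (h₁ :* :- (hⱼ :* t) :+ hⱼ) :- con 0ℤ := :- hⱼ :* (s :* p :+ t :* h₁ :- con 1ℤ))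
        refl (h zero) (h (suc zero)) (h (suc (suc j))) s t))

  act-row : {μ : Matrix ℤ (suc n)} → Unipotent μ → (g ν : Matrix ℤ (suc n)) →
            ∀ j → act μ g ν zero j ≡ (g ⊗ ν) zero j
  act-row {μ = μ} U g ν j = trans
    (sum-head (λ k → μ k zero * (g ⊗ ν) k j) (λ k → 0* (unipotent-column U k))) (1* (diagonal U zero))

  act-column : (μ g : Matrix ℤ (suc n)) {ν : Matrix ℤ (suc n)} → Unipotent ν →
               ∀ i → act μ g ν i zero ≡ sum (λ k → g k zero * μ k i)
  act-column μ g {ν} V i = sum-cong-≋ λ k →
    trans (cong (μ k i *_) (⊗-unipotent-column g V k)) (ℤ.*-comm (μ k i) (g k zero))

  record FirstRowColumn (p y x : ℤ) (g : Matrix ℤ (suc (suc n))) : Set where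
    field
      corner  : g zero zero ≡ p
      row₁    : g zero (suc zero) ≡ y
      row     : ∀ j → g zero (suc (suc j)) ≡ 0ℤ
      column₁ : g (suc zero) zero ≡ x
      column  : ∀ i → g (suc (suc i)) zero ≡ 0ℤ

  -- In `act μ g ν` the first row depends on `ν` alone and the first column on `μ` alone, so the two
  -- are cleared independently.
  clear : {p y x : ℤ} (g : Matrix ℤ (suc (suc n))) → g zero zero ≡ p →
    p ⊥ g zero (suc zero) → g zero (suc zero) ≡ y mod p →
    p ⊥ g (suc zero) zero → g (suc zero) zero ≡ x mod p →
    ∃ λ g′ → g ≃ g′ × FirstRowColumn p y x g′
  clear g refl p⊥y y≡ p⊥x x≡ =
    let ν , V , ν₁ , ν₂ = clear-row (g zero) _ p⊥y y≡
        μ , U , μ₁ , μ₂ = clear-row (λ k → g k zero) _ p⊥x x≡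
    in act μ g ν , acting U V ≋-refl , record
      { corner  = trans (act-row U g ν zero) (⊗-unipotent-column g V zero)
      ; row₁    = trans (act-row U g ν (suc zero)) ν₁
      ; row     = λ j → trans (act-row U g ν (suc (suc j))) (ν₂ j)
      ; column₁ = trans (act-column μ g V (suc zero)) μ₁
      ; column  = λ i → trans (act-column μ g V (suc (suc i))) (μ₂ i)
      }

  -- Γ is the Schur complement of the corner p of g, its first row being
  -- multiplied by - p and the other rows by - 1.
  record Schur (p : ℤ) (g : Matrix ℤ (suc (suc n))) (Γ : Matrix ℤ (suc n)) : Set where
    field
      corner : g zero zero ≡ p
      column : ∀ i → g (suc (suc i)) zero ≡ 0ℤ
      top    : ∀ j → p * g (suc zero) (suc j) ≡ g (suc zero) zero * g zero (suc j) - Γ zero j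
      rest   : ∀ i j → g (suc (suc i)) (suc j) ≡ - Γ (suc i) j

  -- The factor `- p` clears the denominator, which after the column is cleared occurs in the first
  -- row only. The signs are those that turn the remaining pivots into the pivots of the shorter
  -- tuple, so the new corner is its first entry and positive.
  schur : (p : ℤ) (g : Matrix ℤ (suc (suc n))) → Matrix ℤ (suc n)
  schur p g zero    j = g (suc zero) zero * g zero (suc j) - p * g (suc zero) (suc j)
  schur p g (suc i) j = - g (suc (suc i)) (suc j)

  schur-Schur : ∀ {p y x} {g : Matrix ℤ (suc (suc n))} → FirstRowColumn p y x g → Schur p g (schur p g)
  schur-Schur {p = p} {g = g} F = record
    { corner = corner
    ; column = column
    ; top    = λ j → solve 2 (λ a b → a := b :- (b :- a)) refl (p * g (suc zero) (suc j)) (g (suc zero) zero * g zero (suc j))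
    ; rest   = λ i j → sym (ℤ.neg-involutive _)
    }
    where open FirstRowColumn F

  -- Undoing the row factors conjugates the left matrix, whose first row merely acquires a factor
  -- `p` off the diagonal; the same factor lets the first column stay cleared. The right matrix
  -- receives a new first row `σ`, which must compensate `y` times the first row of `ν` by multiples
  -- of `p`. This needs `p` to divide that row off the diagonal, a consequence of `p` being coprime
  -- to the corner of `Γ`.
  lift-≃ : ∀ (p : ℕ⁺) {y x} {g k : Matrix ℤ (suc (suc n))} {Γ κ : Matrix ℤ (suc n)} →
    FirstRowColumn ⟦ p ⟧ y x g → FirstRowColumn ⟦ p ⟧ y x k →
    Schur ⟦ p ⟧ g Γ → Schur ⟦ p ⟧ k κ → ⟦ p ⟧ ⊥ Γ zero zero → Γ ≃ κ → g ≃ k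
  lift-≃ {n} p⁺ {y} {x} {g} {k} {Γ} {κ} G K Γ-schur κ-schur p⊥Γ₀₀ (acting {μ} {ν} U V κ≋) =
    acting Û V̂ k≋
    where
    module G = FirstRowColumn G
    module K = FirstRowColumn K
    module Γ = Schur Γ-schur
    module κ = Schur κ-schur
    p = ⟦ p⁺ ⟧

    e : Vector ℤ (suc n)
    e zero    = y
    e (suc j) = 0ℤ

    k-row : ∀ j → k zero (suc j) ≡ e j
    k-row zero    = K.row₁
    k-row (suc j) = K.row j

    multiple : ∀ {g : Matrix ℤ (suc (suc n))} {Γ} → FirstRowColumn p y x g → Schur p g Γ →
      ∀ j → Γ zero (suc j) ≡ - g (suc zero) (suc (suc j)) * p
    multiple {g} {Γ} F S j = linear₂ 1ℤ (g (suc zero) zero)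
      (Schur.top S (suc j)) (FirstRowColumn.row F j)
      (solve 5 (λ γ p g₁ x g₀ → γ :- :- g₁ :* p := con 1ℤ :* (p :* g₁ :- (x :* g₀ :- γ)) :+ x :* (g₀ :- con 0ℤ))
        refl (Γ zero (suc j)) p (g (suc zero) (suc (suc j))) (g (suc zero) zero) (g zero (suc (suc j))))

    κ-row : ∀ j → κ zero j ≡ (Γ ⊗ ν) zero j
    κ-row j = trans (κ≋ zero j) (act-row U Γ ν j)

    -- Modulo p the first rows of Γ and of κ are multiples of the first unit
    -- vector, so p divides the entries of the first row of ν off the diagonal.
    ν-divisible : ∀ j → ∃ λ s → ν zero (suc j) ≡ s * p
    ν-divisible j = let s by eq = mod-cancelˡ p⊥Γ₀₀ (q by Γν≡) in s , trans eq (ℤ.+-identityˡ (s * p))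
      where
      m = λ l → g (suc zero) (suc (suc l)) * ν (suc l) (suc j)
      q = sum m - k (suc zero) (suc (suc j))

      tail-sum : sum (λ l → Γ zero (suc l) * ν (suc l) (suc j)) ≡ - p * sum m
      tail-sum = trans
        (sum-cong-≋ λ l → trans (cong (_* ν (suc l) (suc j)) (multiple G Γ-schur l))
          (solve 3 (λ a b p → :- a :* p :* b := :- p :* (a :* b)) refl (g (suc zero) (suc (suc l))) (ν (suc l) (suc j)) p))
        (sym (*-distribˡ-sum (- p) m))

      Γν≡ : Γ zero zero * ν zero (suc j) ≡ Γ zero zero * 0ℤ + q * p
      Γν≡ = linear₃ 1ℤ (- 1ℤ) (- 1ℤ) (multiple K κ-schur j) (κ-row (suc j)) tail-sum
        (solve 7 (λ a v κ t k₁ p m → a :* v :- (a :* con 0ℤ :+ (m :- k₁) :* p) :=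
          con 1ℤ :* (κ :- :- k₁ :* p) :+ :- con 1ℤ :* (κ :- (a :* v :+ t)) :+ :- con 1ℤ :* (t :- :- p :* m))
          refl (Γ zero zero) (ν zero (suc j)) (κ zero (suc j)) (sum (λ l → Γ zero (suc l) * ν (suc l) (suc j)))
            (k (suc zero) (suc (suc j))) p (sum m))

    -- Column `suc j` of `g ⊗ ν̂` begins with `p * σ j + y * ν zero j`, which has to be the cleared
    -- row `e`.
    σ : Vector ℤ (suc n)
    σ zero    = 0ℤ
    σ (suc j) = - (y * proj₁ (ν-divisible j))

    σ-eq : ∀ j → p * σ j + y * ν zero j ≡ e j
    σ-eq zero    = linear₁ y (diagonal V zero)
      (solve 3 (λ p y v → p :* con 0ℤ :+ y :* v :- y := y :* (v :- con 1ℤ)) refl p y (ν zero zero))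
    σ-eq (suc j) = linear₁ y (proj₂ (ν-divisible j))
      (solve 4 (λ p y v s → p :* :- (y :* s) :+ y :* v :- con 0ℤ := y :* (v :- s :* p)) refl
        p y (ν zero (suc j)) (proj₁ (ν-divisible j)))

    -- The minor of `μ̂` is `μ` conjugated by the row factors. The entries `- (x * μ zero (suc i))`
    -- above it cancel what its entries `p * μ zero (suc i)` bring into the first column, where row
    -- 0 holds `p` and row 1 holds `x`.
    ν̂ μ̂ : Matrix ℤ (suc (suc n))
    ν̂ zero    zero    = 1ℤ
    ν̂ zero    (suc j) = σ j
    ν̂ (suc l) zero    = 0ℤ
    ν̂ (suc l) (suc j) = ν l j
    μ̂ zero          zero          = 1ℤ
    μ̂ zero          (suc zero)    = 0ℤ
    μ̂ zero          (suc (suc i)) = - (x * μ zero (suc i))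
    μ̂ (suc l)       zero          = 0ℤ
    μ̂ (suc zero)    (suc zero)    = 1ℤ
    μ̂ (suc (suc l)) (suc zero)    = 0ℤ
    μ̂ (suc zero)    (suc (suc i)) = p * μ zero (suc i)
    μ̂ (suc (suc l)) (suc (suc i)) = μ (suc l) (suc i)

    V̂ : Unipotent ν̂
    V̂ = unipotent-∷ refl (λ i → refl) V

    Û : Unipotent μ̂
    Û = unipotent-∷ refl (λ i → refl) (unipotent-∷ refl (λ i → refl) (unipotent-minor U))

    h : Matrix ℤ (suc (suc n))
    h = g ⊗ ν̂

    h-zero : ∀ j → h zero (suc j) ≡ e j
    h-zero j = trans
      (cong₂ _+_ (cong (_* σ j) G.corner) (trans
        (sum-head (λ l → g zero (suc l) * ν l j) (λ l → 0* (G.row l)))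
        (cong (_* ν zero j) G.row₁)))
      (σ-eq j)

    g₀ g₁ : Fin (suc n) → ℤ
    g₀ j = sum (λ l → g zero (suc l) * ν l j)
    g₁ j = sum (λ l → g (suc zero) (suc l) * ν l j)

    p*g₁ : ∀ j → p * g₁ j ≡ g (suc zero) zero * g₀ j + - 1ℤ * (Γ ⊗ ν) zero j
    p*g₁ j = begin
      p * g₁ j
        ≡⟨ *-distribˡ-sum p (λ l → g (suc zero) (suc l) * ν l j) ⟩
      sum (λ l → p * (g (suc zero) (suc l) * ν l j))
        ≡⟨ sum-cong-≋ {x = λ l → p * (g (suc zero) (suc l) * ν l j)}
             {y = λ l → g (suc zero) zero * (g zero (suc l) * ν l j) + - 1ℤ * (Γ zero l * ν l j)} (λ l → linear₁ (ν l j) (Γ.top l)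
             (solve 6 (λ p g v x g₀ γ → p :* (g :* v) :- (x :* (g₀ :* v) :+ :- con 1ℤ :* (γ :* v)) :=
               v :* (p :* g :- (x :* g₀ :- γ))) refl
               p (g (suc zero) (suc l)) (ν l j) (g (suc zero) zero) (g zero (suc l)) (Γ zero l))) ⟩
      sum (λ l → g (suc zero) zero * (g zero (suc l) * ν l j) + - 1ℤ * (Γ zero l * ν l j))
        ≡⟨ ∑-distrib-+ (λ l → g (suc zero) zero * (g zero (suc l) * ν l j)) (λ l → - 1ℤ * (Γ zero l * ν l j)) ⟩
      sum (λ l → g (suc zero) zero * (g zero (suc l) * ν l j)) + sum (λ l → - 1ℤ * (Γ zero l * ν l j))
        ≡⟨ cong₂ _+_ (*-distribˡ-sum (g (suc zero) zero) (λ l → g zero (suc l) * ν l j))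
             (*-distribˡ-sum (- 1ℤ) (λ l → Γ zero l * ν l j)) ⟨
      g (suc zero) zero * g₀ j + - 1ℤ * (Γ ⊗ ν) zero j ∎
      where open ≡-Reasoning

    h-one : ∀ j → p * h (suc zero) (suc j) ≡ x * e j - κ zero j
    h-one j = linear₃ 1ℤ x 1ℤ
      (trans (p*g₁ j) (cong (λ □ → g (suc zero) zero * g₀ j + - 1ℤ * □) (sym (κ-row j))))
      (trans (cong (λ □ → □ * σ j + g₀ j) (sym G.corner)) (h-zero j))
      (cong (λ □ → □ * (p * σ j + g₀ j)) G.column₁)
      (solve 8 (λ p γ σ t x t₀ e κ → p :* (γ :* σ :+ t) :- (x :* e :- κ) :=
        con 1ℤ :* (p :* t :- (γ :* t₀ :+ :- con 1ℤ :* κ)) :+ x :* (p :* σ :+ t₀ :- e) :+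
          con 1ℤ :* (γ :* (p :* σ :+ t₀) :- x :* (p :* σ :+ t₀)))
        refl p (g (suc zero) zero) (σ j) (g₁ j) x (g₀ j) (e j) (κ zero j))

    h-rest : ∀ l j → h (suc (suc l)) (suc j) ≡ - 1ℤ * (Γ ⊗ ν) (suc l) j
    h-rest l j = trans (0+ (0* (G.column l))) (trans
      (sum-cong-≋ λ q → trans (cong (_* ν q j) (Γ.rest l q))
        (solve 2 (λ a b → :- a :* b := :- con 1ℤ :* (a :* b)) refl (Γ (suc l) q) (ν q j)))
      (sym (*-distribˡ-sum (- 1ℤ) (λ q → Γ (suc l) q * ν q j))))

    act-one : ∀ j → act μ̂ g ν̂ (suc zero) j ≡ h (suc zero) j
    act-one j = trans (ℤ.+-identityˡ _) (trans
      (sum-head (λ l → μ̂ (suc l) (suc zero) * h (suc l) j) (λ l → refl)) (ℤ.*-identityˡ _))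

    k≋ : k ≋ act μ̂ g ν̂
    k≋ zero zero = sym (trans (act-row Û g ν̂ zero)
      (trans (⊗-unipotent-column g V̂ zero) (trans G.corner (sym K.corner))))
    k≋ zero (suc j) = trans (k-row j) (sym (trans (act-row Û g ν̂ (suc j)) (h-zero j)))
    k≋ (suc zero) zero = sym (trans (act-one zero)
      (trans (⊗-unipotent-column g V̂ (suc zero)) (trans G.column₁ (sym K.column₁))))
    k≋ (suc zero) (suc j) = trans
      -- Row 1 of either side satisfies the Schur relation for `κ` with the same first row and
      -- column; the relation fixes `p` times the entry.
      (⟦⟧-cancelˡ p⁺ (trans (κ.top j) (trans
        (cong₂ (λ a b → a * b - κ zero j) K.column₁ (k-row j)) (sym (h-one j)))))
      (sym (act-one (suc j)))
    k≋ (suc (suc i)) zero = sym (begin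
      - (x * m) * h zero zero + (p * m * h (suc zero) zero + rest)
        ≡⟨ cong₂ (λ a b → - (x * m) * h zero zero + (p * m * a + b))
             (trans (⊗-unipotent-column g V̂ (suc zero)) G.column₁)
             (sum-≈0 {f = λ l → μ (suc l) (suc i) * h (suc (suc l)) zero} λ l →
               *0 {x = μ (suc l) (suc i)} (trans (⊗-unipotent-column g V̂ (suc (suc l))) (G.column l))) ⟩
      - (x * m) * h zero zero + (p * m * x + 0ℤ)
        ≡⟨ cong (λ □ → - (x * m) * □ + (p * m * x + 0ℤ)) (trans (⊗-unipotent-column g V̂ zero) G.corner) ⟩
      - (x * m) * p + (p * m * x + 0ℤ)
        ≡⟨ solve 3 (λ x m p → :- (x :* m) :* p :+ (p :* m :* x :+ con 0ℤ) := con 0ℤ) refl x m p ⟩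
      0ℤ  ≡⟨ K.column i ⟨
      k (suc (suc i)) zero ∎)
      where
      open ≡-Reasoning
      m = μ zero (suc i)
      rest = sum (λ l → μ (suc l) (suc i) * h (suc (suc l)) zero)
    k≋ (suc (suc i)) (suc j) = sym (begin
      - (x * m) * h zero (suc j) + (p * m * h (suc zero) (suc j) + sum (λ l → μ (suc l) (suc i) * h (suc (suc l)) (suc j)))
        ≡⟨ cong (λ □ → - (x * m) * h zero (suc j) + (p * m * h (suc zero) (suc j) + □)) (trans
             (sum-cong-≋ λ l → trans (cong (μ (suc l) (suc i) *_) (h-rest l j))
               (solve 2 (λ a b → a :* (:- con 1ℤ :* b) := :- con 1ℤ :* (a :* b)) refl (μ (suc l) (suc i)) ((Γ ⊗ ν) (suc l) j)))
             (sym (*-distribˡ-sum (- 1ℤ) (λ l → μ (suc l) (suc i) * (Γ ⊗ ν) (suc l) j)))) ⟩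
      - (x * m) * h zero (suc j) + (p * m * h (suc zero) (suc j) + - 1ℤ * rest)
        ≡⟨ linear₃ (- (x * m)) m (- m) (h-zero j) (h-one j) (κ-row j)
             (solve 9 (λ x m h₀ p h₁ r e κ γ →
               :- (x :* m) :* h₀ :+ (p :* m :* h₁ :+ :- con 1ℤ :* r) :- :- (m :* γ :+ r) :=
               :- (x :* m) :* (h₀ :- e) :+ m :* (p :* h₁ :- (x :* e :- κ)) :+ :- m :* (κ :- γ)) refl
               x m (h zero (suc j)) p (h (suc zero) (suc j)) rest (e j) (κ zero j) ((Γ ⊗ ν) zero j)) ⟩
      - (m * (Γ ⊗ ν) zero j + rest)  ≡⟨ cong -_ (κ≋ (suc i) j) ⟨
      - κ (suc i) j                  ≡⟨ κ.rest i j ⟨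
      k (suc (suc i)) (suc j) ∎)
      where
      open ≡-Reasoning
      m = μ zero (suc i)
      rest = sum (λ l → μ (suc l) (suc i) * (Γ ⊗ ν) (suc l) j)

-- Tridiagonal normal forms

module Tridiagonal where
  open import Data.Integer.Base using (_+_; _*_; -_; _-_)
  open IntegerMatrix
  open +-*-Solver using (solve; con; _:=_; _:+_; _:*_; _:-_; :-_)
  open ≡ using (refl)

  -- P₀ = 1 for P = padded D; the induction replaces P by its tail.
  tridiagonal : Vector ℕ⁺ (suc (suc r)) → (u w z : Vector ℤ r) → Matrix ℤ (suc r)
  tridiagonal {zero}  P u w z i                   j                   = ⟦ P (suc zero) ⟧
  tridiagonal {suc r} P u w z zero                zero                = ⟦ P (suc zero) ⟧
  tridiagonal {suc r} P u w z zero                (suc zero)          = ⟦ P zero ⟧ * w zero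
  tridiagonal {suc r} P u w z zero                (suc (suc j))       = 0ℤ
  tridiagonal {suc r} P u w z (suc zero)          zero                = u zero
  tridiagonal {suc r} P u w z (suc (suc i))       zero                = 0ℤ
  tridiagonal {suc r} P u w z (suc zero)          (suc zero)          = z zero
  -- The Schur step multiplies this entry by `- P₁`, which yields the entry `P₁ w₁` required next to
  -- the new corner.
  tridiagonal {suc r} P u w z (suc zero)          (suc (suc zero))    = - w (suc zero)
  tridiagonal {suc r} P u w z (suc zero)          (suc (suc (suc j))) = 0ℤ
  tridiagonal {suc r} P u w z (suc (suc i))       (suc j)             =
    - tridiagonal (tail P) (tail u) (tail w) (tail z) (suc i) j

  -- Says that each Schur step produces the right corner: `u k` times the entry `Pₖ w k` across the
  -- diagonal, minus `Pₖ₊₁ z k`, is `Pₖ₊₂`.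
  Equations : Vector ℕ⁺ (suc (suc r)) → (u w z : Vector ℤ r) → Set
  Equations P u w z = ∀ k →
    ⟦ P (inject₁ (inject₁ k)) ⟧ * u k * w k ≡ ⟦ P (suc (suc k)) ⟧ + ⟦ P (suc (inject₁ k)) ⟧ * z k

  tridiagonal-corner : (P : Vector ℕ⁺ (suc (suc r))) (u w z : Vector ℤ r) →
                       tridiagonal P u w z zero zero ≡ ⟦ P (suc zero) ⟧
  tridiagonal-corner {zero}  P u w z = refl
  tridiagonal-corner {suc r} P u w z = refl

  tridiagonal-firstRowColumn : (P : Vector ℕ⁺ (suc (suc (suc r)))) (u w z : Vector ℤ (suc r)) →
    FirstRowColumn ⟦ P (suc zero) ⟧ (⟦ P zero ⟧ * w zero) (u zero) (tridiagonal P u w z)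
  tridiagonal-firstRowColumn P u w z = record
    { corner = refl ; row₁ = refl ; row = λ j → refl ; column₁ = refl ; column = λ i → refl }

  -- The recursion in `tridiagonal` undoes a Schur step by definition; only the new corner calls for
  -- the equations.
  tridiagonal-schur : (P : Vector ℕ⁺ (suc (suc (suc r)))) (u w z : Vector ℤ (suc r)) → Equations P u w z →
    Schur ⟦ P (suc zero) ⟧ (tridiagonal P u w z) (tridiagonal (tail P) (tail u) (tail w) (tail z))
  tridiagonal-schur P u w z eqs = record
    { corner = refl ; column = λ i → refl ; top = top P u w z eqs ; rest = λ i j → refl }
    where
    top : ∀ {r} (P : Vector ℕ⁺ (suc (suc (suc r)))) (u w z : Vector ℤ (suc r)) → Equations P u w z →
      ∀ j → ⟦ P (suc zero) ⟧ * tridiagonal P u w z (suc zero) (suc j) ≡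
        u zero * tridiagonal P u w z zero (suc j) - tridiagonal (tail P) (tail u) (tail w) (tail z) zero j
    top P u w z eqs zero = linear₂ -1ℤ 1ℤ (eqs zero) (tridiagonal-corner (tail P) (tail u) (tail w) (tail z))
      (solve 7 (λ p z u q w c t → p :* z :- (u :* (q :* w) :- t) :=
        con -1ℤ :* (q :* u :* w :- (c :+ p :* z)) :+ con 1ℤ :* (t :- c)) refl
        ⟦ P (suc zero) ⟧ (z zero) (u zero) ⟦ P zero ⟧ (w zero) ⟦ P (suc (suc zero)) ⟧
        (tridiagonal (tail P) (tail u) (tail w) (tail z) zero zero))
    top {suc r} P u w z eqs (suc zero) =
      solve 3 (λ p w u → p :* :- w :=  u :* con 0ℤ :- p :* w) refl ⟦ P (suc zero) ⟧ (w (suc zero)) (u zero)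
    top {suc r} P u w z eqs (suc (suc j)) =
      solve 2 (λ p u → p :* con 0ℤ := u :* con 0ℤ :- con 0ℤ) refl ⟦ P (suc zero) ⟧ (u zero)

  tridiagonal-cong : (P : Vector ℕ⁺ (suc (suc r))) {u u′ w w′ z z′ : Vector ℤ r} →
    (∀ k → u k ≡ u′ k) → (∀ k → w k ≡ w′ k) → (∀ k → z k ≡ z′ k) →
    tridiagonal P u w z ≋ tridiagonal P u′ w′ z′
  tridiagonal-cong {zero}  P u≡ w≡ z≡ i                   j                   = refl
  tridiagonal-cong {suc r} P u≡ w≡ z≡ zero                zero                = refl
  tridiagonal-cong {suc r} P u≡ w≡ z≡ zero                (suc zero)          = ≡.cong (⟦ P zero ⟧ *_) (w≡ zero)
  tridiagonal-cong {suc r} P u≡ w≡ z≡ zero                (suc (suc j))       = refl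
  tridiagonal-cong {suc r} P u≡ w≡ z≡ (suc zero)          zero                = u≡ zero
  tridiagonal-cong {suc r} P u≡ w≡ z≡ (suc (suc i))       zero                = refl
  tridiagonal-cong {suc r} P u≡ w≡ z≡ (suc zero)          (suc zero)          = z≡ zero
  tridiagonal-cong {suc (suc r)} P u≡ w≡ z≡ (suc zero)    (suc (suc zero))    = ≡.cong -_ (w≡ (suc zero))
  tridiagonal-cong {suc (suc r)} P u≡ w≡ z≡ (suc zero)    (suc (suc (suc j))) = refl
  tridiagonal-cong {suc r} P u≡ w≡ z≡ (suc (suc i))       (suc j)             =
    ≡.cong -_ (tridiagonal-cong (tail P) (u≡ ∘ suc) (w≡ ∘ suc) (z≡ ∘ suc) (suc i) j)

-- Factorizations of integer matrices over a ring in which positive integers are invertible: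
-- reduction and invariants

module Factorization {a ℓ} (F : CommutativeRing a ℓ)
  (ι : ℤ → CommutativeRing.Carrier F)
  (ι-monomorphism : IsRingMonomorphism ℤ.+-*-rawRing (CommutativeRing.rawRing F) ι)
  (_⁻¹ : ℕ⁺ → CommutativeRing.Carrier F)
  (inverseʳ : ∀ p → CommutativeRing._≈_ F (CommutativeRing._*_ F (ι ⟦ p ⟧) (p ⁻¹)) (CommutativeRing.1# F))
  where

  open CommutativeRing F hiding (zero)
  open MatrixAlgebra F
  open Tridiagonal
  open IntegerMatrix using (FirstRowColumn; Schur; schur; schur-Schur; clear; lift-≃; acting)
    renaming ( _≃_ to _≃ᶻ_; ≃-sym to ≃ᶻ-sym; ≃-trans to ≃ᶻ-trans; ≋⇒≃ to ≋⇒≃ᶻ; act to actᶻ; sum to sumᶻ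
             ; Unipotent to Unipotentᶻ; _⊗_ to _⊗ᶻ_ )
  open IsRingMonomorphism ι-monomorphism public
    using () renaming (injective to ι-injective; +-homo to ι-+; *-homo to ι-*; 0#-homo to ι-0; 1#-homo to ι-1; -‿homo to ι-neg; ⟦⟧-cong to ι-cong)

  -- Integers act as solver coefficients through `ι`. The constants in the solved identities are
  -- therefore images under `ι`, converted afterwards by `ι-1` and `ι-0`.
  ι-coefficients : ℤ.+-*-rawRing -Raw-AlmostCommutative⟶ fromCommutativeRing F
  ι-coefficients = record
    { ⟦_⟧ = ι ; +-homo = ι-+ ; *-homo = ι-* ; -‿homo = ι-neg ; 0-homo = ι-0 ; 1-homo = ι-1 }

  ι-≟ : WeaklyDecidable (λ i j → ι i ≈ ι j)
  ι-≟ i j with i ℤ.≟ j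
  ... | yes i≡j = Maybe.just (ι-cong i≡j)
  ... | no  _   = Maybe.nothing

  open Algebra.Solver.Ring ℤ.+-*-rawRing (fromCommutativeRing F) ι-coefficients ι-≟ public
    using (solve; con; _:=_; _:+_; _:*_; _:-_; :-_)

  open +-*-Solver using () renaming
    (solve to solveᶻ; con to conᶻ; _:=_ to _:=ᶻ_; _:+_ to _:+ᶻ_; _:*_ to _:*ᶻ_; _:-_ to _:-ᶻ_; :-_ to :-ᶻ_)
  open SetoidReasoning setoid

  vanish : ∀ {l r} c → l ≈ r → c * (l - r) ≈ 0#
  vanish {l} {r} c l≈r = *0 (trans (+-congʳ l≈r) (-‿inverseʳ r))

  x-y≈0⇒x≈y : ∀ {x y} → x - y ≈ 0# → x ≈ y
  x-y≈0⇒x≈y {x} {y} eq = begin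
    x              ≈⟨ +0 (-‿inverseˡ y) ⟨
    x + (- y + y)  ≈⟨ +-assoc x (- y) y ⟨
    x - y + y      ≈⟨ 0+ eq ⟩
    y              ∎

  linear₁ᶠ : ∀ {x y l r} c → l ≈ r → x - y ≈ c * (l - r) → x ≈ y
  linear₁ᶠ c l≈r eq = x-y≈0⇒x≈y (trans eq (vanish c l≈r))

  linear₂ᶠ : ∀ {x y l r l′ r′} c c′ → l ≈ r → l′ ≈ r′ → x - y ≈ c * (l - r) + c′ * (l′ - r′) → x ≈ y
  linear₂ᶠ c c′ l≈r l′≈r′ eq = linear₁ᶠ c l≈r (trans eq (+0 (vanish c′ l′≈r′)))

  linear₃ᶠ : ∀ {x y l r l′ r′ l″ r″} c c′ c″ → l ≈ r → l′ ≈ r′ → l″ ≈ r″ →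
    x - y ≈ c * (l - r) + c′ * (l′ - r′) + c″ * (l″ - r″) → x ≈ y
  linear₃ᶠ c c′ c″ l≈r l′≈r′ l″≈r″ eq = linear₂ᶠ c c′ l≈r l′≈r′ (trans eq (+0 (vanish c″ l″≈r″)))

  linear₄ᶠ : ∀ {x y l r l′ r′ l″ r″ l‴ r‴} c c′ c″ c‴ → l ≈ r → l′ ≈ r′ → l″ ≈ r″ → l‴ ≈ r‴ →
    x - y ≈ c * (l - r) + c′ * (l′ - r′) + c″ * (l″ - r″) + c‴ * (l‴ - r‴) → x ≈ y
  linear₄ᶠ c c′ c″ c‴ l≈r l′≈r′ l″≈r″ l‴≈r‴ eq =
    linear₃ᶠ c c′ c″ l≈r l′≈r′ l″≈r″ (trans eq (+0 (vanish c‴ l‴≈r‴)))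

  ι-sum : (f : Vector ℤ n) → ι (sumᶻ f) ≈ sum (ι ∘ f)
  ι-sum {zero}  f = ι-0
  ι-sum {suc n} f = trans (ι-+ _ _) (+-congˡ (ι-sum (tail f)))

  ι-⊗ : (X Y : Matrix ℤ n) → mapᴹ ι (X ⊗ᶻ Y) ≋ mapᴹ ι X ⊗ mapᴹ ι Y
  ι-⊗ X Y i j = trans (ι-sum (λ k → X i k ℤ.* Y k j)) (sum-cong-≋ λ k → ι-* (X i k) (Y k j))

  ι-unipotent : {u : Matrix ℤ n} → Unipotentᶻ u → Unipotent (mapᴹ ι u)
  ι-unipotent U = record
    { diagonal = λ i → trans (ι-cong (ℤᴹ.Unipotent.diagonal U i)) ι-1
    ; below    = λ j<i → trans (ι-cong (ℤᴹ.Unipotent.below U j<i)) ι-0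
    }

  ι-act : (μ g ν : Matrix ℤ n) → mapᴹ ι (actᶻ μ g ν) ≋ act (mapᴹ ι μ) (mapᴹ ι g) (mapᴹ ι ν)
  ι-act μ g ν = ≋-trans (ι-⊗ (λ i j → μ j i) (g ⊗ᶻ ν)) (⊗-cong ≋-refl (ι-⊗ g ν))

  -- The row factors of the Schur complement and their inverses.
  scale unscale : ℕ⁺ → Fin n → Carrier
  scale p zero      = - ι ⟦ p ⟧
  scale p (suc i)   = ι -1ℤ
  unscale p zero    = - p ⁻¹
  unscale p (suc i) = ι -1ℤ

  scale-unscale : ∀ p (i : Fin n) → scale p i * unscale p i ≈ 1#
  scale-unscale p zero = trans
    (solve 2 (λ x y → :- x :* :- y := x :* y) refl (ι ⟦ p ⟧) (p ⁻¹)) (inverseʳ p)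
  scale-unscale p (suc i) = trans (sym (ι-* -1ℤ -1ℤ)) ι-1

  -- The diagonal part ± Dₖ₊₁/Dₖ of a cell after its rows have been reversed,
  -- except that the denominator P₀ of the first entry is omitted.
  pivot : Vector ℕ⁺ (suc (suc r)) → Vector Carrier (suc r)
  pivot         P zero    = ι ⟦ P (suc zero) ⟧
  pivot {suc r} P (suc k) = unscale (P (suc zero)) k * pivot (tail P) k

  pivot⁻¹ : Vector ℕ⁺ (suc (suc r)) → Vector Carrier (suc r)
  pivot⁻¹         P zero    = P (suc zero) ⁻¹
  pivot⁻¹ {suc r} P (suc k) = scale (P (suc zero)) k * pivot⁻¹ (tail P) k

  pivot-inverse : (P : Vector ℕ⁺ (suc (suc r))) → ∀ k → pivot P k * pivot⁻¹ P k ≈ 1#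
  pivot-inverse         P zero    = inverseʳ (P (suc zero))
  pivot-inverse {suc r} P (suc k) = trans
    (solve 4 (λ x y z w → x :* y :* (z :* w) := z :* x :* (y :* w)) refl _ _ _ _)
    (trans (1* (scale-unscale (P (suc zero)) k)) (pivot-inverse (tail P) k))

  -- For `P = padded D` these are the cells with reversed rows; a general `P` lets the induction
  -- pass to `tail P`.
  record Factored (P : Vector ℕ⁺ (suc (suc r))) (g : Matrix ℤ (suc r)) : Set (a ⊔ ℓ) where
    field
      left right      : Matrix Carrier (suc r)
      left-unipotent  : Unipotent left
      right-unipotent : Unipotent right
      factorization   : mapᴹ ι g ≋ ldu left (pivot P) right

  open Factored

  -- Transposed, this is diag(s) xᵀ diag(t), a conjugate of xᵀ when `s` and `t` are inverse to each
  -- other.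
  scaled : (s t : Vector Carrier n) → Matrix Carrier n → Matrix Carrier n
  scaled s t x k i = s i * x k i * t k

  scaled-unipotent : {s t : Vector Carrier n} {x : Matrix Carrier n} →
    (∀ k → s k * t k ≈ 1#) → Unipotent x → Unipotent (scaled s t x)
  scaled-unipotent st≈1 X = record
    { diagonal = λ i → trans (*-congʳ (*1 (diagonal X i))) (st≈1 i)
    ; below    = λ j<i → 0* (*0 (below X j<i))
    }

  scaled-ldu : (s t d e : Vector Carrier n) (x y : Matrix Carrier n) → (∀ k → t k * d k ≈ e k) →
    ∀ i j → ldu (scaled s t x) d y i j ≈ s i * ldu x e y i j
  scaled-ldu s t d e x y td≈e i j = begin
    sum (λ k → s i * x k i * t k * (d k * y k j))
      ≈⟨ sum-cong-≋ (λ k → trans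
           (solve 5 (λ s x t d y → s :* x :* t :* (d :* y) := s :* (x :* (t :* d :* y))) refl
             (s i) (x k i) (t k) (d k) (y k j))
           (*-congˡ (*-congˡ (*-congʳ (td≈e k))))) ⟩
    sum (λ k → s i * (x k i * (e k * y k j)))
      ≈⟨ *-distribˡ-sum (s i) (λ k → x k i * (e k * y k j)) ⟨
    s i * ldu x e y i j ∎

  ι-[x*y-z] : ∀ {w v x y z} → w ℤ.* v ≡ x ℤ.* y ℤ.- z → ι w * ι v ≈ ι x * ι y - ι z
  ι-[x*y-z] {w} {v} {x} {y} {z} eq = begin
    ι w * ι v              ≈⟨ ι-* w v ⟨
    ι (w ℤ.* v)            ≈⟨ ι-cong eq ⟩
    ι (x ℤ.* y ℤ.- z)      ≈⟨ ι-+ (x ℤ.* y) (ℤ.- z) ⟩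
    ι (x ℤ.* y) + ι (ℤ.- z) ≈⟨ +-cong (ι-* x y) (ι-neg z) ⟩
    ι x * ι y - ι z        ∎

  factored-row : {P : Vector ℕ⁺ (suc (suc r))} {g : Matrix ℤ (suc r)} (G : Factored P g) →
    ∀ j → ι (g zero j) ≈ ι ⟦ P (suc zero) ⟧ * right G zero j
  factored-row {P = P} G j = trans (factorization G zero j) (ldu-row {b = right G} (pivot P) (left-unipotent G) j)

  factored-column : {P : Vector ℕ⁺ (suc (suc r))} {g : Matrix ℤ (suc r)} (G : Factored P g) →
    ∀ i → ι (g i zero) ≈ left G zero i * ι ⟦ P (suc zero) ⟧
  factored-column {P = P} G i =
    trans (factorization G i zero) (ldu-column {a = left G} (pivot P) (right-unipotent G) i)

  factored-corner : {P : Vector ℕ⁺ (suc (suc r))} {g : Matrix ℤ (suc r)} → Factored P g →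
    g zero zero ≡ ⟦ P (suc zero) ⟧
  factored-corner G = ι-injective (trans (factored-row G zero) (*1 (diagonal (right-unipotent G) zero)))

  -- The left side is minus the leading 2 × 2 minor, and that minor is the product of the first two
  -- pivots, `P₁` and `- P₂ / P₁`.
  factored-schur : {P : Vector ℕ⁺ (suc (suc (suc r)))} {g : Matrix ℤ (suc (suc r))} → Factored P g →
    schur ⟦ P (suc zero) ⟧ g zero zero ≡ ⟦ P (suc (suc zero)) ⟧
  factored-schur {P = P} {g} G = ι-injective (begin
    ι (x ℤ.* y ℤ.- p ℤ.* m)      ≈⟨ trans (ι-+ (x ℤ.* y) _) (+-cong (ι-* x y) (trans (ι-neg _) (-‿cong (ι-* p m)))) ⟩
    ι x * ι y - ι p * ι m
      ≈⟨ linear₄ᶠ (- ι p) (ι y) (left G zero (suc zero) * ι p) (ι ⟦ P (suc (suc zero)) ⟧)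
           (trans (factorization G (suc zero) (suc zero)) (+-congˡ (trans
             (ldu-row {a = minor (left G)} {minor (right G)} (tail (pivot P)) (unipotent-minor (left-unipotent G)) zero)
             (*1 (diagonal (right-unipotent G) (suc zero))))))
           (factored-column G (suc zero)) (factored-row G (suc zero)) (inverseʳ (P (suc zero)))
           (trans (solve 8 (λ x y p m a b c i → x :* y :- p :* m :- c :=
             :- p :* (m :- (a :* (p :* b) :+ :- i :* c)) :+ y :* (x :- a :* p) :+ a :* p :* (y :- p :* b)
               :+ c :* (p :* i :- con 1ℤ)) refl
             (ι x) (ι y) (ι p) (ι m) (left G zero (suc zero)) (right G zero (suc zero)) (ι ⟦ P (suc (suc zero)) ⟧) (P (suc zero) ⁻¹))
             (+-congˡ (*-congˡ (+-congˡ (-‿cong ι-1))))) ⟩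
    ι ⟦ P (suc (suc zero)) ⟧ ∎)
    where
    p = ⟦ P (suc zero) ⟧
    x = g (suc zero) zero
    y = g zero (suc zero)
    m = g (suc zero) (suc zero)

  factored-≃ : {P : Vector ℕ⁺ (suc (suc r))} {g g′ : Matrix ℤ (suc r)} →
    Factored P g → g ≃ᶻ g′ → Factored P g′
  factored-≃ {P = P} {g} {g′} G (acting {μ} {ν} U V g′≋) = record
    { left            = left G ⊗ mapᴹ ι μ
    ; right           = right G ⊗ mapᴹ ι ν
    ; left-unipotent  = ⊗-unipotent (left-unipotent G) (ι-unipotent U)
    ; right-unipotent = ⊗-unipotent (right-unipotent G) (ι-unipotent V)
    ; factorization   = ≋-trans (λ i j → ι-cong (g′≋ i j)) (≋-trans (ι-act μ g ν)
        (≋-trans (act-cong (mapᴹ ι μ) (mapᴹ ι ν) (factorization G))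
          (act-ldu (mapᴹ ι μ) (left G) (pivot P) (right G) (mapᴹ ι ν))))
    }

  -- Removing the rank one part given by the first row and column leaves the product of the minors
  -- of the factors. The row factors pass the transposed left factor by conjugation and turn the
  -- remaining pivots into `pivot (tail P)`.
  factored-schur-down : {P : Vector ℕ⁺ (suc (suc (suc r)))} {g : Matrix ℤ (suc (suc r))} {Γ : Matrix ℤ (suc r)} →
    Schur ⟦ P (suc zero) ⟧ g Γ → Factored P g → Factored (tail P) Γ
  factored-schur-down {P = P} {g} {Γ} S G = record
    { left            = scaled (scale p) (unscale p) (minor (left G))
    ; right           = minor (right G)
    ; left-unipotent  = scaled-unipotent (scale-unscale p) (unipotent-minor (left-unipotent G))
    ; right-unipotent = unipotent-minor (right-unipotent G)
    ; factorization   = λ i j → trans (complement i j)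
        (sym (scaled-ldu (scale p) (unscale p) (pivot (tail P)) (tail (pivot P)) (minor (left G)) (minor (right G)) (λ k → refl) i j))
    }
    where
    p = P (suc zero)
    L = ldu (minor (left G)) (tail (pivot P)) (minor (right G))

    complement : ∀ i j → ι (Γ i j) ≈ scale p i * L i j
    complement zero j = linear₄ᶠ 1# (- ι ⟦ p ⟧) (ι (g zero (suc j))) (left G zero (suc zero) * ι ⟦ p ⟧)
      (ι-[x*y-z] (Schur.top S j)) (factorization G (suc zero) (suc j))
      (factored-column G (suc zero)) (factored-row G (suc j))
      (trans (solve 8 (λ γ p L g x y a b → γ :- :- p :* L :=
        con 1ℤ :* (p :* g :- (x :* y :- γ)) :+ :- p :* (g :- (a :* (p :* b) :+ L)) :+
          y :* (x :- a :* p) :+ a :* p :* (y :- p :* b)) refl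
        (ι (Γ zero j)) (ι ⟦ p ⟧) (L zero j) (ι (g (suc zero) (suc j))) (ι (g (suc zero) zero)) (ι (g zero (suc j)))
        (left G zero (suc zero)) (right G zero (suc j)))
        (+-congʳ (+-congʳ (+-congʳ (*-congʳ ι-1)))))
    complement (suc i) j = linear₄ᶠ 1# (- 1#) (right G zero (suc j)) (- right G zero (suc j))
      (trans (ι-cong (Schur.rest S i j)) (ι-neg _)) (factorization G (suc (suc i)) (suc j))
      (factored-column G (suc (suc i))) (trans (ι-cong (Schur.column S i)) ι-0)
      (trans (solve 7 (λ γ L g a p b x → γ :- con -1ℤ :* L :=
        con 1ℤ :* (g :- :- γ) :+ :- con 1ℤ :* (g :- (a :* (p :* b) :+ L)) :+
          b :* (x :- a :* p) :+ :- b :* (x :- con 0ℤ)) refl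
        (ι (Γ (suc i) j)) (L (suc i) j) (ι (g (suc (suc i)) (suc j))) (left G zero (suc (suc i))) (ι ⟦ p ⟧)
        (right G zero (suc j)) (ι (g (suc (suc i)) zero)))
        (+-cong (+-congʳ (+-cong (*-congʳ ι-1) (*-congʳ (-‿cong ι-1)))) (*-congˡ (+-congˡ (-‿cong ι-0)))))

  -- The converse of `factored-schur-down`: the new first rows of the factors are the first column
  -- and row of `g` divided by the corner.
  module FactoredUp {P : Vector ℕ⁺ (suc (suc (suc r)))} {g : Matrix ℤ (suc (suc r))} {Γ : Matrix ℤ (suc r)}
    (S : Schur ⟦ P (suc zero) ⟧ g Γ) (G : Factored (tail P) Γ) where
    p = P (suc zero)

    â b̂ : Matrix Carrier (suc (suc r))
    â zero    zero    = 1#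
    â zero    (suc i) = ι (g (suc i) zero) * p ⁻¹
    â (suc k) zero    = 0#
    â (suc k) (suc i) = scaled (unscale p) (scale p) (left G) k i
    b̂ zero    zero    = 1#
    b̂ zero    (suc j) = p ⁻¹ * ι (g zero (suc j))
    b̂ (suc k) zero    = 0#
    b̂ (suc k) (suc j) = right G k j

    â-unipotent : Unipotent â
    â-unipotent = unipotent-∷ refl (λ i → refl)
      (scaled-unipotent (λ k → trans (*-comm _ _) (scale-unscale p k)) (left-unipotent G))

    b̂-unipotent : Unipotent b̂
    b̂-unipotent = unipotent-∷ refl (λ i → refl) (right-unipotent G)

    minor-ldu : ∀ i j → ldu (minor â) (tail (pivot P)) (minor b̂) i j ≈ unscale p i * ι (Γ i j)
    minor-ldu i j = trans
      (scaled-ldu (unscale p) (scale p) (tail (pivot P)) (pivot (tail P)) (left G) (right G)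
        (λ k → trans (sym (*-assoc _ _ _)) (1* (scale-unscale p k))) i j)
      (*-congˡ (sym (factorization G i j)))

    entry : mapᴹ ι g ≋ ldu â (pivot P) b̂
    entry zero zero = trans (trans (ι-cong (Schur.corner S)) (sym (*-identityʳ _)))
      (sym (ldu-row {a = â} {b̂} (pivot P) â-unipotent zero))
    entry zero (suc j) = trans
      (sym (trans (sym (*-assoc _ _ _)) (1* (inverseʳ p))))
      (sym (ldu-row {a = â} {b̂} (pivot P) â-unipotent (suc j)))
    entry (suc i) zero = trans
      (sym (trans (*-assoc _ _ _) (*1 (trans (*-comm _ _) (inverseʳ p)))))
      (sym (ldu-column {a = â} {b̂} (pivot P) b̂-unipotent (suc i)))
    entry (suc zero) (suc j) = trans
      (linear₃ᶠ (p ⁻¹) (- ι (g (suc zero) (suc j))) (- (ι (g (suc zero) zero) * ι (g zero (suc j)) * p ⁻¹))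
        (ι-[x*y-z] (Schur.top S j)) (inverseʳ p) (inverseʳ p)
        (trans (solve 6 (λ g x y γ p i → g :- (x :* i :* (p :* (i :* y)) :+ :- i :* γ) :=
          i :* (p :* g :- (x :* y :- γ)) :+ :- g :* (p :* i :- con 1ℤ) :+ :- (x :* y :* i) :* (p :* i :- con 1ℤ)) refl
          (ι (g (suc zero) (suc j))) (ι (g (suc zero) zero)) (ι (g zero (suc j))) (ι (Γ zero j)) (ι ⟦ p ⟧) (p ⁻¹))
          (+-cong (+-congˡ (*-congˡ (+-congˡ (-‿cong ι-1)))) (*-congˡ (+-congˡ (-‿cong ι-1))))))
      (+-congˡ (sym (minor-ldu zero j)))
    entry (suc (suc i)) (suc j) = trans
      (sym (trans (0+ (0* (0* (trans (ι-cong (Schur.column S i)) ι-0))))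
        (trans (solve 1 (λ γ → con -1ℤ :* γ := :- γ) refl (ι (Γ (suc i) j)))
          (sym (trans (ι-cong (Schur.rest S i j)) (ι-neg _))))))
      (+-congˡ (sym (minor-ldu (suc i) j)))

    factored-schur-up : Factored P g
    factored-schur-up = record
      { left = â ; right = b̂ ; left-unipotent = â-unipotent ; right-unipotent = b̂-unipotent ; factorization = entry }

  open FactoredUp using (factored-schur-up)

  -- P₀ multiplies the entry to the right of the corner but not the one below it,
  -- whence the two different vectors.
  record FactoredTridiagonal (P : Vector ℕ⁺ (suc (suc r))) (u w z : Vector ℤ r) : Set (a ⊔ ℓ) where
    field
      factored : Factored P (tridiagonal P u w z)
      left-superdiagonal : ∀ k → left factored (inject₁ k) (suc k) * ι ⟦ P (suc (inject₁ k)) ⟧ ≈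
        ι (⟦ (pos 1 ∷ tail P) (inject₁ (inject₁ k)) ⟧ ℤ.* u k)
      right-superdiagonal : ∀ k → right factored (inject₁ k) (suc k) * ι ⟦ P (suc (inject₁ k)) ⟧ ≈
        ι (⟦ P (inject₁ (inject₁ k)) ⟧ ℤ.* w k)

  tridiagonal-factored : (P : Vector ℕ⁺ (suc (suc r))) (u w z : Vector ℤ r) → Equations P u w z →
    FactoredTridiagonal P u w z
  tridiagonal-factored {zero} P u w z eqs = record
    { factored = record
      { left = 1ᴹ ; right = 1ᴹ ; left-unipotent = 1ᴹ-unipotent ; right-unipotent = 1ᴹ-unipotent
      ; factorization = λ { zero zero → sym (trans (ldu-row {a = 1ᴹ} {1ᴹ} (pivot P) 1ᴹ-unipotent zero) (*-identityʳ _)) }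
      }
    ; left-superdiagonal = λ ()
    ; right-superdiagonal = λ ()
    }
  tridiagonal-factored {suc r} P u w z eqs = record
    { factored            = factored-schur-up S T.factored
    ; left-superdiagonal  = left-superdiagonal
    ; right-superdiagonal = λ
      { zero    → trans (solve 3 (λ i y p → i :* y :* p := p :* i :* y) refl (P (suc zero) ⁻¹) (ι (⟦ P zero ⟧ ℤ.* w zero)) p)
                     (1* (inverseʳ (P (suc zero))))
      ; (suc k) → T.right-superdiagonal k
      }
    }
    where
    S = tridiagonal-schur P u w z eqs
    module T = FactoredTridiagonal (tridiagonal-factored (tail P) (tail u) (tail w) (tail z) (eqs ∘ suc))
    p = ι ⟦ P (suc zero) ⟧

    left-superdiagonal : ∀ k → left (factored-schur-up S T.factored) (inject₁ k) (suc k) * ι ⟦ P (suc (inject₁ k)) ⟧ ≈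
        ι (⟦ (pos 1 ∷ tail P) (inject₁ (inject₁ k)) ⟧ ℤ.* u k)
    left-superdiagonal zero = trans
      (solve 3 (λ x i p → x :* i :* p := p :* i :* x) refl (ι (u zero)) (P (suc zero) ⁻¹) p)
      (trans (1* (inverseʳ (P (suc zero)))) (ι-cong (≡.sym (ℤ.*-identityˡ (u zero)))))
    -- Conjugation multiplies the first row of the inner left factor by `P₁` off the diagonal, so
    -- `u₁` becomes `P₁ u₁`. Further down the two signs cancel and nothing changes.
    left-superdiagonal (suc zero) = trans
      (solve 3 (λ x p q → con -1ℤ :* x :* :- p :* q := p :* (x :* q)) refl (left T.factored zero (suc zero)) p (ι ⟦ P (suc (suc zero)) ⟧))
      (trans (*-congˡ (T.left-superdiagonal zero)) (trans (sym (ι-* ⟦ P (suc zero) ⟧ (1ℤ ℤ.* u (suc zero))))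
        (ι-cong (≡.cong (⟦ P (suc zero) ⟧ ℤ.*_) (ℤ.*-identityˡ (u (suc zero)))))))
    left-superdiagonal (suc (suc k)) = trans
      (solve 2 (λ x q → con -1ℤ :* x :* con -1ℤ :* q := x :* q) refl
        (left T.factored (inject₁ (suc k)) (suc (suc k))) (ι ⟦ P (suc (inject₁ (suc (suc k)))) ⟧))
      (T.left-superdiagonal (suc k))

  module _ (P : Vector ℕ⁺ (suc (suc (suc r)))) (coprime : ∀ k → ⟦ P (inject₁ k) ⟧ ⊥ ⟦ P (suc k) ⟧) where
    private
      p₁ = P (suc zero)

    -- The entries `x` and `y` next to the corner are units modulo `P₁`, because `x y` is congruent
    -- to the corner `P₂` of the Schur complement. As `P₀` is a unit too, `y` may be replaced by a
    -- multiple `P₀ w`.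
    normalize : (g : Matrix ℤ (suc (suc r))) → Factored P g → ∃₂ λ u w → ∃ λ g′ →
      Residue p₁ u × Residue p₁ w × g ≃ᶻ g′ × FirstRowColumn ⟦ p₁ ⟧ (⟦ P zero ⟧ ℤ.* w) u g′
    normalize g G =
      let j , P₀j≡y      = divide-mod (⊥-sym (coprime zero)) y
          w , w-res , j≡w = residue p₁ j
          u , u-res , x≡u = residue p₁ x
          g′ , g≃g′ , F  = clear g (factored-corner G)
            (⊥-factorʳ x p₁⊥xy) (mod-trans (mod-sym P₀j≡y) (mod-*ˡ ⟦ P zero ⟧ j≡w))
            (⊥-factorˡ x p₁⊥xy) x≡u
      in u , w , g′ , u-res , w-res , g≃g′ , F
      where
      x = g (suc zero) zero
      y = g zero (suc zero)
      m = g (suc zero) (suc zero)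

      p₁⊥xy : ⟦ p₁ ⟧ ⊥ x ℤ.* y
      p₁⊥xy = ⊥-mod ((ℤ.- m) by linear₁ -1ℤ (factored-schur G)
        (solveᶻ 5 (λ c x y m p → c :-ᶻ (x :*ᶻ y :+ᶻ :-ᶻ m :*ᶻ p) :=ᶻ conᶻ -1ℤ :*ᶻ (x :*ᶻ y :-ᶻ p :*ᶻ m :-ᶻ c)) ≡.refl
          ⟦ P (suc (suc zero)) ⟧ x y m ⟦ p₁ ⟧)) (coprime (suc zero))

    equation : ∀ {u w} {g : Matrix ℤ (suc (suc r))} → FirstRowColumn ⟦ p₁ ⟧ (⟦ P zero ⟧ ℤ.* w) u g →
      Factored P g → ⟦ P zero ⟧ ℤ.* u ℤ.* w ≡ ⟦ P (suc (suc zero)) ⟧ ℤ.+ ⟦ p₁ ⟧ ℤ.* g (suc zero) (suc zero)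
    equation {u} {w} {g} F G = linear₂ 1ℤ -1ℤ (factored-schur G) (≡.cong₂ ℤ._*_ column₁ row₁)
      (solveᶻ 8 (λ q u w c p m x y → q :*ᶻ u :*ᶻ w :-ᶻ (c :+ᶻ p :*ᶻ m) :=ᶻ
        conᶻ 1ℤ :*ᶻ (x :*ᶻ y :-ᶻ p :*ᶻ m :-ᶻ c) :+ᶻ conᶻ -1ℤ :*ᶻ (x :*ᶻ y :-ᶻ u :*ᶻ (q :*ᶻ w))) ≡.refl
        ⟦ P zero ⟧ u w ⟦ P (suc (suc zero)) ⟧ ⟦ p₁ ⟧ (g (suc zero) (suc zero)) (g (suc zero) zero) (g zero (suc zero)))
      where open FirstRowColumn F

    extend : {g : Matrix ℤ (suc (suc r))} (u w z : Vector ℤ (suc r)) →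
      FirstRowColumn ⟦ p₁ ⟧ (⟦ P zero ⟧ ℤ.* w zero) (u zero) g → Factored P g →
      Equations P u w z →
      schur ⟦ p₁ ⟧ g ≃ᶻ tridiagonal (tail P) (tail u) (tail w) (tail z) → g ≃ᶻ tridiagonal P u w z
    extend u w z F G eqs = lift-≃ p₁ F (tridiagonal-firstRowColumn P u w z)
      (schur-Schur F) (tridiagonal-schur P u w z eqs)
      (≡.subst (⟦ p₁ ⟧ ⊥_) (≡.sym (factored-schur G)) (coprime (suc zero)))

  -- Residues make the normal form unique: the class of `w k` determines that of `u k` by the
  -- equation, and then `z k`.
  Reduction : Vector ℕ⁺ (suc (suc r)) → Matrix ℤ (suc r) → Set
  Reduction P g = ∃₂ λ u w → ∃ λ z → Equations P u w z ×
    (∀ k → Residue (P (suc (inject₁ k))) (u k)) × (∀ k → Residue (P (suc (inject₁ k))) (w k)) ×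
    g ≃ᶻ tridiagonal P u w z

  reduce : (P : Vector ℕ⁺ (suc (suc r))) → (∀ k → ⟦ P (inject₁ k) ⟧ ⊥ ⟦ P (suc k) ⟧) →
    (g : Matrix ℤ (suc r)) → Factored P g → Reduction P g
  reduce {zero}  P coprime g G = (λ ()) , (λ ()) , (λ ()) , (λ ()) , (λ ()) , (λ ()) ,
    ≋⇒≃ᶻ λ { zero zero → factored-corner G }
  reduce {suc r} P coprime g G = step (normalize P coprime g G)
    where
    p₁ = P (suc zero)

    step : (∃₂ λ u w → ∃ λ g′ → Residue p₁ u × Residue p₁ w × g ≃ᶻ g′ ×
              FirstRowColumn ⟦ p₁ ⟧ (⟦ P zero ⟧ ℤ.* w) u g′) → Reduction P g
    step (u₀ , w₀ , g′ , u₀-res , w₀-res , g≃g′ , F) = conclude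
      (reduce (tail P) (coprime ∘ suc) (schur ⟦ p₁ ⟧ g′) (factored-schur-down (schur-Schur F) G′))
      where
      G′ = factored-≃ G g≃g′

      conclude : Reduction (tail P) (schur ⟦ p₁ ⟧ g′) → Reduction P g
      conclude (u , w , z , eqs , u-res , w-res , Γ≃) =
        (u₀ ∷ u) , (w₀ ∷ w) , (g′ (suc zero) (suc zero) ∷ z) , equations ,
        (λ { zero → u₀-res ; (suc k) → u-res k }) , (λ { zero → w₀-res ; (suc k) → w-res k }) ,
        ≃ᶻ-trans g≃g′ (extend P coprime (u₀ ∷ u) (w₀ ∷ w) (g′ (suc zero) (suc zero) ∷ z) F G′ equations Γ≃)
        where
        equations : Equations P (u₀ ∷ u) (w₀ ∷ w) (g′ (suc zero) (suc zero) ∷ z)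
        equations zero    = equation P coprime F G′
        equations (suc k) = eqs k

  Superdiagonal : (x : Matrix Carrier (suc r)) (p : Vector ℕ⁺ r) (V : Vector ℤ r) → Set ℓ
  Superdiagonal x p V = ∀ k → x (inject₁ k) (suc k) * ι ⟦ p k ⟧ ≈ ι (V k)

  interior : Vector ℕ⁺ (suc (suc r)) → Vector ℕ⁺ r
  interior P k = P (suc (inject₁ k))

  -- An integral unipotent factor adds its own superdiagonal, hence a multiple of `p k` once
  -- denominators are cleared; injectivity of `ι` brings the identity back to the integers.
  superdiagonal-⊗ : {x y : Matrix Carrier (suc r)} {v : Matrix ℤ (suc r)} {p : Vector ℕ⁺ r} {V W : Vector ℤ r} →
    Unipotent x → Unipotentᶻ v → y ≋ x ⊗ mapᴹ ι v → Superdiagonal x p V → Superdiagonal y p W →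
    ∀ k → W k ≡ V k mod ⟦ p k ⟧
  superdiagonal-⊗ {x = x} {y} {v} {p} {V} {W} X N y≋ x-V y-W k = v (inject₁ k) (suc k) by ι-injective (begin
    ι (W k)                                  ≈⟨ y-W k ⟨
    y (inject₁ k) (suc k) * ι ⟦ p k ⟧        ≈⟨ *-congʳ (trans (y≋ _ _) (⊗-superdiagonal X (ι-unipotent N) k)) ⟩
    (x (inject₁ k) (suc k) + ι vₖ) * ι ⟦ p k ⟧ ≈⟨ distribʳ _ _ _ ⟩
    x (inject₁ k) (suc k) * ι ⟦ p k ⟧ + ι vₖ * ι ⟦ p k ⟧ ≈⟨ +-cong (x-V k) (sym (ι-* vₖ ⟦ p k ⟧)) ⟩
    ι (V k) + ι (vₖ ℤ.* ⟦ p k ⟧)             ≈⟨ ι-+ _ _ ⟨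
    ι (V k ℤ.+ vₖ ℤ.* ⟦ p k ⟧)               ∎)
    where
    vₖ = v (inject₁ k) (suc k)

  -- Carries the integrality of the cleared superdiagonal from a normal form back to an arbitrary
  -- equivalent matrix.
  superdiagonal-⊗⁻¹ : {x y : Matrix Carrier (suc r)} {v : Matrix ℤ (suc r)} {p : Vector ℕ⁺ r} {W : Vector ℤ r} →
    Unipotent x → Unipotentᶻ v → y ≋ x ⊗ mapᴹ ι v → Superdiagonal y p W →
    Superdiagonal x p (λ k → W k ℤ.- v (inject₁ k) (suc k) ℤ.* ⟦ p k ⟧)
  superdiagonal-⊗⁻¹ {x = x} {y} {v} {p} {W} X N y≋ y-W k = begin
    xₖ * ι ⟦ p k ⟧
      ≈⟨ solve 3 (λ x v p → x :* p := (x :+ v) :* p :- v :* p) refl xₖ (ι vₖ) (ι ⟦ p k ⟧) ⟩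
    (xₖ + ι vₖ) * ι ⟦ p k ⟧ - ι vₖ * ι ⟦ p k ⟧
      ≈⟨ +-cong (trans (*-congʳ (sym (trans (y≋ _ _) (⊗-superdiagonal X (ι-unipotent N) k)))) (y-W k))
           (trans (-‿cong (sym (ι-* vₖ ⟦ p k ⟧))) (sym (ι-neg _))) ⟩
    ι (W k) + ι (ℤ.- (vₖ ℤ.* ⟦ p k ⟧))
      ≈⟨ ι-+ _ _ ⟨
    ι (W k ℤ.- vₖ ℤ.* ⟦ p k ⟧) ∎
    where
    xₖ = x (inject₁ k) (suc k)
    vₖ = v (inject₁ k) (suc k)

  module _ {P : Vector ℕ⁺ (suc (suc r))} {g k : Matrix ℤ (suc r)} (G : Factored P g) (K : Factored P k) where
    -- Transporting the factorization of `g` along the equivalence gives a second factorization of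
    -- `k`, and the two must agree.
    factored-unique : (g≃k : g ≃ᶻ k) → let open _≃ᶻ_ g≃k in
      left K ≋ left G ⊗ mapᴹ ι μ × right K ≋ right G ⊗ mapᴹ ι ν
    factored-unique g≃k = ldu-unique (pivot-inverse P)
      (left-unipotent K) (right-unipotent K) (left-unipotent G′) (right-unipotent G′)
      (≋-trans (≋-sym (factorization K)) (factorization G′))
      where G′ = factored-≃ G g≃k

  -- For `P = padded D` the product is `Dₖ₋₁ Dₖ₊₁` modulo `Dₖ`. This relation recovers the class of
  -- `U k` from that of `V k` and is the source of the twist.
  record Invariant {P : Vector ℕ⁺ (suc (suc r))} {g : Matrix ℤ (suc r)} (G : Factored P g) (U V : Vector ℤ r) : Set ℓ where
    field
      left-superdiagonal  : Superdiagonal (left G) (interior P) U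
      right-superdiagonal : Superdiagonal (right G) (interior P) V
      product             : ∀ k → U k ℤ.* V k ≡
        ⟦ (pos 1 ∷ tail P) (inject₁ (inject₁ k)) ⟧ ℤ.* ⟦ P (suc (suc k)) ⟧ mod ⟦ interior P k ⟧

  open Invariant

  invariant-≃ : {P : Vector ℕ⁺ (suc (suc r))} {g k : Matrix ℤ (suc r)} {G : Factored P g} {K : Factored P k}
    {U V U′ V′ : Vector ℤ r} → Invariant G U V → Invariant K U′ V′ → g ≃ᶻ k →
    ∀ i → V′ i ≡ V i mod ⟦ interior P i ⟧
  invariant-≃ {P = P} {G = G} {K} I J g≃k = superdiagonal-⊗ {p = interior P} (right-unipotent G)
    (_≃ᶻ_.ν-unipotent g≃k) (proj₂ (factored-unique G K g≃k)) (right-superdiagonal I) (right-superdiagonal J)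

  module _ (P : Vector ℕ⁺ (suc (suc r))) (u w z : Vector ℤ r) (eqs : Equations P u w z) where
    private
      module T = FactoredTridiagonal (tridiagonal-factored P u w z eqs)
      Q = pos 1 ∷ tail P

    tridiagonal-invariant : Invariant T.factored
      (λ k → ⟦ Q (inject₁ (inject₁ k)) ⟧ ℤ.* u k) (λ k → ⟦ P (inject₁ (inject₁ k)) ⟧ ℤ.* w k)
    tridiagonal-invariant = record
      { left-superdiagonal  = T.left-superdiagonal
      ; right-superdiagonal = T.right-superdiagonal
      ; product             = λ k → ⟦ Q (inject₁ (inject₁ k)) ⟧ ℤ.* z k by
          linear₁ ⟦ Q (inject₁ (inject₁ k)) ⟧ (eqs k)
            (solveᶻ 7 (λ q u p w c d z → q :*ᶻ u :*ᶻ (p :*ᶻ w) :-ᶻ (q :*ᶻ c :+ᶻ q :*ᶻ z :*ᶻ d) :=ᶻ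
              q :*ᶻ (p :*ᶻ u :*ᶻ w :-ᶻ (c :+ᶻ d :*ᶻ z))) ≡.refl
              ⟦ Q (inject₁ (inject₁ k)) ⟧ (u k) ⟦ P (inject₁ (inject₁ k)) ⟧ (w k) ⟦ P (suc (suc k)) ⟧ ⟦ interior P k ⟧ (z k))
      }

  module _ (P : Vector ℕ⁺ (suc (suc r))) (coprime : ∀ k → ⟦ P (inject₁ k) ⟧ ⊥ ⟦ P (suc k) ⟧) where
    private
      Q = pos 1 ∷ tail P

    module _ {g : Matrix ℤ (suc r)} (G : Factored P g) where
      invariants : ∃₂ λ U V → Invariant G U V
      invariants with reduce P coprime g G
      ... | u , w , z , eqs , _ , _ , g≃ = _ , _ , record
        { left-superdiagonal  = superdiagonal-⊗⁻¹ {v = μ} {p = interior P} (left-unipotent G) μ-unipotent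
            (proj₁ (factored-unique G T.factored g≃)) T.left-superdiagonal
        ; right-superdiagonal = superdiagonal-⊗⁻¹ {v = ν} {p = interior P} (right-unipotent G) ν-unipotent
            (proj₂ (factored-unique G T.factored g≃)) T.right-superdiagonal
        ; product             = λ k → mod-trans
            (mod-* (shift (⟦ Q (inject₁ (inject₁ k)) ⟧ ℤ.* u k) (μ (inject₁ k) (suc k)) ⟦ interior P k ⟧)
                   (shift (⟦ P (inject₁ (inject₁ k)) ⟧ ℤ.* w k) (ν (inject₁ k) (suc k)) ⟦ interior P k ⟧))
            (product (tridiagonal-invariant P u w z eqs) k)
        }
        where
        open _≃ᶻ_ g≃
        module T = FactoredTridiagonal (tridiagonal-factored P u w z eqs)

        shift : ∀ i t p → (i ℤ.- t ℤ.* p) ≡ i mod p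
        shift i t p = (ℤ.- t) by solveᶻ 3 (λ i t p → i :-ᶻ t :*ᶻ p :=ᶻ i :+ᶻ :-ᶻ t :*ᶻ p) ≡.refl i t p

    -- The equations for different `k` share no unknowns, so each is solved separately for its
    -- prescribed `V k`.
    realize : (V : Vector ℤ r) → (∀ k → ⟦ interior P k ⟧ ⊥ V k) →
      ∃ λ g → ∃ λ (G : Factored P g) → ∃₂ λ U V′ → Invariant G U V′ × (∀ k → V′ k ≡ V k mod ⟦ interior P k ⟧)
    realize V p⊥V = tridiagonal P u w z , _ , _ , _ , tridiagonal-invariant P u w z eqs ,
      λ k → proj₁ (proj₂ (proj₂ (proj₂ (solution k))))
      where
      solution = λ k → solve-equation ⟦ P (suc (suc k)) ⟧ (⊥-sym (coprime (inject₁ k))) (p⊥V k)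

      u w z : Vector ℤ r
      u k = proj₁ (solution k)
      w k = proj₁ (proj₂ (solution k))
      z k = proj₁ (proj₂ (proj₂ (solution k)))

      eqs : Equations P u w z
      eqs k = proj₂ (proj₂ (proj₂ (proj₂ (solution k))))

    -- `U k * V k` is congruent to a product of two integers coprime to the modulus.
    product-unit : ∀ {g : Matrix ℤ (suc r)} {G : Factored P g} {U V} → Invariant G U V → ∀ k →
      ⟦ interior P k ⟧ ⊥ ⟦ Q (inject₁ (inject₁ k)) ⟧ → ⟦ interior P k ⟧ ⊥ V k
    product-unit {U = U} I k p⊥Q = ⊥-factorʳ (U k)
      (⊥-mod (mod-sym (product I k)) (⊥-* p⊥Q (coprime (suc k))))

    module _ {u w z u′ w′ z′ : Vector ℤ r} (eqs : Equations P u w z) (eqs′ : Equations P u′ w′ z′)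
      (u-res : ∀ k → Residue (interior P k) (u k)) (w-res : ∀ k → Residue (interior P k) (w k))
      (u′-res : ∀ k → Residue (interior P k) (u′ k)) (w′-res : ∀ k → Residue (interior P k) (w′ k))
      (Pw≡Pw′ : ∀ k → ⟦ P (inject₁ (inject₁ k)) ⟧ ℤ.* w k ≡ ⟦ P (inject₁ (inject₁ k)) ⟧ ℤ.* w′ k mod ⟦ interior P k ⟧)
      where
      private
        w≡w′ : ∀ k → w k ≡ w′ k
        w≡w′ k = residue-unique (interior P k) (w-res k) (w′-res k)
          (mod-cancelˡ (⊥-sym (coprime (inject₁ k))) (Pw≡Pw′ k))

        equation-mod : ∀ {u w z} → Equations P u w z → ∀ k →
          ⟦ P (inject₁ (inject₁ k)) ⟧ ℤ.* w k ℤ.* u k ≡ ⟦ P (suc (suc k)) ⟧ mod ⟦ interior P k ⟧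
        equation-mod {u} {w} {z} eqs k = z k by linear₁ 1ℤ (eqs k)
          (solveᶻ 6 (λ p u w c d z → p :*ᶻ w :*ᶻ u :-ᶻ (c :+ᶻ z :*ᶻ d) :=ᶻ
            conᶻ 1ℤ :*ᶻ (p :*ᶻ u :*ᶻ w :-ᶻ (c :+ᶻ d :*ᶻ z))) ≡.refl
            ⟦ P (inject₁ (inject₁ k)) ⟧ (u k) (w k) ⟦ P (suc (suc k)) ⟧ ⟦ interior P k ⟧ (z k))

        -- `Pₖ w k` can be cancelled: its product with `u k` is `Pₖ₊₂` modulo `Pₖ₊₁`, so it is a
        -- unit.
        u≡u′ : ∀ k → u k ≡ u′ k
        u≡u′ k = residue-unique (interior P k) (u-res k) (u′-res k)
          (mod-cancelˡ {k = ⟦ P (inject₁ (inject₁ k)) ⟧ ℤ.* w k}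
            (⊥-factorˡ (⟦ P (inject₁ (inject₁ k)) ⟧ ℤ.* w k) {u k} (⊥-mod (mod-sym (equation-mod eqs k)) (coprime (suc k))))
            (mod-trans (equation-mod eqs k) (mod-trans (mod-sym (equation-mod eqs′ k))
              (≡⇒mod (≡.cong (λ □ → ⟦ P (inject₁ (inject₁ k)) ⟧ ℤ.* □ ℤ.* u′ k) (≡.sym (w≡w′ k)))))))

        z≡z′ : ∀ k → z k ≡ z′ k
        z≡z′ k = ⟦⟧-cancelˡ (interior P k) (linear₃ -1ℤ 1ℤ 1ℤ (eqs k) (eqs′ k)
          (≡.cong₂ (λ u w → ⟦ P (inject₁ (inject₁ k)) ⟧ ℤ.* u ℤ.* w) (u≡u′ k) (w≡w′ k))
          (solveᶻ 6 (λ d z z′ x x′ c → d :*ᶻ z :-ᶻ d :*ᶻ z′ :=ᶻ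
            conᶻ -1ℤ :*ᶻ (x :-ᶻ (c :+ᶻ d :*ᶻ z)) :+ᶻ conᶻ 1ℤ :*ᶻ (x′ :-ᶻ (c :+ᶻ d :*ᶻ z′)) :+ᶻ conᶻ 1ℤ :*ᶻ (x :-ᶻ x′)) ≡.refl
            ⟦ interior P k ⟧ (z k) (z′ k) (⟦ P (inject₁ (inject₁ k)) ⟧ ℤ.* u k ℤ.* w k)
            (⟦ P (inject₁ (inject₁ k)) ⟧ ℤ.* u′ k ℤ.* w′ k) ⟦ P (suc (suc k)) ⟧))

      tridiagonal-unique : tridiagonal P u w z ≃ᶻ tridiagonal P u′ w′ z′
      tridiagonal-unique = ≋⇒≃ᶻ (tridiagonal-cong P u≡u′ w≡w′ z≡z′)

    -- Reduction preserves the classes of the right coordinates, so both matrices arrive at the same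
    -- normal form.
    invariant-injective : {g h : Matrix ℤ (suc r)} {G : Factored P g} {H : Factored P h} {U V U′ V′ : Vector ℤ r} →
      Invariant G U V → Invariant H U′ V′ → (∀ k → V k ≡ V′ k mod ⟦ interior P k ⟧) → g ≃ᶻ h
    invariant-injective {g} {h} {G} {H} I J V≡V′ with reduce P coprime g G | reduce P coprime h H
    ... | u , w , z , eqs , u-res , w-res , g≃ | u′ , w′ , z′ , eqs′ , u′-res , w′-res , h≃ =
      ≃ᶻ-trans g≃ (≃ᶻ-trans (tridiagonal-unique eqs eqs′ u-res w-res u′-res w′-res λ k →
        mod-trans (invariant-≃ I (tridiagonal-invariant P u w z eqs) g≃ k) (mod-trans (V≡V′ k)
          (mod-sym (invariant-≃ J (tridiagonal-invariant P u′ w′ z′ eqs′) h≃ k)))) (≃ᶻ-sym h≃))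

-- Padded vectors and the reversal of rows

∷ʳ-inject₁ : ∀ {A : Set} (xs : Vector A r) y k → (xs ∷ʳ y) (inject₁ k) ≡ xs k
∷ʳ-inject₁ {suc r} xs y zero    = ≡.refl
∷ʳ-inject₁ {suc r} xs y (suc k) = ∷ʳ-inject₁ (tail xs) y k

∷ʳ-fromℕ : ∀ {A : Set} (xs : Vector A r) y → (xs ∷ʳ y) (fromℕ r) ≡ y
∷ʳ-fromℕ {zero}  xs y = ≡.refl
∷ʳ-fromℕ {suc r} xs y = ∷ʳ-fromℕ (tail xs) y

opposite-< : ∀ {i j : Fin n} → i < j → opposite j < opposite i
opposite-< {n} {i} {j} i<j = ≡.subst₂ ℕ._<_ (≡.sym (opposite-prop j)) (≡.sym (opposite-prop i))
  (ℕ.∸-monoʳ-< (s≤s i<j) (toℕ<n j))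

module _ {a} {A : Set a} where
  flipRows : Matrix A n → Matrix A n
  flipRows X i = X (opposite i)

  -- Reflection in the antidiagonal keeps matrices upper triangular and reverses the superdiagonal.
  -- It takes `b₁` to the left factor of the row-reversed cell, which matches the reversal of `M` in
  -- the sum.
  antitranspose : Matrix A n → Matrix A n
  antitranspose X i j = X (opposite j) (opposite i)

  flipRows-involutive : (X : Matrix A n) → ∀ i j → flipRows (flipRows X) i j ≡ X i j
  flipRows-involutive X i j = ≡.cong (λ □ → X □ j) (opposite-involutive i)

  antitranspose-involutive : (X : Matrix A n) → ∀ i j → antitranspose (antitranspose X) i j ≡ X i j
  antitranspose-involutive X i j = ≡.cong₂ X (opposite-involutive i) (opposite-involutive j)

module RowReversal {c ℓ} (R : CommutativeRing c ℓ) where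
  open CommutativeRing R hiding (zero)
  open MatrixAlgebra R
  open CommutativeMonoidSum +-commutativeMonoid using (sum-permute)

  antitranspose-unipotent : {u : Matrix Carrier n} → Unipotent u → Unipotent (antitranspose u)
  antitranspose-unipotent U = record
    { diagonal = diagonal U ∘ opposite
    ; below    = λ j<i → below U (opposite-< j<i)
    }

  flipRows-act : (u g v : Matrix Carrier n) →
    act (antitranspose u) (flipRows g) v ≋ flipRows (u ⊗ g ⊗ v)
  flipRows-act u g v i j = sym (trans (⊗-assoc u g v (opposite i) j)
    (sum-permute (λ k → u (opposite i) k * (g ⊗ v) k j) reverse-permutation))

  flipRows-act⁻¹ : (μ g ν : Matrix Carrier n) {h : Matrix Carrier n} →
    flipRows h ≋ act μ (flipRows g) ν → h ≋ antitranspose μ ⊗ g ⊗ ν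
  flipRows-act⁻¹ μ g ν {h} h≋ = begin
    h                                  ≈⟨ (λ i j → reflexive (flipRows-involutive h i j)) ⟨
    flipRows (flipRows h)              ≈⟨ (λ i → h≋ (opposite i)) ⟩
    flipRows (act μ (flipRows g) ν)    ≈⟨ (λ i → ⊗-cong {X = μ ᵀ} {μ′ ᵀ} μ≋μ′ (≋-refl {X = flipRows g ⊗ ν}) (opposite i)) ⟩
    flipRows (act μ′ (flipRows g) ν)   ≈⟨ (λ i → flipRows-act (antitranspose μ) g ν (opposite i)) ⟩
    flipRows (flipRows (antitranspose μ ⊗ g ⊗ ν))
      ≈⟨ (λ i j → reflexive (flipRows-involutive (antitranspose μ ⊗ g ⊗ ν) i j)) ⟩
    antitranspose μ ⊗ g ⊗ ν            ∎
    where
    open SetoidReasoning (≋-setoid _)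
    μ′ = antitranspose (antitranspose μ)
    μ≋μ′ : μ ᵀ ≋ μ′ ᵀ
    μ≋μ′ i j = reflexive (≡.sym (antitranspose-involutive μ j i))

-- Integers and reciprocals in the rationals

module IntegersInRationals where
  open import Data.Rational.Base using (fromℚᵘ)
  open +-*-Solver using (solve; con; _:=_; _:+_; _:*_)

  _/1 : ℤ → ℚ
  i /1 = i ℚ./ 1

  fromℚᵘ-+ : ∀ p q → fromℚᵘ p ℚ.+ fromℚᵘ q ≡ fromℚᵘ (p ℚᵘ.+ q)
  fromℚᵘ-+ p q = ℚ.toℚᵘ-injective (ℚᵘ.≃-trans (ℚ.toℚᵘ-homo-+ (fromℚᵘ p) (fromℚᵘ q))
    (ℚᵘ.≃-trans (ℚᵘ.+-cong (ℚ.toℚᵘ-fromℚᵘ p) (ℚ.toℚᵘ-fromℚᵘ q)) (ℚᵘ.≃-sym (ℚ.toℚᵘ-fromℚᵘ (p ℚᵘ.+ q)))))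

  fromℚᵘ-* : ∀ p q → fromℚᵘ p ℚ.* fromℚᵘ q ≡ fromℚᵘ (p ℚᵘ.* q)
  fromℚᵘ-* p q = ℚ.toℚᵘ-injective (ℚᵘ.≃-trans (ℚ.toℚᵘ-homo-* (fromℚᵘ p) (fromℚᵘ q))
    (ℚᵘ.≃-trans (ℚᵘ.*-cong (ℚ.toℚᵘ-fromℚᵘ p) (ℚ.toℚᵘ-fromℚᵘ q)) (ℚᵘ.≃-sym (ℚ.toℚᵘ-fromℚᵘ (p ℚᵘ.* q)))))

  fromℚᵘ-neg : ∀ p → ℚ.- fromℚᵘ p ≡ fromℚᵘ (ℚᵘ.- p)
  fromℚᵘ-neg p = ℚ.toℚᵘ-injective (ℚᵘ.≃-trans (ℚ.toℚᵘ-homo‿- (fromℚᵘ p))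
    (ℚᵘ.≃-trans (ℚᵘ.-‿cong (ℚ.toℚᵘ-fromℚᵘ p)) (ℚᵘ.≃-sym (ℚ.toℚᵘ-fromℚᵘ (ℚᵘ.- p)))))

  /1-monomorphism : IsRingMonomorphism ℤ.+-*-rawRing ℚ.+-*-rawRing _/1
  /1-monomorphism = record
    { isRingHomomorphism = record
      { isSemiringHomomorphism = record
        { isNearSemiringHomomorphism = record
          { +-isMonoidHomomorphism = record
            { isMagmaHomomorphism = record
              { isRelHomomorphism = record { cong = ≡.cong _/1 }
              ; homo = λ i j → ≡.trans (ℚ.fromℚᵘ-cong {mkℚᵘ (i ℤ.+ j) 0} {mkℚᵘ i 0 ℚᵘ.+ mkℚᵘ j 0} (*≡* (+-eq i j)))
                  (≡.sym (fromℚᵘ-+ (mkℚᵘ i 0) (mkℚᵘ j 0)))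
              }
            ; ε-homo = ≡.refl
            }
          ; *-homo = λ i j → ≡.trans (ℚ.fromℚᵘ-cong {mkℚᵘ (i ℤ.* j) 0} {mkℚᵘ i 0 ℚᵘ.* mkℚᵘ j 0} (*≡* ≡.refl))
              (≡.sym (fromℚᵘ-* (mkℚᵘ i 0) (mkℚᵘ j 0)))
          }
        ; 1#-homo = ≡.refl
        }
      ; -‿homo = λ i → ≡.sym (fromℚᵘ-neg (mkℚᵘ i 0))
      }
    ; injective = λ {i} {j} i≡j → /1-injective i j (ℚ.fromℚᵘ-injective {mkℚᵘ i 0} {mkℚᵘ j 0} i≡j)
    }
    where
    +-eq : ∀ i j → (i ℤ.+ j) ℤ.* 1ℤ ≡ (i ℤ.* 1ℤ ℤ.+ j ℤ.* 1ℤ) ℤ.* 1ℤ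
    +-eq = solve 2 (λ i j → (i :+ j) :* con 1ℤ := (i :* con 1ℤ :+ j :* con 1ℤ) :* con 1ℤ) ≡.refl

    /1-injective : ∀ i j → mkℚᵘ i 0 ℚᵘ.≃ mkℚᵘ j 0 → i ≡ j
    /1-injective i j (*≡* eq) = ≡.trans (≡.sym (ℤ.*-identityʳ i)) (≡.trans eq (ℤ.*-identityʳ j))

  reciprocal : ℕ⁺ → ℚ
  reciprocal p = pos 1 ÷ p

  ÷-reciprocal : ∀ p q → p ÷ q ≡ (⟦ p ⟧ /1) ℚ.* reciprocal q
  ÷-reciprocal (pos p) (pos (suc q)) = ≡.sym (≡.trans (fromℚᵘ-* (mkℚᵘ (+ p) 0) (mkℚᵘ 1ℤ q))
    (ℚ.fromℚᵘ-cong {mkℚᵘ (+ p) 0 ℚᵘ.* mkℚᵘ 1ℤ q} {mkℚᵘ (+ p) q}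
      (*≡* (≡.cong₂ ℤ._*_ (ℤ.*-identityʳ (+ p)) (≡.cong +_ (≡.sym (ℕ.+-identityʳ (suc q))))))))

  ÷-self : ∀ p → p ÷ p ≡ ℚ.1ℚ
  ÷-self (pos (suc p)) = ℚ.fromℚᵘ-cong {mkℚᵘ (+ suc p) p} {mkℚᵘ 1ℤ 0} (*≡* (ℤ.*-comm (+ suc p) 1ℤ))

-- Cells as factored integer matrices, and their determinant

module Cells {a ℓ b m} (𝔼 : Exponential a ℓ b m) where
  open Exponential 𝔼
  open Kloosterman 𝔼
  open Cell public
  open IntegersInRationals
  open ℝ using (_≈_; _*_; -_; 0#; 1#; refl; sym; trans; *-cong; *-congˡ; *-congʳ; reflexive)
  open IsRingMonomorphism fromℚ-monomorphism using ()
    renaming (⟦⟧-cong to fromℚ-cong; *-homo to fromℚ-*; 1#-homo to fromℚ-1)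
  open CommutativeMonoidSum ℝ.*-commutativeMonoid using () renaming (sum to product; sum-permute to product-permute)

  fromℤ-monomorphism : IsRingMonomorphism ℤ.+-*-rawRing ℝ.rawRing fromℤ
  fromℤ-monomorphism = Composition.isRingMonomorphism ℝ.trans /1-monomorphism fromℚ-monomorphism

  _⁻¹ : ℕ⁺ → ℝ.Carrier
  p ⁻¹ = fromℚ (reciprocal p)

  fromℚ-÷ : ∀ p q → fromℚ (p ÷ q) ≈ fromℤ ⟦ p ⟧ * q ⁻¹
  fromℚ-÷ p q = trans (fromℚ-cong (÷-reciprocal p q)) (fromℚ-* (⟦ p ⟧ /1) (reciprocal q))

  inverseʳ : ∀ p → fromℤ ⟦ p ⟧ * p ⁻¹ ≈ 1#
  inverseʳ p = trans (sym (fromℚ-÷ p p)) (trans (fromℚ-cong (÷-self p)) fromℚ-1)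

  open MatrixAlgebra ℝ public
  open Exp ℝ.semiring using () renaming (_^_ to _ℝ^_)
  open Exp (CommutativeRing.semiring ℤ.+-*-commutativeRing) using () renaming (_^_ to _ℤ^_)
  open Determinant ℤ.+-*-commutativeRing using () renaming (sign to ℤ-sign)
  open CommutativeMonoidSum ℝ.+-commutativeMonoid using (sum-permute)
  open Determinant ℝ using (sign; det-cong; det-unipotent-⊗; det-antitriangular)
  open Factorization ℝ fromℤ fromℤ-monomorphism _⁻¹ inverseʳ public
  open Factored
  open SetoidReasoning ℝ.setoid
  module ℤᴬ = IntegerMatrix

  ratio : Vector ℕ⁺ (suc (suc r)) → Vector ℝ.Carrier (suc r)
  ratio P k = fromℚ (P (suc k) ÷ P (inject₁ k))

  -- Each Schur step contributes -1, and only the last one, for which the row comes first, the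
  -- denominator. The resulting signs are those of `w₀`.
  pivot-ratio : (P : Vector ℕ⁺ (suc (suc r))) → ∀ k → pivot P (suc k) ≈ sign (suc k) * ratio P (suc k)
  pivot-ratio {suc r} P zero = begin
    - P₁ ⁻¹ * fromℤ ⟦ P₂ ⟧                 ≈⟨ solve 2 (λ i q → :- i :* q := con -1ℤ :* con 1ℤ :* (q :* i)) refl (P₁ ⁻¹) (fromℤ ⟦ P₂ ⟧) ⟩
    fromℤ -1ℤ * fromℤ 1ℤ * (fromℤ ⟦ P₂ ⟧ * P₁ ⁻¹) ≈⟨ *-cong (*-cong ι-minus1 ι-1) (sym (fromℚ-÷ P₂ P₁)) ⟩
    sign {suc (suc r)} (suc zero) * ratio P (suc zero) ∎
    where
    P₁ = P (suc zero)
    P₂ = P (suc (suc zero))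
    ι-minus1 : fromℤ -1ℤ ≈ - 1#
    ι-minus1 = trans (ι-neg 1ℤ) (ℝ.-‿cong ι-1)
  pivot-ratio {suc r} P (suc k) = begin
    fromℤ -1ℤ * pivot (tail P) (suc k)              ≈⟨ *-cong (trans (ι-neg 1ℤ) (ℝ.-‿cong ι-1)) (pivot-ratio (tail P) k) ⟩
    - 1# * (sign (suc k) * ratio P (suc (suc k)))   ≈⟨ ℝ.*-assoc _ _ _ ⟨
    - 1# * sign (suc k) * ratio P (suc (suc k))     ∎

  pivot-padded : (D : Vector ℕ⁺ r) → ∀ k → pivot (padded D) k ≈ sign k * ratio (padded D) k
  pivot-padded         D zero    = begin
    fromℤ ⟦ padded D (suc zero) ⟧            ≈⟨ trans (*-congˡ (trans (fromℚ-cong (÷-self (pos 1))) fromℚ-1)) (ℝ.*-identityʳ _) ⟨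
    fromℤ ⟦ padded D (suc zero) ⟧ * pos 1 ⁻¹ ≈⟨ fromℚ-÷ (padded D (suc zero)) (pos 1) ⟨
    ratio (padded D) zero                    ≈⟨ ℝ.*-identityˡ _ ⟨
    1# * ratio (padded D) zero               ∎
  pivot-padded {suc r} D (suc k) = pivot-ratio (padded D) k

  sum-indicator : (f h : Vector ℝ.Carrier n) (j : Fin n) →
    sum (λ k → f k * (if does (k ≟ j) then h k else 0#)) ≈ f j * h j
  sum-indicator f h zero    = sum-head (λ k → f k * (if does (k ≟ zero) then h k else 0#)) (λ k → ℝ.zeroʳ (f (suc k)))
  sum-indicator f h (suc j) = trans (0+ (ℝ.zeroʳ (f zero))) (sum-indicator (tail f) (tail h) j)

  bruhat-entry : (D : Vector ℕ⁺ r) (b₁ b₂ : Matrix ℝ.Carrier (suc r)) → ∀ i j →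
    (b₁ ⊗ c D ⊗ w₀ ⊗ b₂) i j ≈ sum (λ k → b₁ i (opposite k) * (pivot (padded D) k * b₂ k j))
  bruhat-entry D b₁ b₂ i j = sum-cong-≋ λ k → begin
    (b₁ ⊗ c D ⊗ w₀) i k * b₂ k j
      ≈⟨ *-congʳ (sum-indicator ((b₁ ⊗ c D) i) (λ _ → sign k) (opposite k)) ⟩
    (b₁ ⊗ c D) i (opposite k) * sign k * b₂ k j
      ≈⟨ *-congʳ (*-congʳ (sum-indicator (b₁ i) (λ j → ratio (padded D) (opposite j)) (opposite k))) ⟩
    b₁ i (opposite k) * ratio (padded D) (opposite (opposite k)) * sign k * b₂ k j
      ≈⟨ *-congʳ (*-congʳ (*-congˡ (reflexive (≡.cong (ratio (padded D)) (opposite-involutive k))))) ⟩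
    b₁ i (opposite k) * ratio (padded D) k * sign k * b₂ k j
      ≈⟨ solve 4 (λ x q s y → x :* q :* s :* y := x :* (s :* q :* y)) refl (b₁ i (opposite k)) (ratio (padded D) k) (sign k) (b₂ k j) ⟩
    b₁ i (opposite k) * (sign k * ratio (padded D) k * b₂ k j)
      ≈⟨ *-congˡ (*-congʳ (pivot-padded D k)) ⟨
    b₁ i (opposite k) * (pivot (padded D) k * b₂ k j) ∎

  open RowReversal ℝ
  module ℤᴿ = RowReversal ℤ.+-*-commutativeRing

  module _ {D : Vector ℕ⁺ r} where
    cell-factored : (x : Cell D) → Factored (padded D) (flipRows (γ x))
    cell-factored x = record
      { left            = antitranspose (b₁ x)
      ; right           = b₂ x
      ; left-unipotent  = antitranspose-unipotent (b₁-unipotent x)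
      ; right-unipotent = b₂-unipotent x
      ; factorization   = λ i j → trans (decomposition x (opposite i) j) (bruhat-entry D (b₁ x) (b₂ x) (opposite i) j)
      }

    ∼⇒≃ : {x y : Cell D} → x ∼ y → flipRows (γ x) ℤᴬ.≃ flipRows (γ y)
    ∼⇒≃ {x} (u , v , U , V , γy≋) = ℤᴬ.acting (ℤᴿ.antitranspose-unipotent U) V
      λ i j → ≡.trans (γy≋ (opposite i) j) (≡.sym (ℤᴿ.flipRows-act u (γ x) v i j))

    ≃⇒∼ : {x y : Cell D} → flipRows (γ x) ℤᴬ.≃ flipRows (γ y) → x ∼ y
    ≃⇒∼ {x} {y} (ℤᴬ.acting {μ} {ν} U V γy≋) =
      antitranspose μ , ν , ℤᴿ.antitranspose-unipotent U , V , ℤᴿ.flipRows-act⁻¹ μ (γ x) ν γy≋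

  -- The quotients telescope; for `padded D` both ends are 1.
  product-ratio : (P : Vector ℕ⁺ (suc (suc r))) →
    product (ratio P) ≈ fromℤ ⟦ P (fromℕ (suc r)) ⟧ * P zero ⁻¹
  product-ratio {zero}  P = trans (ℝ.*-identityʳ _) (fromℚ-÷ (P (suc zero)) (P zero))
  product-ratio {suc r} P = begin
    ratio P zero * product (ratio (tail P))   ≈⟨ *-cong (fromℚ-÷ (P (suc zero)) (P zero)) (product-ratio (tail P)) ⟩
    fromℤ ⟦ P (suc zero) ⟧ * P zero ⁻¹ * (fromℤ ⟦ P (fromℕ (suc (suc r))) ⟧ * P (suc zero) ⁻¹)
      ≈⟨ solve 4 (λ p i q j → p :* i :* (q :* j) := p :* j :* (q :* i)) refl _ _ _ _ ⟩
    fromℤ ⟦ P (suc zero) ⟧ * P (suc zero) ⁻¹ * (fromℤ ⟦ P (fromℕ (suc (suc r))) ⟧ * P zero ⁻¹)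
      ≈⟨ 1* (inverseʳ (P (suc zero))) ⟩
    fromℤ ⟦ P (fromℕ (suc (suc r))) ⟧ * P zero ⁻¹ ∎

  product-ratio-padded : (D : Vector ℕ⁺ r) → product (ratio (padded D)) ≈ 1#
  product-ratio-padded D = trans (product-ratio (padded D))
    (trans (*-congʳ (reflexive (≡.cong (λ p → fromℤ ⟦ p ⟧) (∷ʳ-fromℕ D (pos 1))))) (inverseʳ (pos 1)))

  ι-sign : (k : Fin n) → fromℤ (ℤ-sign k) ≈ sign k
  ι-sign k = power (toℕ k)
    where
    power : ∀ n → fromℤ (-1ℤ ℤ^ n) ≈ (- 1#) ℝ^ n
    power zero    = ι-1
    power (suc n) = trans (ι-* -1ℤ (-1ℤ ℤ^ n)) (*-cong (trans (ι-neg 1ℤ) (ℝ.-‿cong ι-1)) (power n))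

  ι-det : (X : Matrix ℤ n) → fromℤ (ℤᴹ.det X) ≈ det (mapᴹ fromℤ X)
  ι-det {zero}  X = ι-1
  ι-det {suc n} X = trans (ι-sum (λ j → ℤ-sign j ℤ.* X zero j ℤ.* subdet j))
    (sum-cong-≋ λ j → trans (ι-* (ℤ-sign j ℤ.* X zero j) (subdet j))
      (*-cong (trans (ι-* (ℤ-sign j) (X zero j)) (*-congʳ {x = fromℤ (X zero j)} (ι-sign j)))
        (ι-det (λ i k → X (suc i) (punchIn j k)))))
    where
    subdet : Fin (suc n) → ℤ
    subdet j = ℤᴹ.det (λ i k → X (suc i) (punchIn j k))

  bruhat-flipRows : (D : Vector ℕ⁺ r) (b₁ b₂ : Matrix ℝ.Carrier (suc r)) →
    b₁ ⊗ c D ⊗ w₀ ⊗ b₂ ≋ b₁ ⊗ flipRows (scaleRows (pivot (padded D)) b₂)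
  bruhat-flipRows D b₁ b₂ i j = trans (bruhat-entry D b₁ b₂ i j) (sym (trans
    (sum-permute (λ k → b₁ i k * flipRows (scaleRows (pivot (padded D)) b₂) k j) reverse-permutation)
    (sum-cong-≋ λ k → *-congˡ {x = b₁ i (opposite k)} (reflexive (flipRows-involutive (scaleRows (pivot (padded D)) b₂) k j)))))

  -- `b₁` leaves the determinant unchanged, and the rest is antitriangular with the ratios on the
  -- antidiagonal up to the expected signs. Through injectivity of `fromℤ` this yields the condition
  -- `det≡1` for cells built from a factorization.
  det-decomposition : (D : Vector ℕ⁺ r) {b₁ b₂ : Matrix ℝ.Carrier (suc r)} → Unipotent b₁ → Unipotent b₂ →
    det (b₁ ⊗ c D ⊗ w₀ ⊗ b₂) ≈ 1#
  det-decomposition D {b₁} {b₂} B₁ B₂ = begin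
    det (b₁ ⊗ c D ⊗ w₀ ⊗ b₂)   ≈⟨ det-cong (bruhat-flipRows D b₁ b₂) ⟩
    det (b₁ ⊗ Y)               ≈⟨ det-unipotent-⊗ B₁ Y ⟩
    det Y                      ≈⟨ det-antitriangular (flip-ratio) Y
                                    (λ i j j< → *0 (below B₂ j<))
                                    (λ i → trans (*1 (diagonal B₂ (opposite i)))
                                      (trans (pivot-padded D (opposite i)) (ℝ.*-comm _ _))) ⟩
    product flip-ratio         ≈⟨ product-permute (ratio (padded D)) reverse-permutation ⟨
    product (ratio (padded D)) ≈⟨ product-ratio-padded D ⟩
    1#                         ∎
    where
    Y = flipRows (scaleRows (pivot (padded D)) b₂)
    flip-ratio : Vector ℝ.Carrier _
    flip-ratio i = ratio (padded D) (opposite i)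

  module _ {D : Vector ℕ⁺ r} {g : Matrix ℤ (suc r)} (G : Factored (padded D) g) where
    factored-cell : Cell D
    factored-cell = record
      { γ             = flipRows g
      ; det≡1         = ι-injective (trans (ι-det (flipRows g)) (trans (det-cong decomposed)
                          (trans (det-decomposition D (antitranspose-unipotent (left-unipotent G)) (right-unipotent G)) (sym ι-1))))
      ; b₁            = antitranspose (left G)
      ; b₂            = right G
      ; b₁-unipotent  = antitranspose-unipotent (left-unipotent G)
      ; b₂-unipotent  = right-unipotent G
      ; decomposition = decomposed
      }
      where
      decomposed : mapᴹ fromℤ (flipRows g) ≋ antitranspose (left G) ⊗ c D ⊗ w₀ ⊗ right G
      decomposed i j = trans (factorization G (opposite i) j) (sym (trans
        (bruhat-entry D (antitranspose (left G)) (right G) i j)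
        (sum-cong-≋ λ k → *-congʳ {x = pivot (padded D) k * right G k j} (reflexive (≡.cong (λ □ → left G □ (opposite i)) (opposite-involutive k))))))

    factored-cell-invariant : {U V : Vector ℤ r} → Invariant G U V → Invariant (cell-factored factored-cell) U V
    factored-cell-invariant I = record
      { left-superdiagonal  = λ k → trans (*-congʳ (reflexive (antitranspose-involutive (left G) (inject₁ k) (suc k))))
          (Invariant.left-superdiagonal I k)
      ; right-superdiagonal = Invariant.right-superdiagonal I
      ; product             = Invariant.product I
      }

  padded-coprime : (D : Vector ℕ⁺ r) → (∀ {i j} → i ≢ j → Coprime (value (D i)) (value (D j))) →
    ∀ k → ⟦ padded D (inject₁ k) ⟧ ⊥ ⟦ padded D (suc k) ⟧
  padded-coprime         D coprime zero    = ⊥-sym (⊥-1ʳ _)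
  padded-coprime {suc r} D coprime (suc k) = adjacent D coprime k
    where
    adjacent : ∀ {r} (D : Vector ℕ⁺ (suc r)) → (∀ {i j} → i ≢ j → Coprime (value (D i)) (value (D j))) →
      ∀ k → ⟦ (D ∷ʳ pos 1) (inject₁ k) ⟧ ⊥ ⟦ (D ∷ʳ pos 1) (suc k) ⟧
    adjacent {zero}  D coprime zero    = ⊥-1ʳ _
    adjacent {suc r} D coprime zero    = coprime⇒⊥ (coprime λ ())
    adjacent {suc r} D coprime (suc k) = adjacent (tail D) (λ i≢j → coprime (i≢j ∘ suc-injective)) k

-- Enumeration of the units modulo q and of tuples of indices

record Enumerated {p} (P : Pred (Fin n) p) : Set p where
  field
    size       : ℕ
    member     : Fin size → Fin n
    member-∈   : ∀ i → P (member i)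
    injective  : ∀ {i j} → member i ≡ member j → i ≡ j
    surjective : ∀ {x} → P x → ∃ λ i → member i ≡ x

enumerate : ∀ {p} {P : Pred (Fin n) p} → Decidable P → Enumerated P
enumerate {zero}  P? = record
  { size = 0 ; member = λ () ; member-∈ = λ () ; injective = λ { {()} } ; surjective = λ { {()} } }
enumerate {suc n} P? with P? zero | enumerate (P? ∘ suc)
... | yes p₀ | E = record
  { size       = suc E.size
  ; member     = λ { zero → zero ; (suc i) → suc (E.member i) }
  ; member-∈   = λ { zero → p₀ ; (suc i) → E.member-∈ i }
  ; injective  = λ { {zero} {zero} _ → ≡.refl ; {suc i} {suc j} eq → ≡.cong suc (E.injective (suc-injective eq)) }
  ; surjective = λ { {zero} _ → zero , ≡.refl
                   ; {suc x} p → let i , eq = E.surjective p in suc i , ≡.cong suc eq }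
  }
  where module E = Enumerated E
... | no ¬p₀ | E = record
  { size       = E.size
  ; member     = suc ∘ E.member
  ; member-∈   = E.member-∈
  ; injective  = E.injective ∘ suc-injective
  ; surjective = λ { {zero} p → contradiction p ¬p₀
                   ; {suc x} p → let i , eq = E.surjective p in i , ≡.cong suc eq }
  }
  where module E = Enumerated E

record Units (q : ℕ⁺) : Set where
  field
    size       : ℕ
    unit       : Fin size → ℤ
    unit-⊥     : ∀ i → ⟦ q ⟧ ⊥ unit i
    injective  : ∀ {i j} → unit i ≡ unit j mod ⟦ q ⟧ → i ≡ j
    surjective : ∀ {v} → ⟦ q ⟧ ⊥ v → ∃ λ i → unit i ≡ v mod ⟦ q ⟧

units : ∀ q → Units q
units q = record
  { size       = E.size
  ; unit       = λ i → + toℕ (E.member i)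
  ; unit-⊥     = λ i → coprime⇒⊥ (E.member-∈ i)
  ; injective  = λ {i} {j} eq → E.injective (toℕ-injective (ℤ.+-injective
      (residue-unique q (_ , ≡.refl , toℕ<n (E.member i)) (_ , ≡.refl , toℕ<n (E.member j)) eq)))
  ; surjective = λ {v} q⊥v → surjective q⊥v (residue q v)
  }
  where
  -- For `q = 1` the only residue 0 is coprime to `q`, so there is one unit.
  module E = Enumerated (enumerate (λ (i : Fin (value q)) → coprime? (value q) (toℕ i)))

  surjective : ∀ {v} → ⟦ q ⟧ ⊥ v → (∃ λ j → Residue q j × v ≡ j mod ⟦ q ⟧) →
    ∃ λ i → + toℕ (E.member i) ≡ v mod ⟦ q ⟧
  surjective q⊥v (_ , (k , ≡.refl , k<q) , v≡k) =
    let i , eq = E.surjective {fromℕ< k<q}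
          (⊥⇒coprime (≡.subst (λ □ → ⟦ q ⟧ ⊥ + □) (≡.sym (toℕ-fromℕ< k<q)) (⊥-mod v≡k q⊥v)))
    in i , mod-sym (≡.subst (λ □ → _ ≡ + □ mod ⟦ q ⟧) (≡.sym (≡.trans (≡.cong toℕ eq) (toℕ-fromℕ< k<q))) v≡k)

module Tuples where
  count : Vector ℕ r → ℕ
  count {zero}  s = 1
  count {suc r} s = s zero ℕ.* count (tail s)

  -- Mixed radix digits: tuples are functions, compared pointwise, and are coded by one index so
  -- that `≡` on indices expresses their equality.
  decode : (s : Vector ℕ r) → Fin (count s) → ∀ k → Fin (s k)
  decode {suc r} s t zero    = proj₁ (remQuot {s zero} (count (tail s)) t)
  decode {suc r} s t (suc k) = decode (tail s) (proj₂ (remQuot {s zero} (count (tail s)) t)) k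

  encode : (s : Vector ℕ r) → (∀ k → Fin (s k)) → Fin (count s)
  encode {zero}  s x = zero
  encode {suc r} s x = combine (x zero) (encode (tail s) (x ∘ suc))

  decode-encode : (s : Vector ℕ r) (x : ∀ k → Fin (s k)) → ∀ k → decode s (encode s x) k ≡ x k
  decode-encode {suc r} s x zero    = ≡.cong proj₁ (remQuot-combine (x zero) (encode (tail s) (x ∘ suc)))
  decode-encode {suc r} s x (suc k) = ≡.trans
    (≡.cong (λ □ → decode (tail s) (proj₂ □) k) (remQuot-combine (x zero) (encode (tail s) (x ∘ suc))))
    (decode-encode (tail s) (x ∘ suc) k)

  encode-cong : (s : Vector ℕ r) {x y : ∀ k → Fin (s k)} → (∀ k → x k ≡ y k) → encode s x ≡ encode s y
  encode-cong {zero}  s x≡y = ≡.refl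
  encode-cong {suc r} s x≡y = ≡.cong₂ combine (x≡y zero) (encode-cong (tail s) (x≡y ∘ suc))

  encode-decode : (s : Vector ℕ r) → ∀ t → encode s (decode s t) ≡ t
  encode-decode {zero}  s zero = ≡.refl
  encode-decode {suc r} s t    = ≡.trans
    (≡.cong (combine (decode s t zero)) (encode-decode (tail s) (proj₂ (remQuot {s zero} (count (tail s)) t))))
    (combine-remQuot {s zero} (count (tail s)) t)

  decode-injective : (s : Vector ℕ r) → ∀ {t t′} → (∀ k → decode s t k ≡ decode s t′ k) → t ≡ t′
  decode-injective s {t} {t′} eq =
    ≡.trans (≡.sym (encode-decode s t)) (≡.trans (encode-cong s eq) (encode-decode s t′))

-- Expansion of a product of sums

module ProductOfSums {c ℓ} (R : CommutativeRing c ℓ) where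
  open CommutativeRing R hiding (zero)
  open CommutativeMonoidSum +-commutativeMonoid using (sum; sum-cong-≋)
  open CommutativeMonoidSum *-commutativeMonoid using () renaming (sum to product)
  open SemiringSum semiring using (*-distribˡ-sum; *-distribʳ-sum)
  open SetoidReasoning setoid
  open Tuples

  sum-↑ : ∀ m (f : Fin (m ℕ.+ n) → Carrier) → sum f ≈ sum (λ i → f (i ↑ˡ n)) + sum (λ j → f (m ↑ʳ j))
  sum-↑ zero    f = sym (+-identityˡ _)
  sum-↑ (suc m) f = trans (+-congˡ (sum-↑ m (tail f))) (sym (+-assoc _ _ _))

  sum-combine : ∀ m n (f : Fin (m ℕ.* n) → Carrier) → sum f ≈ sum (λ (i : Fin m) → sum (λ (j : Fin n) → f (combine i j)))
  sum-combine zero    n f = refl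
  sum-combine (suc m) n f = trans (sum-↑ n f) (+-congˡ (sum-combine m n (λ k → f (n ↑ʳ k))))

  product-sum : (s : Vector ℕ r) (f : ∀ k → Fin (s k) → Carrier) →
    product (λ k → sum (f k)) ≈ sum (λ t → product (λ k → f k (decode s t k)))
  product-sum {zero}  s f = sym (+-identityʳ 1#)
  product-sum {suc r} s f = begin
    sum (f zero) * product (λ k → sum (f (suc k)))
      ≈⟨ *-congˡ (product-sum (tail s) (λ k → f (suc k))) ⟩
    sum (f zero) * sum rest
      ≈⟨ *-distribʳ-sum (sum rest) (f zero) ⟩
    sum (λ i → f zero i * sum rest)
      ≈⟨ sum-cong-≋ (λ i → *-distribˡ-sum (f zero i) rest) ⟩
    sum (λ i → sum (λ j → f zero i * rest j))
      ≈⟨ sum-cong-≋ (λ i → sum-cong-≋ λ j → reflexive (≡.cong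
           (λ □ → f zero (proj₁ □) * rest (proj₂ □)) (remQuot-combine {s zero} {count (tail s)} i j))) ⟨
    sum (λ (i : Fin (s zero)) → sum (λ (j : Fin (count (tail s))) → term (combine i j)))
      ≈⟨ sum-combine (s zero) (count (tail s)) term ⟨
    sum term ∎
    where
    rest : Fin (count (tail s)) → Carrier
    rest t = product (λ k → f (suc k) (decode (tail s) t k))

    term : Fin (count s) → Carrier
    term t = product (λ k → f k (decode s t k))

-- Coordinates on the set of double cosets

AdjacentCoprime : Vector ℕ⁺ r → Set
AdjacentCoprime D = ∀ k → ⟦ padded D (inject₁ k) ⟧ ⊥ ⟦ padded D (suc k) ⟧

module Coordinates {a ℓ b m} (𝔼 : Exponential a ℓ b m) where
  open Exponential 𝔼
  open Kloosterman 𝔼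
  open Cells 𝔼
  open Invariant

  interior-padded : (D : Vector ℕ⁺ r) → ∀ k → interior (padded D) k ≡ D k
  interior-padded D k = ∷ʳ-inject₁ D (pos 1) k

  module _ {D : Vector ℕ⁺ r} (coprime : AdjacentCoprime D) where
    private
      P = padded D

      modulo : ∀ {i j : ℤ} k → i ≡ j mod ⟦ interior P k ⟧ → i ≡ j mod ⟦ D k ⟧
      modulo {i} {j} k = ≡.subst (λ p → i ≡ j mod ⟦ p ⟧) (interior-padded D k)

      modulo⁻¹ : ∀ {i j : ℤ} k → i ≡ j mod ⟦ D k ⟧ → i ≡ j mod ⟦ interior P k ⟧
      modulo⁻¹ {i} {j} k = ≡.subst (λ p → i ≡ j mod ⟦ p ⟧) (≡.sym (interior-padded D k))

      P₀≡1 : ∀ j → (pos 1 ∷ tail P) j ≡ P j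
      P₀≡1 zero    = ≡.refl
      P₀≡1 (suc j) = ≡.refl

    opaque
      -- The superdiagonal entries of the reflected `b₁` and of `b₂`, multiplied by `D k`. That
      -- these are integers is known from the reduction to a normal form.
      leftCoordinate rightCoordinate : Cell D → Vector ℤ r
      leftCoordinate  x = proj₁ (invariants P coprime (cell-factored x))
      rightCoordinate x = proj₁ (proj₂ (invariants P coprime (cell-factored x)))

      coordinates-invariant : (x : Cell D) → Invariant (cell-factored x) (leftCoordinate x) (rightCoordinate x)
      coordinates-invariant x = proj₂ (proj₂ (invariants P coprime (cell-factored x)))

    leftCoordinate-eq : (x : Cell D) → ∀ k →
      antitranspose (b₁ x) (inject₁ k) (suc k) ℝ.* fromℤ ⟦ D k ⟧ ℝ.≈ fromℤ (leftCoordinate x k)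
    leftCoordinate-eq x k = ≡.subst
      (λ p → antitranspose (b₁ x) (inject₁ k) (suc k) ℝ.* fromℤ ⟦ p ⟧ ℝ.≈ fromℤ (leftCoordinate x k)) (interior-padded D k)
      (left-superdiagonal (coordinates-invariant x) k)

    rightCoordinate-eq : (x : Cell D) → ∀ k →
      b₂ x (inject₁ k) (suc k) ℝ.* fromℤ ⟦ D k ⟧ ℝ.≈ fromℤ (rightCoordinate x k)
    rightCoordinate-eq x k = ≡.subst
      (λ p → b₂ x (inject₁ k) (suc k) ℝ.* fromℤ ⟦ p ⟧ ℝ.≈ fromℤ (rightCoordinate x k)) (interior-padded D k)
      (right-superdiagonal (coordinates-invariant x) k)

    coordinates-product : (x : Cell D) → ∀ k → leftCoordinate x k ℤ.* rightCoordinate x k ≡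
      ⟦ P (inject₁ (inject₁ k)) ⟧ ℤ.* ⟦ P (suc (suc k)) ⟧ mod ⟦ D k ⟧
    coordinates-product x k = modulo k (≡.subst
      (λ p → leftCoordinate x k ℤ.* rightCoordinate x k ≡ ⟦ p ⟧ ℤ.* ⟦ P (suc (suc k)) ⟧ mod ⟦ interior P k ⟧)
      (P₀≡1 (inject₁ (inject₁ k))) (product (coordinates-invariant x) k))

    rightCoordinate-⊥ : (x : Cell D) → ∀ k → ⟦ D k ⟧ ⊥ rightCoordinate x k
    rightCoordinate-⊥ x k = ≡.subst (λ p → ⟦ p ⟧ ⊥ rightCoordinate x k) (interior-padded D k)
      (product-unit P coprime (coordinates-invariant x) k
        (≡.subst (λ p → ⟦ interior P k ⟧ ⊥ ⟦ p ⟧) (≡.sym (P₀≡1 (inject₁ (inject₁ k)))) (⊥-sym (coprime (inject₁ k)))))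

    ∼⇒≡ : {x y : Cell D} → x ∼ y → ∀ k → rightCoordinate x k ≡ rightCoordinate y k mod ⟦ D k ⟧
    ∼⇒≡ {x} {y} x∼y k = modulo k (mod-sym
      (invariant-≃ (coordinates-invariant x) (coordinates-invariant y) (∼⇒≃ {x = x} {y} x∼y) k))

    ≡⇒∼ : {x y : Cell D} → (∀ k → rightCoordinate x k ≡ rightCoordinate y k mod ⟦ D k ⟧) → x ∼ y
    ≡⇒∼ {x} {y} eq = ≃⇒∼ {x = x} {y}
      (invariant-injective P coprime (coordinates-invariant x) (coordinates-invariant y) (λ k → modulo⁻¹ k (eq k)))

    factored-cell-coordinate : {g : Matrix ℤ (suc r)} (G : Factored P g) {U V : Vector ℤ r} → Invariant G U V →
      ∀ k → rightCoordinate (factored-cell G) k ≡ V k mod ⟦ D k ⟧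
    factored-cell-coordinate {g} G I k = modulo k (invariant-≃ (factored-cell-invariant G I)
      (coordinates-invariant (factored-cell G)) (ℤᴬ.≋⇒≃ {g = flipRows (flipRows g)} ℤᴬ.≋-refl) k)

    Realization : Vector ℤ r → Set _
    Realization V = ∃ λ (x : Cell D) → ∀ k → rightCoordinate x k ≡ V k mod ⟦ D k ⟧

    opaque
      realize-cell : (V : Vector ℤ r) → (∀ k → ⟦ D k ⟧ ⊥ V k) → Realization V
      realize-cell V D⊥V = step (realize P coprime V (λ k → ≡.subst (λ p → ⟦ p ⟧ ⊥ V k) (≡.sym (interior-padded D k)) (D⊥V k)))
        where
        step : (∃ λ g → ∃ λ (G : Factored P g) → ∃₂ λ U V′ → Invariant G U V′ × (∀ k → V′ k ≡ V k mod ⟦ interior P k ⟧)) →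
          Realization V
        step (g , G , U , V′ , I , V′≡V) =
          factored-cell G , λ k → mod-trans (factored-cell-coordinate G I k) (modulo k (V′≡V k))

    enumeration : Enumeration D
    enumeration = record
      { size      = count sizes
      ; element   = element
      ; bijective =
          (λ {t} {t′} t∼t′ → decode-injective sizes λ k → Units.injective (units (D k))
            (mod-trans (mod-sym (element-coordinate t k))
              (mod-trans (∼⇒≡ {x = element t} {element t′} t∼t′ k) (element-coordinate t′ k))))
        , λ y → encode sizes (index y) , λ { ≡.refl → ≡⇒∼ {x = element (encode sizes (index y))} {y} λ k →
            mod-trans (element-coordinate (encode sizes (index y)) k)
              (mod-trans (≡⇒mod (≡.cong (Units.unit (units (D k))) (decode-encode sizes (index y) k)))
                (proj₂ (Units.surjective (units (D k)) (rightCoordinate-⊥ y k)))) }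
      }
      where
      open Tuples

      sizes : Vector ℕ r
      sizes k = Units.size (units (D k))

      realized : ∀ t → ∃ λ (x : Cell D) → ∀ k → rightCoordinate x k ≡ Units.unit (units (D k)) (decode sizes t k) mod ⟦ D k ⟧
      realized t = realize-cell _ (λ k → Units.unit-⊥ (units (D k)) (decode sizes t k))

      element : Fin (count sizes) → Cell D
      element t = proj₁ (realized t)

      element-coordinate : ∀ t k → rightCoordinate (element t) k ≡ Units.unit (units (D k)) (decode sizes t k) mod ⟦ D k ⟧
      element-coordinate t = proj₂ (realized t)

      index : Cell D → ∀ k → Fin (sizes k)
      index y k = proj₁ (Units.surjective (units (D k)) (rightCoordinate-⊥ y k))

-- Comparison of the sums

opposite-inject₁ : (k : Fin n) → opposite (inject₁ k) ≡ suc (opposite k)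
opposite-inject₁ zero    = ≡.refl
opposite-inject₁ (suc k) = ≡.cong inject₁ (opposite-inject₁ k)

-- Makes the coordinates available for n = 2, where the product of the two is 1 modulo `d`.
⟨⟩-coprime : ∀ d → AdjacentCoprime ⟨ d ⟩
⟨⟩-coprime d zero       = ⊥-sym (⊥-1ʳ ⟦ d ⟧)
⟨⟩-coprime d (suc zero) = ⊥-1ʳ ⟦ d ⟧

module Sums {a ℓ b m} (𝔼 : Exponential a ℓ b m) where
  open Exponential 𝔼
  open Kloosterman 𝔼
  open Cells 𝔼
  open Coordinates 𝔼
  open Enumeration
  open Tuples
  open ProductOfSums ℂ using (product-sum)
  open CommutativeMonoidSum ℂ.+-commutativeMonoid using () renaming (sum to ∑; sum-cong-≋ to ∑-cong; sum-permute to ∑-permute)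
  open CommutativeMonoidSum ℂ.*-commutativeMonoid using () renaming (sum-cong-≋ to ∏-cong; ∑-distrib-+ to ∏-distrib-*)
  open CommutativeMonoidSum ℝ.+-commutativeMonoid using (sum-permute)
  open +-*-Solver using () renaming
    (solve to solveᶻ; con to conᶻ; _:=_ to _:=ᶻ_; _:+_ to _:+ᶻ_; _:*_ to _:*ᶻ_; _:-_ to _:-ᶻ_; :-_ to :-ᶻ_)

  e-0 : e ℝ.0# ℂ.≈ ℂ.1#
  e-0 = ℂ.trans (e-cong (ℝ.sym ι-0)) (e-periodic 0ℤ)

  e-sum : (f : Vector ℝ.Carrier n) → e (sum f) ℂ.≈ ∏ (e ∘ f)
  e-sum {zero}  f = e-0
  e-sum {suc n} f = ℂ.trans (e-homo _ _) (ℂ.*-congˡ (e-sum (tail f)))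

  -- Cancelling `d` shows that `x` and `y` differ by the quotient of the congruence, an integer,
  -- which `e` does not see.
  e-mod : ∀ d {x y i j} → x ℝ.* fromℤ ⟦ d ⟧ ℝ.≈ fromℤ i → y ℝ.* fromℤ ⟦ d ⟧ ℝ.≈ fromℤ j → i ≡ j mod ⟦ d ⟧ →
    e x ℂ.≈ e y
  e-mod d {x} {y} {i} {j} xd≈i yd≈j (t by i≡) = begin
    e x                  ≈⟨ e-cong (*-cancelˡ-inverse (inverseʳ d) dx≈d[y+t]) ⟩
    e (y ℝ.+ fromℤ t)    ≈⟨ e-homo y (fromℤ t) ⟩
    e y ℂ.* e (fromℤ t)  ≈⟨ ℂ.*-congˡ (e-periodic t) ⟩
    e y ℂ.* ℂ.1#         ≈⟨ ℂ.*-identityʳ (e y) ⟩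
    e y                  ∎
    where
    open SetoidReasoning ℂ.setoid

    dx≈d[y+t] : fromℤ ⟦ d ⟧ ℝ.* x ℝ.≈ fromℤ ⟦ d ⟧ ℝ.* (y ℝ.+ fromℤ t)
    dx≈d[y+t] = linear₃ᶠ ℝ.1# (ℝ.- ℝ.1#) ℝ.1# xd≈i yd≈j
      (ℝ.trans (ι-cong i≡) (ℝ.trans (ι-+ j (t ℤ.* ⟦ d ⟧)) (ℝ.+-congˡ (ι-* t ⟦ d ⟧))))
      (ℝ.trans (solve 6 (λ d x y t i j → d :* x :- d :* (y :+ t) :=
        con 1ℤ :* (x :* d :- i) :+ :- con 1ℤ :* (y :* d :- j) :+ con 1ℤ :* (i :- (j :+ t :* d))) ℝ.refl
        (fromℤ ⟦ d ⟧) x y (fromℤ t) (fromℤ i) (fromℤ j))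
        (ℝ.+-cong (ℝ.+-cong (ℝ.*-congʳ ι-1) (ℝ.*-congʳ (ℝ.-‿cong ι-1))) (ℝ.*-congʳ ι-1)))

  module _ {D : Vector ℕ⁺ r} where
    summand : Vector ℤ r → Vector ℤ r → Cell D → ℂ.Carrier
    summand M N x = ψ (reverse M) (b₁ x) ℂ.* ψ N (b₂ x)

    leftPhase rightPhase : ℤ → Cell D → Fin r → ℂ.Carrier
    leftPhase  m x k = e (fromℤ m ℝ.* antitranspose (b₁ x) (inject₁ k) (suc k))
    rightPhase m x k = e (fromℤ m ℝ.* b₂ x (inject₁ k) (suc k))

    -- Summing in the opposite order absorbs the reversal of `M` into the reflection of `b₁`, so
    -- that both characters factor over the same index `k`.
    summand-product : ∀ M N x → summand M N x ℂ.≈ ∏ (λ k → leftPhase (M k) x k ℂ.* rightPhase (N k) x k)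
    summand-product M N x = ℂ.trans (ℂ.*-cong (ℂ.trans (e-cong reversed) (e-sum f))
        (e-sum (λ k → fromℤ (N k) ℝ.* b₂ x (inject₁ k) (suc k))))
      (ℂ.sym (∏-distrib-* (λ k → leftPhase (M k) x k) (λ k → rightPhase (N k) x k)))
      where
      f : Vector ℝ.Carrier r
      f k = fromℤ (M k) ℝ.* antitranspose (b₁ x) (inject₁ k) (suc k)

      reversed : sum (λ i → fromℤ (M (opposite i)) ℝ.* b₁ x (inject₁ i) (suc i)) ℝ.≈ sum f
      reversed = ℝ.sym (ℝ.trans (sum-permute f reverse-permutation) (sum-cong-≋ λ i →
        ℝ.*-congˡ {x = fromℤ (M (opposite i))} (ℝ.reflexive (≡.cong₂ (b₁ x)
          (≡.cong inject₁ (opposite-involutive i))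
          (≡.trans (opposite-inject₁ (opposite i)) (≡.cong suc (opposite-involutive i)))))))

  *-clear : ∀ m d i {x} → x ℝ.* fromℤ d ℝ.≈ fromℤ i → fromℤ m ℝ.* x ℝ.* fromℤ d ℝ.≈ fromℤ (m ℤ.* i)
  *-clear m d i xd≈i = ℝ.trans (ℝ.*-assoc _ _ _) (ℝ.trans (ℝ.*-congˡ xd≈i) (ℝ.sym (ι-* m i)))

  module _ {D : Vector ℕ⁺ r} (coprime : AdjacentCoprime D) where
    Matches : Cell D → ∀ k → Cell ⟨ D k ⟩ → Set
    Matches x k y = rightCoordinate coprime x k ≡ rightCoordinate (⟨⟩-coprime (D k)) y zero mod ⟦ D k ⟧

    -- From `U V ≡ p q`, `U′ V′ ≡ 1` and `V ≡ V′` follows `U ≡ p q U′` after cancelling the unit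
    -- `V`; the factor `p q` moves into the frequency as the twist.
    phases-match : ∀ (m n : ℤ) x k y → Matches x k y →
      leftPhase m x k ℂ.* rightPhase n x k ℂ.≈ leftPhase (twist D k m) y zero ℂ.* rightPhase n y zero
    phases-match m n x k y V≡V′ = ℂ.*-cong
      (e-mod (D k)
        (*-clear m ⟦ D k ⟧ U (leftCoordinate-eq coprime x k))
        (*-clear (twist D k m) ⟦ D k ⟧ U′ (leftCoordinate-eq (⟨⟩-coprime (D k)) y zero))
        mU≡twist)
      (e-mod (D k) (*-clear n ⟦ D k ⟧ V (rightCoordinate-eq coprime x k))
        (*-clear n ⟦ D k ⟧ V′ (rightCoordinate-eq (⟨⟩-coprime (D k)) y zero))
        (mod-*ˡ n V≡V′))
      where
      U = leftCoordinate coprime x k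
      V = rightCoordinate coprime x k
      U′ = leftCoordinate (⟨⟩-coprime (D k)) y zero
      V′ = rightCoordinate (⟨⟩-coprime (D k)) y zero
      p = ⟦ padded D (inject₁ (inject₁ k)) ⟧
      q = ⟦ padded D (suc (suc k)) ⟧

      U≡ : U ≡ p ℤ.* q ℤ.* U′ mod ⟦ D k ⟧
      U≡ = mod-cancelˡ (rightCoordinate-⊥ coprime x k)
        (mod-trans (≡⇒mod (ℤ.*-comm V U)) (mod-trans (coordinates-product coprime x k) (mod-sym
          (mod-trans (mod-* V≡V′ mod-refl)
            (mod-trans (≡⇒mod (solveᶻ 3 (λ v c u → v :*ᶻ (c :*ᶻ u) :=ᶻ c :*ᶻ (u :*ᶻ v)) ≡.refl V′ (p ℤ.* q) U′))
              (mod-trans (mod-*ˡ (p ℤ.* q) (coordinates-product (⟨⟩-coprime (D k)) y zero))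
                (≡⇒mod (ℤ.*-identityʳ (p ℤ.* q)))))))))

      mU≡twist : m ℤ.* U ≡ twist D k m ℤ.* U′ mod ⟦ D k ⟧
      mU≡twist = mod-trans (mod-*ˡ m U≡)
        (≡⇒mod (solveᶻ 4 (λ m p q u → m :*ᶻ (p :*ᶻ q :*ᶻ u) :=ᶻ p :*ᶻ m :*ᶻ q :*ᶻ u) ≡.refl m p q U′))

    summand-matches : ∀ M N x (y : ∀ k → Cell ⟨ D k ⟩) → (∀ k → Matches x k (y k)) →
      summand M N x ℂ.≈ ∏ (λ k → summand ⟨ twist D k (M k) ⟩ ⟨ N k ⟩ (y k))
    summand-matches M N x y matches = ℂ.trans (summand-product M N x) (∏-cong λ k →
      ℂ.trans (phases-match (M k) (N k) x k (y k) (matches k))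
        (ℂ.sym (ℂ.trans (summand-product ⟨ twist D k (M k) ⟩ ⟨ N k ⟩ (y k)) (ℂ.*-identityʳ _))))

    module _ (X : Enumeration D) (Y : ∀ k → Enumeration ⟨ D k ⟩) where
      private
        sizes : Vector ℕ r
        sizes k = size (Y k)

        Partner : Cell D → ∀ k → Set
        Partner x k = ∃ λ j → Matches x k (element (Y k) j)

      opaque
        -- A cell with the required coordinate is realized first. The given enumeration contains an
        -- equivalent cell, and equivalence preserves the coordinate modulo `D k`. The same argument
        -- serves for `glue`.
        partner : ∀ x k → Partner x k
        partner x k = choose (realize-cell (⟨⟩-coprime (D k))
          (λ _ → rightCoordinate coprime x k) (λ { zero → rightCoordinate-⊥ coprime x k }))
          where
          choose : Realization (⟨⟩-coprime (D k)) (λ _ → rightCoordinate coprime x k) → Partner x k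
          choose (y , y≡x) = let j , j∼y = proj₂ (bijective (Y k)) y in
            j , mod-sym (mod-trans (∼⇒≡ (⟨⟩-coprime (D k)) {element (Y k) j} {y} (j∼y ≡.refl) zero) (y≡x zero))

        glue : (t : ∀ k → Fin (sizes k)) → ∃ λ i → ∀ k → Matches (element X i) k (element (Y k) (t k))
        glue t = choose (realize-cell coprime (λ k → V k zero)
          (λ k → rightCoordinate-⊥ (⟨⟩-coprime (D k)) (element (Y k) (t k)) zero))
          where
          V : ∀ (k : Fin r) → Vector ℤ 1
          V k = rightCoordinate (⟨⟩-coprime (D k)) (element (Y k) (t k))

          choose : Realization coprime (λ k → V k zero) → ∃ λ i → ∀ k → Matches (element X i) k (element (Y k) (t k))
          choose (x , x≡V) = let i , i∼x = proj₂ (bijective X) x in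
            i , λ k → mod-trans (∼⇒≡ coprime {element X i} {x} (i∼x ≡.refl) k) (x≡V k)

      -- The enumerations are arbitrary, so their indices are related only through matching
      -- coordinates; a match is unique on either side, which makes `split` and `join` inverse to
      -- each other.
      split : Fin (size X) → Fin (count sizes)
      split i = encode sizes (λ k → proj₁ (partner (element X i) k))

      split-matches : ∀ i k → Matches (element X i) k (element (Y k) (decode sizes (split i) k))
      split-matches i k = ≡.subst (λ j → Matches (element X i) k (element (Y k) j))
        (≡.sym (decode-encode sizes (λ k → proj₁ (partner (element X i) k)) k)) (proj₂ (partner (element X i) k))

      join : Fin (count sizes) → Fin (size X)
      join t = proj₁ (glue (decode sizes t))

      Matches-uniqueˡ : ∀ {i i′} {t : ∀ k → Fin (sizes k)} →
        (∀ k → Matches (element X i) k (element (Y k) (t k))) →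
        (∀ k → Matches (element X i′) k (element (Y k) (t k))) → i ≡ i′
      Matches-uniqueˡ {i} {i′} m m′ = proj₁ (bijective X)
        (≡⇒∼ coprime {element X i} {element X i′} λ k → mod-trans (m k) (mod-sym (m′ k)))

      Matches-uniqueʳ : ∀ {x k j j′} → Matches x k (element (Y k) j) → Matches x k (element (Y k) j′) → j ≡ j′
      Matches-uniqueʳ {x} {k} {j} {j′} m m′ = proj₁ (bijective (Y k))
        (≡⇒∼ (⟨⟩-coprime (D k)) {element (Y k) j} {element (Y k) j′} λ { zero → mod-trans (mod-sym m) m′ })

      split-join : ∀ t → split (join t) ≡ t
      split-join t = decode-injective sizes λ k →
        Matches-uniqueʳ {element X (join t)} (split-matches (join t) k) (proj₂ (glue (decode sizes t)) k)

      join-split : ∀ i → join (split i) ≡ i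
      join-split i = Matches-uniqueˡ (proj₂ (glue (decode sizes (split i)))) (split-matches i)

      S-product : ∀ M N → S M N X ℂ.≈ ∏ (λ k → S ⟨ twist D k (M k) ⟩ ⟨ N k ⟩ (Y k))
      S-product M N = begin
        ∑ (λ i → summand M N (element X i))
          ≈⟨ ∑-cong (λ i → summand-matches M N (element X i) (λ k → element (Y k) (decode sizes (split i) k)) (split-matches i)) ⟩
        ∑ (λ i → product-term (split i))
          ≈⟨ ∑-permute product-term (permutation split join split-join join-split) ⟨
        ∑ product-term
          ≈⟨ product-sum sizes (λ k j → summand ⟨ twist D k (M k) ⟩ ⟨ N k ⟩ (element (Y k) j)) ⟨
        ∏ (λ k → S ⟨ twist D k (M k) ⟩ ⟨ N k ⟩ (Y k)) ∎
        where
        open SetoidReasoning ℂ.setoid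
        product-term : Fin (count sizes) → ℂ.Carrier
        product-term t = ∏ (λ k → summand ⟨ twist D k (M k) ⟩ ⟨ N k ⟩ (element (Y k) (decode sizes t k)))

corollary3p11 : ∀ {a ℓ b m} (𝔼 : Exponential a ℓ b m) →
    let open Exponential 𝔼
        open Kloosterman 𝔼
    in
    ∀ (r : ℕ) → 2 ≤ suc r →
    ∀ (M N : Vector ℤ r) (D : Vector ℕ⁺ r) →
    (∀ {i j} → i ≢ j → Coprime (value (D i)) (value (D j))) →
    (Enumeration D × (∀ i → Enumeration ⟨ D i ⟩)) ×
    (∀ (X : Enumeration D) (Y : ∀ i → Enumeration ⟨ D i ⟩) →
      S M N X ℂ.≈ ∏ (λ i → S ⟨ twist D i (M i) ⟩ ⟨ N i ⟩ (Y i)))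
corollary3p11 𝔼 r _ M N D coprime =
  (enumeration adjacent , λ i → enumeration (⟨⟩-coprime (D i))) ,
  λ X Y → S-product adjacent X Y M N
  where
  open Cells 𝔼 using (padded-coprime)
  open Coordinates 𝔼
  open Sums 𝔼
  adjacent = padded-coprime D coprime
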